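{- Let $M$ be a $3$-connected binary matroid, let $N$ be a $3$-connected matroid such that $M$ has a minor isomorphic to $N$, and let $T$ be a triangle of $M$. Then $M$ has a $3$-connected minor $M'$ with $T\subseteq E(M')$ such that $M'$ has a minor $N'$ isomorphic to $N$ with $E(M')-E(N')\subseteq T$.
   Context: A triangle of a matroid is a $3$-element circuit. Minors are obtained by deleting and contracting elements; $E(\cdot)$ denotes the ground set. -}

module Defs where

open import Data.Nat using (ℕ; zero; suc; _+_; _<_; _≤_; _⊔_)
open import Data.Bool using (Bool; true; false; _∧_; _∨_; _xor_; if_then_else_)
open import Data.Fin using (Fin; _≟_)
open import Data.Fin.Subset using (Subset; ⊥; ⁅_⁆; _∈_; _∉_; _⊆_; _⊂_; _∩_; _∪_; _─_; ∁; ∣_∣; Nonempty; Empty)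
open import Data.Vec using (Vec; []; _∷_; replicate; zipWith; tabulate; lookup)
open import Data.List using (List; []; _∷_; map; _++_; foldr)
open import Data.Product using (Σ; _×_; _,_; ∃; ∃-syntax)
open import Relation.Binary.PropositionalEquality using (_≡_; _≢_)
open import Relation.Nullary.Decidable using (⌊_⌋)

-- Finite matroids.  A matroid on the carrier Fin n has a ground set
-- E ⊆ Fin n (so that minors can live on the same carrier) and a
-- (Boolean-valued, i.e. decidable) independence predicate satisfying
-- the independence axioms (I1)-(I3), with independent sets inside E.

record Matroid (n : ℕ) : Set where
  field
    E      : Subset n
    indep  : Subset n → Bool
    indep⊆E    : ∀ X → indep X ≡ true → X ⊆ E
    indep-∅    : indep ⊥ ≡ true
    indep-down : ∀ X Y → Y ⊆ X → indep X ≡ true → indep Y ≡ true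
    indep-aug  : ∀ X Y → indep X ≡ true → indep Y ≡ true → ∣ X ∣ < ∣ Y ∣ →
                 ∃[ e ] (e ∈ Y × e ∉ X × indep (X ∪ ⁅ e ⁆) ≡ true)

open Matroid public

allSubsets : (n : ℕ) → List (Subset n)
allSubsets zero    = [] ∷ []
allSubsets (suc n) = map (false ∷_) (allSubsets n) ++ map (true ∷_) (allSubsets n)

rank : ∀ {n} → Matroid n → Subset n → ℕ
rank {n} M X = foldr (λ Y r → (if indep M (Y ∩ X) then ∣ Y ∩ X ∣ else 0) ⊔ r) 0 (allSubsets n)

IsCircuit : ∀ {n} → Matroid n → Subset n → Set
IsCircuit M C = C ⊆ E M × indep M C ≡ false × (∀ Y → Y ⊂ C → indep M Y ≡ true)

IsTriangle : ∀ {n} → Matroid n → Subset n → Set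
IsTriangle M T = IsCircuit M T × ∣ T ∣ ≡ 3

-- Tutte connectivity.  A k-separation (k ≥ 1) is a partition (X, E−X)
-- of E with |X|, |E−X| ≥ k and r(X) + r(E−X) − r(M) ≤ k − 1
-- (written r(X) + r(E−X) < k + r(E) in ℕ).
-- M is 3-connected if it has no k-separation for k = 1, 2.

IsSeparation : ∀ {n} → Matroid n → ℕ → Subset n → Set
IsSeparation M k X =
  X ⊆ E M × k ≤ ∣ X ∣ × k ≤ ∣ E M ─ X ∣ ×
  rank M X + rank M (E M ─ X) < k + rank M (E M)

ThreeConnected : ∀ {n} → Matroid n → Set
ThreeConnected M = ∀ k X → 1 ≤ k → k < 3 → IsSeparation M k X → Data.Empty.⊥
  where import Data.Empty

-- Binary matroids: representable over GF(2).  Vectors over GF(2) are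
-- Vec Bool r with addition xor; a family (v e)_{e ∈ X} is linearly
-- independent over GF(2) iff no nonempty subfamily sums to 0.

zeroV : ∀ {r} → Vec Bool r
zeroV = replicate _ false

sumOver : ∀ {n r} → Subset n → (Fin n → Vec Bool r) → Vec Bool r
sumOver []           v = zeroV
sumOver (b ∷ Y) v =
  zipWith _xor_ (if b then v Fin.zero else zeroV) (sumOver Y (λ i → v (Fin.suc i)))
  where import Data.Fin as Fin

GF2Independent : ∀ {n r} → (Fin n → Vec Bool r) → Subset n → Set
GF2Independent v X = ∀ Y → Y ⊆ X → Nonempty Y → sumOver Y v ≢ zeroV

IsBinary : ∀ {n} → Matroid n → Set
IsBinary {n} M = Σ ℕ λ r → Σ (Fin n → Vec Bool r) λ v →
  ∀ X → X ⊆ E M → (indep M X ≡ true → GF2Independent v X) × (GF2Independent v X → indep M X ≡ true)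

-- Minors.  N = M / C \ D with C, D disjoint subsets of E(M):
-- E(N) = E(M) − C − D and I is independent in N iff I ⊆ E(N) and
-- r_M(I ∪ C) = |I| + r_M(C)  (i.e. r_{M/C}(I) = |I|).

IsMinor : ∀ {n} → Matroid n → Matroid n → Set
IsMinor {n} M N = Σ (Subset n) λ C → Σ (Subset n) λ D →
  C ⊆ E M × D ⊆ E M × Empty (C ∩ D) ×
  E N ≡ (E M ─ C) ─ D ×
  (∀ I → (indep N I ≡ true → I ⊆ E N × rank M (I ∪ C) ≡ ∣ I ∣ + rank M C)
       × (I ⊆ E N × rank M (I ∪ C) ≡ ∣ I ∣ + rank M C → indep N I ≡ true))

image : ∀ {n m} → (Fin n → Fin m) → Subset n → Subset m
image {n} f X = tabulate λ j →
  foldr _∨_ false (map (λ i → lookup X i ∧ ⌊ f i ≟ j ⌋) (Data.List.allFin n))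
  where import Data.List

Isomorphic : ∀ {n m} → Matroid n → Matroid m → Set
Isomorphic {n} {m} M N = Σ (Fin n → Fin m) λ f →
  (∀ x y → x ∈ E M → y ∈ E M → f x ≡ f y → x ≡ y) ×
  (∀ x → x ∈ E M → f x ∈ E N) ×
  (∀ y → y ∈ E N → ∃[ x ] (x ∈ E M × f x ≡ y)) ×
  (∀ X → X ⊆ E M → indep M X ≡ indep N (image f X))

-- Let N be identified with a restriction of M / D. A set K ⊆ D is good if T has rank two in M / K and no 2-separation of
-- M / K has T on one side and at least two elements of N on the other. If D has an element e outside the closure of
-- K ∪ T, then K ∪ e is good or some 3-separation (X , Y) of M / K with T ⊆ Y has e in the closures of both sides. In the
-- second case all but at most one element of N lies in X, uncrossing finds z ∈ Y − X such that K ∪ z is good, and z can be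
-- contracted in place of e, at the price of moving the element of N in Y to another element of Y. When D is contained in
-- the closure of K ∪ T it can be replaced by K ∪ U with U ⊆ T. Then M / K restricted to T and the elements of N is
-- 3-connected after exchanging parallel elements, unless some further element can be contracted outside the closure of
-- K ∪ T; here it is used that every hyperplane of a binary matroid meets T.
-- If N has at most three elements, it is a minor of the triangle or consists of three parallel elements. In the latter
-- case the same uncrossing, inside a hyperplane that contains T, yields the minor M(K₄) with triangle T.

module Submission where

-- The contractions `M / K` need not be 3-connected. What is kept is weaker: no 2-separation parts
-- the triangle from `N`. It is stated for covers of `E` by two sets that may overlap, so that it
-- applies to closures and to unions and intersections, and uncrossing needs no choice of
-- complements. The obstacle is an element of `D` in the closure of `K ∪ T`, whose contraction would
-- collapse the triangle. Since E(M′) - E(N′) may be any part of `T`, such elements are traded for a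
-- subset `U` of `T` that remains in `M′` and is contracted only on the way from `M′` to `N′`. The
-- bound of four elements makes `N` simple. It also guarantees that, when each of two separations
-- leaves at most one element of `N` outside its first side, the two first sides still share two
-- elements of `N`. Termination comes from the rank of `K`, which grows with every contraction
-- outside the closure of `K ∪ T`.

open import Defs
open import Data.Bool using (Bool; true; false; _∧_; _∨_; _xor_; not; T; if_then_else_)
import Data.Bool as Bool
open import Data.Bool.ListAction using (all)
open import Data.Bool.Properties using (xor-assoc; xor-comm; xor-same; xor-identityˡ; ¬-not)
open import Data.Empty using (⊥; ⊥-elim)
open import Data.Fin using (Fin; zero; suc; _≟_)
open import Data.Fin.Properties using (any?)
open import Data.Fin.Subset using (Subset; _∈_; _∉_; _⊆_; _⊂_; _∪_; _∩_; _─_; ⁅_⁆; ∣_∣; Nonempty) renaming (⊥ to ∅)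
open import Data.Fin.Subset.Properties
open import Data.List using (List; []; _∷_; _++_; map; foldr; allFin)
open import Data.List.Membership.Propositional using () renaming (_∈_ to _∈ₗ_)
open import Data.List.Membership.Propositional.Properties using (∈-++⁺ˡ; ∈-++⁺ʳ; ∈-map⁺; ∈-allFin)
open import Data.List.Relation.Unary.Any using (here; there)
open import Data.Maybe using (Maybe; just; nothing)
open import Data.Nat using (ℕ; zero; suc; _+_; _∸_; _≤_; _<_; z≤n; s≤s; _≤ᵇ_; _≤?_)
import Data.Nat as ℕ
open import Data.Nat.Properties hiding (_≟_; _≤?_; _<?_)
open import Algebra.Properties.CommutativeSemigroup +-commutativeSemigroup using (interchange; x∙yz≈y∙xz; x∙yz≈xz∙y; xy∙z≈xz∙y)
open import Data.Product using (Σ; ∃-syntax; _×_; _,_; proj₁; proj₂)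
open import Data.Sum using (_⊎_; inj₁; inj₂; [_,_]′)
open import Data.Unit using (⊤; tt)
open import Data.Vec using (Vec; []; _∷_; lookup; tabulate; zipWith)
import Data.Vec as Vec
open import Data.Vec.Properties using (lookup-zipWith; lookup-replicate; lookup-map; lookup∘tabulate; lookup⇒[]=; []=⇒lookup; zipWith-assoc; zipWith-comm; zipWith-identityˡ; ≡-dec)
open import Function using (_∘_; case_of_)
open import Relation.Binary.PropositionalEquality hiding (J)
open import Relation.Nullary
open import Relation.Nullary.Decidable using (⌊_⌋; _×-dec_)

-- Deciding inclusions and rank inequalities

infixr 6 _⊔_
infixr 7 _⊓_
infixl 5 _∖_
infixl 6 _⊞_
infix 4 _⊑_ _≼_

data SetExpr (k : ℕ) : Set where
  var         : Fin k → SetExpr k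
  ∅ˢ          : SetExpr k
  _⊔_ _⊓_ _∖_ : SetExpr k → SetExpr k → SetExpr k

data RankExpr (k : ℕ) : Set where
  ρ   : SetExpr k → RankExpr k
  #_  : ℕ → RankExpr k
  _⊞_ : RankExpr k → RankExpr k → RankExpr k

-- A sequent is decided by computation. Inclusions are compared on the rows of a truth table; for an inequality
-- between ranks, all hypotheses are added up, each used exactly once, and what remains is matched set by set.
-- The hypothesis sub A B is the submodular inequality for A and B; it needs no proof.
data Claim (k : ℕ) : Set where
  _⊑_ : SetExpr k → SetExpr k → Claim k
  _≼_ : RankExpr k → RankExpr k → Claim k
  sub : SetExpr k → SetExpr k → Claim k

infixr 3 _⇒_
infix 3 ⊢_

data Sequent (k : ℕ) : Set where
  ⊢_  : Claim k → Sequent k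
  _⇒_ : Claim k → Sequent k → Sequent k

private
  diff-lookup : ∀ {n} (p q : Subset n) i → lookup (p ─ q) i ≡ lookup p i ∧ not (lookup q i)
  diff-lookup (false ∷ p) (false ∷ q) zero = refl
  diff-lookup (false ∷ p) (true ∷ q) zero = refl
  diff-lookup (true ∷ p) (false ∷ q) zero = refl
  diff-lookup (true ∷ p) (true ∷ q) zero = refl
  diff-lookup (_ ∷ p) (_ ∷ q) (suc i) = diff-lookup p q i

⟦_⟧ : ∀ {k n} → SetExpr k → Vec (Subset n) k → Subset n
⟦ var i ⟧ env = lookup env i
⟦ ∅ˢ ⟧ env = ∅
⟦ a ⊔ b ⟧ env = ⟦ a ⟧ env ∪ ⟦ b ⟧ env
⟦ a ⊓ b ⟧ env = ⟦ a ⟧ env ∩ ⟦ b ⟧ env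
⟦ a ∖ b ⟧ env = ⟦ a ⟧ env ─ ⟦ b ⟧ env

-- The membership pattern of one element of the carrier in the variable sets.
Row : ℕ → Set
Row k = Vec Bool k

eval : ∀ {k} → SetExpr k → Row k → Bool
eval (var i) a = lookup a i
eval ∅ˢ a = false
eval (x ⊔ y) a = eval x a ∨ eval y a
eval (x ⊓ y) a = eval x a ∧ eval y a
eval (x ∖ y) a = eval x a ∧ not (eval y a)

at : ∀ {k n} → Vec (Subset n) k → Fin n → Row k
at env i = Vec.map (λ s → lookup s i) env

eval-sound : ∀ {k n} (e : SetExpr k) (env : Vec (Subset n) k) i → lookup (⟦ e ⟧ env) i ≡ eval e (at env i)
eval-sound (var j) env i = sym (lookup-map j _ env)
eval-sound ∅ˢ env i = lookup-replicate i false
eval-sound (a ⊔ b) env i = trans (lookup-zipWith _∨_ i (⟦ a ⟧ env) (⟦ b ⟧ env)) (cong₂ _∨_ (eval-sound a env i) (eval-sound b env i))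
eval-sound (a ⊓ b) env i = trans (lookup-zipWith _∧_ i (⟦ a ⟧ env) (⟦ b ⟧ env)) (cong₂ _∧_ (eval-sound a env i) (eval-sound b env i))
eval-sound (a ∖ b) env i = trans (diff-lookup (⟦ a ⟧ env) (⟦ b ⟧ env) i) (cong₂ (λ x y → x ∧ not y) (eval-sound a env i) (eval-sound b env i))

rows : ∀ k → List (Row k)
rows zero = [] ∷ []
rows (suc k) = map (false ∷_) (rows k) ++ map (true ∷_) (rows k)

rows-complete : ∀ {k} (a : Row k) → a ∈ₗ rows k
rows-complete [] = here refl
rows-complete (false ∷ a) = ∈-++⁺ˡ (∈-map⁺ _ (rows-complete a))
rows-complete {suc k} (true ∷ a) = ∈-++⁺ʳ (map (false ∷_) (rows k)) (∈-map⁺ _ (rows-complete a))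

_⊃ᵇ_ : Bool → Bool → Bool
true ⊃ᵇ b = b
false ⊃ᵇ b = true

keep : ∀ {A : Set} → (A → Bool) → List A → List A
keep p [] = []
keep p (x ∷ xs) = if p x then x ∷ keep p xs else keep p xs

keep-∈ : ∀ {A : Set} (p : A → Bool) {x xs} → x ∈ₗ xs → p x ≡ true → x ∈ₗ keep p xs
keep-∈ p {x} (here refl) eq rewrite eq = here refl
keep-∈ p {xs = y ∷ _} (there h) eq with p y
... | true = there (keep-∈ p h eq)
... | false = keep-∈ p h eq

valid : ∀ {k} → Sequent k → List (Row k)
valid {k} (⊢ _) = rows k
valid ((a ⊑ b) ⇒ s) = keep (λ x → eval a x ⊃ᵇ eval b x) (valid s)
valid (_ ⇒ s) = valid s

included : ∀ {k} → List (Row k) → SetExpr k → SetExpr k → Bool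
included V a b = all (λ x → eval a x ⊃ᵇ eval b x) V

goal : ∀ {k} → Sequent k → Claim k
goal (⊢ c) = c
goal (_ ⇒ s) = goal s

Sum : ℕ → Set
Sum k = List (SetExpr k) × ℕ

_⊕_ : ∀ {k} → Sum k → Sum k → Sum k
(a , m) ⊕ (b , n) = a ++ b , m + n

flatten : ∀ {k} → RankExpr k → Sum k
flatten (ρ e) = e ∷ [] , 0
flatten (# m) = [] , m
flatten (a ⊞ b) = flatten a ⊕ flatten b

-- The hypotheses together bound the sum `smaller` by the sum `larger`. A goal a ≤ b therefore
-- follows by cancellation once a plus `larger` is dominated by b plus `smaller`.
smaller larger : ∀ {k} → Sequent k → Sum k
smaller (⊢ _) = [] , 0
smaller ((a ≼ b) ⇒ s) = flatten a ⊕ smaller s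
smaller (sub a b ⇒ s) = ((a ⊓ b) ∷ (a ⊔ b) ∷ [] , 0) ⊕ smaller s
smaller (_ ⇒ s) = smaller s
larger (⊢ _) = [] , 0
larger ((a ≼ b) ⇒ s) = flatten b ⊕ larger s
larger (sub a b ⇒ s) = (a ∷ b ∷ [] , 0) ⊕ larger s
larger (_ ⇒ s) = larger s

module _ {A : Set} (rel : A → A → Bool) where

  remove : A → List A → Maybe (List A)
  remove a [] = nothing
  remove a (b ∷ bs) with rel a b | remove a bs
  ... | true  | _ = just bs
  ... | false | just cs = just (b ∷ cs)
  ... | false | nothing = nothing

  cancel : List A → List A → List A × List A
  cancel [] bs = [] , bs
  cancel (a ∷ as) bs with remove a bs
  ... | just cs = cancel as cs
  ... | nothing = a ∷ proj₁ (cancel as bs) , proj₂ (cancel as bs)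

  -- A backtracking search for an injection of the left sets into the right ones. Sets left over on
  -- the right do no harm, because ranks are nonnegative; `pre` collects the candidates already
  -- passed over.
  match : List A → List A → Bool
  pick : A → List A → List A → List A → Bool
  match [] bs = true
  match (a ∷ as) bs = pick a as [] bs
  pick a as pre [] = false
  pick a as pre (b ∷ bs) = (rel a b ∧ match as (pre ++ bs)) ∨ pick a as (pre ++ b ∷ []) bs

same : ∀ {k} → List (Row k) → SetExpr k → SetExpr k → Bool
same V a b = included V a b ∧ included V b a

-- Equal sets are cancelled before the remaining sets on the left are matched with supersets.
dominated : ∀ {k} → List (Row k) → Sum k → Sum k → Bool
dominated V (a , m) (b , n) with cancel (same V) a b
... | a′ , b′ = match (included V) a′ b′ ∧ (m ≤ᵇ n)

check : ∀ {k} → Sequent k → Bool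
check s with goal s
... | a ⊑ b = included (valid s) a b
... | a ≼ b = dominated (valid s) (flatten a ⊕ larger s) (flatten b ⊕ smaller s)
... | sub a b = true

NAry : ℕ → ℕ → Set → Set
NAry zero k R = R
NAry (suc m) k R = SetExpr k → NAry m k R

applyAll : ∀ {m k R} → NAry m k R → Vec (SetExpr k) m → R
applyAll f [] = f
applyAll f (x ∷ xs) = applyAll (f x) xs

Curried : ∀ {A : Set} k → (Vec A k → Set) → Set
Curried zero P = P []
Curried {A} (suc k) P = (x : A) → Curried k (λ xs → P (x ∷ xs))

curried : ∀ {A : Set} k {P : Vec A k → Set} → (∀ xs → P xs) → Curried k P
curried zero f = f []
curried (suc k) f x = curried k (λ xs → f (x ∷ xs))

module RankSolver {n : ℕ} (r : Subset n → ℕ)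
  (r-mono : ∀ {A B} → A ⊆ B → r A ≤ r B)
  (r-sub : ∀ A B → r (A ∪ B) + r (A ∩ B) ≤ r A + r B) where

  module _ {k} (env : Vec (Subset n) k) where

    ⟦_⟧ʳ : RankExpr k → ℕ
    ⟦ ρ e ⟧ʳ = r (⟦ e ⟧ env)
    ⟦ # m ⟧ʳ = m
    ⟦ a ⊞ b ⟧ʳ = ⟦ a ⟧ʳ + ⟦ b ⟧ʳ

    ⟦_⟧ᶜ : Claim k → Set
    ⟦ a ⊑ b ⟧ᶜ = ⟦ a ⟧ env ⊆ ⟦ b ⟧ env
    ⟦ a ≼ b ⟧ᶜ = ⟦ a ⟧ʳ ≤ ⟦ b ⟧ʳ
    ⟦ sub a b ⟧ᶜ = ⊤

    Provides : Claim k → Set → Set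
    Provides (sub a b) R = R
    Provides c R = ⟦ c ⟧ᶜ → R

    Statement : Sequent k → Set
    Statement (⊢ c) = ⟦ c ⟧ᶜ
    Statement (c ⇒ s) = Provides c (Statement s)

    sumL : List (SetExpr k) → ℕ
    sumL [] = 0
    sumL (e ∷ es) = r (⟦ e ⟧ env) + sumL es

    sumΣ : Sum k → ℕ
    sumΣ (es , m) = sumL es + m

    sumL-++ : ∀ a b → sumL (a ++ b) ≡ sumL a + sumL b
    sumL-++ [] b = refl
    sumL-++ (x ∷ a) b = trans (cong (_ +_) (sumL-++ a b)) (sym (+-assoc (r _) (sumL a) (sumL b)))

    sum-⊕ : ∀ s t → sumΣ (s ⊕ t) ≡ sumΣ s + sumΣ t
    sum-⊕ (a , m) (b , m′) = trans (cong (_+ (m + m′)) (sumL-++ a b)) (interchange (sumL a) (sumL b) m m′)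

    sum-flatten : ∀ e → sumΣ (flatten e) ≡ ⟦ e ⟧ʳ
    sum-flatten (ρ e) = trans (+-identityʳ _) (+-identityʳ _)
    sum-flatten (# m) = refl
    sum-flatten (a ⊞ b) = trans (sum-⊕ (flatten a) (flatten b)) (cong₂ _+_ (sum-flatten a) (sum-flatten b))

    Facts : Sequent k → Set
    Facts (⊢ c) = ⊤
    Facts (c ⇒ s) = ⟦ c ⟧ᶜ × Facts s

    ⟦_⟧-mem : ∀ e {i} → i ∈ ⟦ e ⟧ env → eval e (at env i) ≡ true
    ⟦ e ⟧-mem {i} h = trans (sym (eval-sound e env i)) ([]=⇒lookup h)

    mem-⟦_⟧ : ∀ e {i} → eval e (at env i) ≡ true → i ∈ ⟦ e ⟧ env
    mem-⟦ e ⟧ {i} h = lookup⇒[]= i _ (trans (eval-sound e env i) h)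

    row-valid : ∀ s → Facts s → ∀ i → at env i ∈ₗ valid s
    row-valid (⊢ _) fs i = rows-complete (at env i)
    row-valid ((a ⊑ b) ⇒ s) (f , fs) i = keep-∈ _ (row-valid s fs i) (imp (eval a (at env i)) refl)
      where
      imp : ∀ u → eval a (at env i) ≡ u → (eval a (at env i) ⊃ᵇ eval b (at env i)) ≡ true
      imp true eq rewrite eq = ⟦ b ⟧-mem (f (mem-⟦ a ⟧ eq))
      imp false eq rewrite eq = refl
    row-valid ((_ ≼ _) ⇒ s) (_ , fs) i = row-valid s fs i
    row-valid (sub _ _ ⇒ s) (_ , fs) i = row-valid s fs i

    all-∈ : ∀ {B : Set} (p : B → Bool) {x xs} → T (all p xs) → x ∈ₗ xs → T (p x)
    all-∈ p {xs = y ∷ ys} h (here refl) with p y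
    ... | true = tt
    all-∈ p {xs = y ∷ ys} h (there m) with p y
    ... | true = all-∈ p h m

    included-sound : ∀ V → (∀ i → at env i ∈ₗ V) → ∀ a b → T (included V a b) → ⟦ a ⟧ env ⊆ ⟦ b ⟧ env
    included-sound V all∈ a b h {i} m = mem-⟦ b ⟧ (mp (all-∈ (λ x → eval a x ⊃ᵇ eval b x) h (all∈ i)) (⟦ a ⟧-mem m))
      where
      mp : ∀ {u v} → T (u ⊃ᵇ v) → u ≡ true → v ≡ true
      mp {true} {true} _ _ = refl

    ∧-T : ∀ {a b} → T (a ∧ b) → T a × T b
    ∧-T {true} {true} _ = tt , tt

    ∨-T : ∀ {a b} → T (a ∨ b) → T a ⊎ T b
    ∨-T {true} _ = inj₁ tt
    ∨-T {false} h = inj₂ h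

    module _ (rel : SetExpr k → SetExpr k → Bool) (sound : ∀ a b → T (rel a b) → ⟦ a ⟧ env ⊆ ⟦ b ⟧ env) where

      remove-sound : ∀ a bs {cs} → remove rel a bs ≡ just cs → r (⟦ a ⟧ env) + sumL cs ≤ sumL bs
      remove-sound a (b ∷ bs) eq with rel a b in e | remove rel a bs in e′
      remove-sound a (b ∷ bs) refl | true | _ = +-monoˡ-≤ (sumL bs) (r-mono (sound a b (subst T (sym e) tt)))
      remove-sound a (b ∷ bs) refl | false | just cs =
        ≤-trans (≤-reflexive (x∙yz≈y∙xz (r (⟦ a ⟧ env)) (r (⟦ b ⟧ env)) (sumL cs)))
                (+-monoʳ-≤ (r (⟦ b ⟧ env)) (remove-sound a bs e′))

      cancel-sound : ∀ as bs → sumL as + sumL (proj₂ (cancel rel as bs)) ≤ sumL (proj₁ (cancel rel as bs)) + sumL bs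
      cancel-sound [] bs = ≤-refl
      cancel-sound (a ∷ as) bs with remove rel a bs in e
      ... | just cs = begin
        r (⟦ a ⟧ env) + sumL as + sumL (proj₂ (cancel rel as cs))   ≡⟨ +-assoc (r (⟦ a ⟧ env)) (sumL as) _ ⟩
        r (⟦ a ⟧ env) + (sumL as + sumL (proj₂ (cancel rel as cs))) ≤⟨ +-monoʳ-≤ (r (⟦ a ⟧ env)) (cancel-sound as cs) ⟩
        r (⟦ a ⟧ env) + (sumL (proj₁ (cancel rel as cs)) + sumL cs) ≡⟨ x∙yz≈y∙xz (r (⟦ a ⟧ env)) (sumL (proj₁ (cancel rel as cs))) (sumL cs) ⟩
        sumL (proj₁ (cancel rel as cs)) + (r (⟦ a ⟧ env) + sumL cs) ≤⟨ +-monoʳ-≤ (sumL (proj₁ (cancel rel as cs))) (remove-sound a bs e) ⟩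
        sumL (proj₁ (cancel rel as cs)) + sumL bs ∎
        where open ≤-Reasoning
      ... | nothing = begin
        r (⟦ a ⟧ env) + sumL as + sumL (proj₂ (cancel rel as bs))   ≡⟨ +-assoc (r (⟦ a ⟧ env)) (sumL as) _ ⟩
        r (⟦ a ⟧ env) + (sumL as + sumL (proj₂ (cancel rel as bs))) ≤⟨ +-monoʳ-≤ (r (⟦ a ⟧ env)) (cancel-sound as bs) ⟩
        r (⟦ a ⟧ env) + (sumL (proj₁ (cancel rel as bs)) + sumL bs) ≡⟨ sym (+-assoc (r (⟦ a ⟧ env)) (sumL (proj₁ (cancel rel as bs))) (sumL bs)) ⟩
        r (⟦ a ⟧ env) + sumL (proj₁ (cancel rel as bs)) + sumL bs ∎
        where open ≤-Reasoning

      match-sound : ∀ as bs → T (match rel as bs) → sumL as ≤ sumL bs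
      pick-sound : ∀ a as pre bs → T (pick rel a as pre bs) → r (⟦ a ⟧ env) + sumL as ≤ sumL pre + sumL bs
      match-sound [] bs h = z≤n
      match-sound (a ∷ as) bs h = pick-sound a as [] bs h
      pick-sound a as pre (b ∷ bs) h with ∨-T {rel a b ∧ match rel as (pre ++ bs)} h
      ... | inj₁ h′ = begin
        r (⟦ a ⟧ env) + sumL as               ≤⟨ +-mono-≤ (r-mono (sound a b (proj₁ (∧-T h′)))) (match-sound as (pre ++ bs) (proj₂
            (∧-T {rel a b} h′))) ⟩
        r (⟦ b ⟧ env) + sumL (pre ++ bs)      ≡⟨ cong (r (⟦ b ⟧ env) +_) (sumL-++ pre bs) ⟩
        r (⟦ b ⟧ env) + (sumL pre + sumL bs)  ≡⟨ x∙yz≈y∙xz (r (⟦ b ⟧ env)) (sumL pre) (sumL bs) ⟩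
        sumL pre + (r (⟦ b ⟧ env) + sumL bs) ∎
        where open ≤-Reasoning
      ... | inj₂ h′ = begin
        r (⟦ a ⟧ env) + sumL as                   ≤⟨ pick-sound a as (pre ++ b ∷ []) bs h′ ⟩
        sumL (pre ++ b ∷ []) + sumL bs            ≡⟨ cong (_+ sumL bs) (sumL-++ pre (b ∷ [])) ⟩
        sumL pre + (r (⟦ b ⟧ env) + 0) + sumL bs  ≡⟨ cong (λ z → sumL pre + z + sumL bs) (+-identityʳ _) ⟩
        sumL pre + r (⟦ b ⟧ env) + sumL bs        ≡⟨ +-assoc (sumL pre) (r (⟦ b ⟧ env)) (sumL bs) ⟩
        sumL pre + (r (⟦ b ⟧ env) + sumL bs) ∎
        where open ≤-Reasoning

    dominated-sound : ∀ V → (∀ i → at env i ∈ₗ V) → ∀ s t → T (dominated V s t) → sumΣ s ≤ sumΣ t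
    dominated-sound V all∈ (a , m) (b , m′) h = +-mono-≤ sets (≤ᵇ⇒≤ m m′ (proj₂ (∧-T {match (included V) a₁ b₁} h)))
      where
      inc = included-sound V all∈
      a₁ b₁ : List (SetExpr k)
      a₁ = proj₁ (cancel (same V) a b)
      b₁ = proj₂ (cancel (same V) a b)
      sets : sumL a ≤ sumL b
      sets = +-cancelʳ-≤ (sumL b₁) _ _ (≤-trans (cancel-sound (same V) (λ x y t → inc x y (proj₁ (∧-T t))) a b)
        (≤-trans (≤-reflexive (+-comm (sumL a₁) _)) (+-monoʳ-≤ (sumL b) (match-sound (included V) inc a₁ b₁ (proj₁ (∧-T h))))))

    hyps-sound : ∀ s → Facts s → sumΣ (smaller s) ≤ sumΣ (larger s)
    hyps-sound (⊢ _) fs = ≤-refl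
    hyps-sound ((_ ⊑ _) ⇒ s) (_ , fs) = hyps-sound s fs
    hyps-sound ((a ≼ b) ⇒ s) (f , fs) = subst₂ _≤_
      (sym (trans (sum-⊕ (flatten a) (smaller s)) (cong (_+ _) (sum-flatten a))))
      (sym (trans (sum-⊕ (flatten b) (larger s)) (cong (_+ _) (sum-flatten b))))
      (+-mono-≤ f (hyps-sound s fs))
    hyps-sound (sub a b ⇒ s) (_ , fs) = subst₂ _≤_
      (sym (trans (sum-⊕ ((a ⊓ b) ∷ (a ⊔ b) ∷ [] , 0) (smaller s)) (cong (_+ sumΣ (smaller s)) (two (a ⊓ b) (a ⊔ b)))))
      (sym (trans (sum-⊕ (a ∷ b ∷ [] , 0) (larger s)) (cong (_+ sumΣ (larger s)) (two a b))))
      (+-mono-≤ (≤-trans (≤-reflexive (+-comm (r (⟦ a ⊓ b ⟧ env)) (r (⟦ a ⊔ b ⟧ env)))) (r-sub (⟦ a ⟧ env) (⟦ b ⟧ env))) (hyps-sound s fs))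
      where
      two : ∀ x y → sumΣ (x ∷ y ∷ [] , 0) ≡ r (⟦ x ⟧ env) + r (⟦ y ⟧ env)
      two x y = trans (+-identityʳ _) (cong (r (⟦ x ⟧ env) +_) (+-identityʳ _))

    check-sound : ∀ s → T (check s) → Facts s → ⟦ goal s ⟧ᶜ
    check-sound s h fs with goal s
    ... | a ⊑ b = included-sound (valid s) (row-valid s fs) a b h
    ... | sub a b = tt
    ... | a ≼ b = +-cancelʳ-≤ (sumΣ (larger s)) _ _ (begin
        ⟦ a ⟧ʳ + sumΣ (larger s)  ≡⟨ trans (cong (_+ _) (sym (sum-flatten a))) (sym (sum-⊕ (flatten a) (larger s))) ⟩
        sumΣ (flatten a ⊕ larger s) ≤⟨ dominated-sound (valid s) (row-valid s fs) (flatten a ⊕ larger s) (flatten b ⊕ smaller s) h ⟩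
        sumΣ (flatten b ⊕ smaller s) ≡⟨ trans (sum-⊕ (flatten b) (smaller s)) (cong (_+ _) (sum-flatten b)) ⟩
        ⟦ b ⟧ʳ + sumΣ (smaller s) ≤⟨ +-monoʳ-≤ ⟦ b ⟧ʳ (hyps-sound s fs) ⟩
        ⟦ b ⟧ʳ + sumΣ (larger s) ∎)
        where open ≤-Reasoning

    supply : ∀ s → (Facts s → ⟦ goal s ⟧ᶜ) → Statement s
    supply (⊢ c) f = f tt
    supply ((a ⊑ b) ⇒ s) f h = supply s (λ fs → f ((λ {x} → h {x}) , fs))
    supply ((a ≼ b) ⇒ s) f h = supply s (λ fs → f (h , fs))
    supply (sub a b ⇒ s) f = supply s (λ fs → f (tt , fs))

  -- The implicit argument reduces to the unit type whenever the check succeeds, so a use names only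
  -- the sequent, the sets and the proofs of the hypotheses.
  by-rank : ∀ k (f : NAry k k (Sequent k)) → let s = applyAll f (Vec.tabulate var) in
            {_ : T (check s)} → Curried k (λ env → Statement env s)
  by-rank k f {h} = curried k (λ env → supply env s (check-sound env s h))
    where s = applyAll f (Vec.tabulate var)

-- The zero function is monotone and submodular, so the same procedure serves for pure inclusions.
module SetSolver {n : ℕ} = RankSolver {n} (λ _ → 0) (λ _ → ≤-refl) (λ _ _ → ≤-refl)

module S {n} = SetSolver {n}

-- Finite subsets and images

sing⊆ : ∀ {n} {x : Fin n} {A} → x ∈ A → ⁅ x ⁆ ⊆ A
sing⊆ {x = x} h {y} m rewrite x∈⁅y⁆⇒x≡y x m = h

∈∪ˡ : ∀ {n} {x : Fin n} {A B} → x ∈ A → x ∈ A ∪ B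
∈∪ˡ {A = A} {B} = p⊆p∪q B

∈∪ʳ : ∀ {n} {x : Fin n} {A B} → x ∈ B → x ∈ A ∪ B
∈∪ʳ {A = A} {B} = q⊆p∪q A B

∈∪⁻ : ∀ {n} {x : Fin n} {A B} → x ∈ A ∪ B → x ∈ A ⊎ x ∈ B
∈∪⁻ {A = A} {B} = x∈p∪q⁻ A B

∈∩⁻ : ∀ {n} {x : Fin n} {A B} → x ∈ A ∩ B → x ∈ A × x ∈ B
∈∩⁻ {A = A} {B} = x∈p∩q⁻ A B

∈∩ : ∀ {n} {x : Fin n} {A B} → x ∈ A → x ∈ B → x ∈ A ∩ B
∈∩ a b = x∈p∩q⁺ (a , b)

∈─⁻ : ∀ {n} {x : Fin n} {A B} → x ∈ A ─ B → x ∈ A × x ∉ B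
∈─⁻ {x = x} {A} {B} h = S.by-rank 2 (λ a b → ⊢ (a ∖ b) ⊑ a) A B h , λ b →
  ∉⊥ (S.by-rank 2 (λ a b → ⊢ ((a ∖ b) ⊓ b) ⊑ ∅ˢ) A B (∈∩ h b))

∪-lub : ∀ {n} {A B C : Subset n} → A ⊆ C → B ⊆ C → A ∪ B ⊆ C
∪-lub f g = [ f , g ]′ ∘ ∈∪⁻

subset-induction : ∀ {n} (P : Subset n → Set) → P ∅ → (∀ A x → x ∉ A → P A → P (A ∪ ⁅ x ⁆)) → ∀ A → P A
subset-induction {n} P base step A = go ∣ A ∣ A ≤-refl
  where
  go : ∀ m A → ∣ A ∣ ≤ m → P A
  go m A bound with nonempty? A
  ... | no empty = subst P (sym (Empty-unique empty)) base
  go zero A bound | yes (x , x∈A) = ⊥-elim (case ≤-trans (s≤s z≤n) (≤-trans (x∈p⇒∣p-x∣<∣p∣ x∈A) bound) of λ ())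
  go (suc m) A bound | yes (x , x∈A) = subst P
    (⊆-antisym (S.by-rank 2 (λ a s → s ⊑ a ⇒ ⊢ ((a ∖ s) ⊔ s) ⊑ a) A ⁅ x ⁆ (sing⊆ x∈A))
               (S.by-rank 2 (λ a s → ⊢ a ⊑ ((a ∖ s) ⊔ s)) A ⁅ x ⁆))
    (step (A ─ ⁅ x ⁆) x (λ h → proj₂ (∈─⁻ h) (x∈⁅x⁆ x))
      (go m (A ─ ⁅ x ⁆) (≤-pred (≤-trans (x∈p⇒∣p-x∣<∣p∣ x∈A) bound))))

-- A discrete intermediate value argument: when the elements of `Y` are added to `B` one at a time,
-- `Q` must break at some single insertion.
last-good : ∀ {n} {Q : Subset n → Set} → (∀ A → Dec (Q A)) → ∀ B Y → Q B → ¬ Q (B ∪ Y) →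
            ∃[ A ] ∃[ y ] (B ⊆ A × A ⊆ B ∪ Y × y ∈ Y × Q A × ¬ Q (A ∪ ⁅ y ⁆))
last-good {n} {Q} Q? B Y qB = subset-induction
  (λ Y → ¬ Q (B ∪ Y) → Result Y) (λ h → ⊥-elim (h (subst Q (sym (∪-identityʳ B)) qB))) step Y
  where
  Result : Subset n → Set
  Result Y = ∃[ A ] ∃[ y ] (B ⊆ A × A ⊆ B ∪ Y × y ∈ Y × Q A × ¬ Q (A ∪ ⁅ y ⁆))
  step : ∀ Y y → y ∉ Y → (¬ Q (B ∪ Y) → Result Y) → ¬ Q (B ∪ (Y ∪ ⁅ y ⁆)) → Result (Y ∪ ⁅ y ⁆)
  step Y y _ ih h with Q? (B ∪ Y)
  ... | yes q = B ∪ Y , y , p⊆p∪q Y , S.by-rank 3 (λ b u v → ⊢ (b ⊔ u) ⊑ (b ⊔ (u ⊔ v))) B Y ⁅ y ⁆ ,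
                ∈∪ʳ (x∈⁅x⁆ y) , q , λ q′ → h (subst Q (∪-assoc B Y ⁅ y ⁆) q′)
  ... | no ¬q with ih ¬q
  ...   | A , z , B⊆A , A⊆ , z∈ , q , ¬q′ =
          A , z , B⊆A , S.by-rank 4 (λ a b u v → a ⊑ (b ⊔ u) ⇒ ⊢ a ⊑ (b ⊔ (u ⊔ v))) A B Y ⁅ y ⁆ A⊆ ,
          ∈∪ˡ z∈ , q , ¬q′

card-modular : ∀ {n} (A B : Subset n) → ∣ A ∪ B ∣ + ∣ A ∩ B ∣ ≡ ∣ A ∣ + ∣ B ∣
card-modular [] [] = refl
card-modular (false ∷ A) (false ∷ B) = card-modular A B
card-modular (false ∷ A) (true ∷ B) = trans (cong suc (card-modular A B)) (sym (+-suc _ _))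
card-modular (true ∷ A) (false ∷ B) = cong suc (card-modular A B)
card-modular (true ∷ A) (true ∷ B) = cong suc (trans (+-suc _ _) (trans (cong suc (card-modular A B)) (sym (+-suc _ _))))

module CardSolver {n} = RankSolver {n} ∣_∣ p⊆q⇒∣p∣≤∣q∣ (λ A B → ≤-reflexive (card-modular A B))

card-∪ : ∀ {n} (A B : Subset n) → (A ∩ B) ⊆ ∅ → ∣ A ∪ B ∣ ≡ ∣ A ∣ + ∣ B ∣
card-∪ {n} A B disjoint = trans (sym (+-identityʳ _)) (trans (cong (∣ A ∪ B ∣ +_) (sym zero-∩)) (card-modular A B))
  where
  zero-∩ : ∣ A ∩ B ∣ ≡ 0
  zero-∩ = n≤0⇒n≡0 (≤-trans (p⊆q⇒∣p∣≤∣q∣ disjoint) (≤-reflexive (∣⊥∣≡0 n)))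

card-split : ∀ {n} (A B : Subset n) → ∣ A ∣ ≡ ∣ A ∩ B ∣ + ∣ A ─ B ∣
card-split A B = trans (cong ∣_∣ (⊆-antisym (S.by-rank 2 (λ a b → ⊢ a ⊑ ((a ⊓ b) ⊔ (a ∖ b))) A B)
                                            (S.by-rank 2 (λ a b → ⊢ ((a ⊓ b) ⊔ (a ∖ b)) ⊑ a) A B)))
  (card-∪ (A ∩ B) (A ─ B) (S.by-rank 2 (λ a b → ⊢ ((a ⊓ b) ⊓ (a ∖ b)) ⊑ ∅ˢ) A B))

card-insert : ∀ {n} (A : Subset n) x → x ∉ A → ∣ A ∪ ⁅ x ⁆ ∣ ≡ suc ∣ A ∣
card-insert A x x∉A = trans (card-∪ A ⁅ x ⁆ disjoint) (trans (cong (∣ A ∣ +_) (∣⁅x⁆∣≡1 x)) (+-comm ∣ A ∣ 1))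
  where
  disjoint : (A ∩ ⁅ x ⁆) ⊆ ∅
  disjoint h with ∈∩⁻ h
  ... | a , s rewrite x∈⁅y⁆⇒x≡y x s = ⊥-elim (x∉A a)

card-≥⇒⊇ : ∀ {n} {A B : Subset n} → A ⊆ B → ∣ B ∣ ≤ ∣ A ∣ → B ⊆ A
card-≥⇒⊇ {A = A} {B} A⊆B h {x} x∈B with x ∈? A
... | yes x∈A = x∈A
... | no x∉A = ⊥-elim (<-irrefl refl (≤-trans (p⊂q⇒∣p∣<∣q∣ (A⊆B , x , x∈B , x∉A)) h))

card-pos : ∀ {n} {A : Subset n} → 1 ≤ ∣ A ∣ → Nonempty A
card-pos {n} {A} h with nonempty? A
... | yes p = p
... | no empty = ⊥-elim (<-irrefl refl (≤-trans h (≤-reflexive (trans (cong ∣_∣ (Empty-unique empty)) (∣⊥∣≡0 n)))))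

card-two : ∀ {n} {A : Subset n} → 2 ≤ ∣ A ∣ → ∃[ x ] ∃[ y ] (x ∈ A × y ∈ A × x ≢ y)
card-two {A = A} h with card-pos (≤-trans (s≤s z≤n) h)
... | x , x∈A with card-pos {A = A ─ ⁅ x ⁆} (+-cancelˡ-≤ 1 1 _ (≤-trans h (≤-trans
        (≤-reflexive (card-split A ⁅ x ⁆)) (+-monoˡ-≤ _ (≤-trans (p⊆q⇒∣p∣≤∣q∣ (p∩q⊆q A ⁅ x ⁆)) (≤-reflexive (∣⁅x⁆∣≡1 x)))))))
... | y , y∈ = x , y , x∈A , proj₁ (∈─⁻ y∈) , λ { refl → proj₂ (∈─⁻ y∈) (x∈⁅x⁆ x) }

two-card : ∀ {n} {A : Subset n} {x y} → x ∈ A → y ∈ A → x ≢ y → 2 ≤ ∣ A ∣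
two-card {A = A} {x} {y} x∈ y∈ x≢y = ≤-trans
  (≤-reflexive (sym (trans (card-insert ⁅ x ⁆ y (λ h → x≢y (sym (x∈⁅y⁆⇒x≡y x h)))) (cong suc (∣⁅x⁆∣≡1 x)))))
  (p⊆q⇒∣p∣≤∣q∣ (∪-lub (sing⊆ x∈) (sing⊆ y∈)))

card-one : ∀ {n} {A : Subset n} → ∣ A ∣ ≤ 1 → ∀ {x y} → x ∈ A → y ∈ A → x ≡ y
card-one h {x} {y} x∈ y∈ with x ≟ y
... | yes e = e
... | no ne = ⊥-elim (<-irrefl refl (≤-trans (two-card x∈ y∈ ne) h))

subset-of-size : ∀ {n} (A : Subset n) j → j ≤ ∣ A ∣ → ∃[ B ] (B ⊆ A × ∣ B ∣ ≡ j)
subset-of-size {n} = subset-induction (λ A → ∀ j → j ≤ ∣ A ∣ → ∃[ B ] (B ⊆ A × ∣ B ∣ ≡ j))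
  (λ j h → ∅ , (λ m → m) , trans (∣⊥∣≡0 n) (sym (n≤0⇒n≡0 (≤-trans h (≤-reflexive (∣⊥∣≡0 n))))))
  step
  where
  step : ∀ A x → x ∉ A → (∀ j → j ≤ ∣ A ∣ → ∃[ B ] (B ⊆ A × ∣ B ∣ ≡ j)) → ∀ j → j ≤ ∣ A ∪ ⁅ x ⁆ ∣ → ∃[ B ] (B ⊆ A ∪ ⁅ x ⁆ × ∣ B ∣ ≡ j)
  step A x x∉A ih j h with m≤n⇒m<n∨m≡n h
  ... | inj₂ eq = A ∪ ⁅ x ⁆ , (λ m → m) , sym eq
  ... | inj₁ lt = let B , B⊆A , e = ih j (≤-pred (≤-trans lt (≤-reflexive (card-insert A x x∉A)))) in
                  B , (λ m → ∈∪ˡ (B⊆A m)) , e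

private
  or⁺ : ∀ {A : Set} (p : A → Bool) {x xs} → x ∈ₗ xs → p x ≡ true → foldr _∨_ false (map p xs) ≡ true
  or⁺ p {x} (here refl) eq rewrite eq = refl
  or⁺ p {xs = y ∷ ys} (there m) eq with p y
  ... | true = refl
  ... | false = or⁺ p m eq

  or⁻ : ∀ {A : Set} (p : A → Bool) xs → foldr _∨_ false (map p xs) ≡ true → ∃[ x ] p x ≡ true
  or⁻ p (x ∷ xs) h with p x in eq
  ... | true = x , eq
  ... | false = or⁻ p xs h

holds : ∀ {P : Set} (d : Dec P) → P → ⌊ d ⌋ ≡ true
holds (yes _) _ = refl
holds (no ¬p) p = ⊥-elim (¬p p)

image⁺ : ∀ {n m} (f : Fin n → Fin m) A {x} → x ∈ A → f x ∈ image f A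
image⁺ {n} f A {x} h = lookup⇒[]= (f x) _ (trans (lookup∘tabulate _ (f x))
  (or⁺ _ (∈-allFin x) (cong₂ _∧_ ([]=⇒lookup h) (holds (f x ≟ f x) refl))))

image⁻ : ∀ {n m} (f : Fin n → Fin m) A {y} → y ∈ image f A → ∃[ x ] (x ∈ A × f x ≡ y)
image⁻ {n} f A {y} h with or⁻ (λ i → lookup A i ∧ ⌊ f i ≟ y ⌋) (allFin n) (trans (sym (lookup∘tabulate _ y)) ([]=⇒lookup h))
... | x , eq with lookup A x in e₁ | f x ≟ y
... | true | yes e₂ = x , lookup⇒[]= x A e₁ , e₂

image-∪ : ∀ {n m} (f : Fin n → Fin m) A B → image f (A ∪ B) ≡ image f A ∪ image f B
image-∪ f A B = ⊆-antisym fwd (∪-lub bwdˡ bwdʳ)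
  where
  fwd : image f (A ∪ B) ⊆ image f A ∪ image f B
  fwd h with image⁻ f (A ∪ B) h
  ... | x , x∈ , refl = [ (λ a → p⊆p∪q (image f B) (image⁺ f A a)) , (λ b → q⊆p∪q (image f A) (image f B) (image⁺ f B b)) ]′ (x∈p∪q⁻ A B x∈)
  bwdˡ : image f A ⊆ image f (A ∪ B)
  bwdˡ h with image⁻ f A h
  ... | x , x∈ , refl = image⁺ f (A ∪ B) (p⊆p∪q B x∈)
  bwdʳ : image f B ⊆ image f (A ∪ B)
  bwdʳ h with image⁻ f B h
  ... | x , x∈ , refl = image⁺ f (A ∪ B) (q⊆p∪q A B x∈)

image-sing : ∀ {n m} (f : Fin n → Fin m) x → image f ⁅ x ⁆ ≡ ⁅ f x ⁆
image-sing f x = ⊆-antisym fwd (sing⊆ (image⁺ f ⁅ x ⁆ (x∈⁅x⁆ x)))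
  where
  fwd : image f ⁅ x ⁆ ⊆ ⁅ f x ⁆
  fwd h with image⁻ f ⁅ x ⁆ h
  ... | y , y∈ , refl rewrite x∈⁅y⁆⇒x≡y x y∈ = x∈⁅x⁆ (f x)

image-∅ : ∀ {n m} (f : Fin n → Fin m) → image f ∅ ≡ ∅
image-∅ f = Empty-unique λ { (y , h) → ∉⊥ (proj₁ (proj₂ (image⁻ f ∅ h))) }

image-mono : ∀ {n m} {f g : Fin n → Fin m} A {B} → (∀ {x} → x ∈ A → f x ≡ g x) → A ⊆ B → image f A ⊆ image g B
image-mono {f = f} {g} A {B} e A⊆B h with image⁻ f A h
... | x , x∈ , refl = subst (_∈ image g B) (sym (e x∈)) (image⁺ g B (A⊆B x∈))

image-cong : ∀ {n m} {f g : Fin n → Fin m} A → (∀ {x} → x ∈ A → f x ≡ g x) → image f A ≡ image g A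
image-cong {f = f} {g} A e = ⊆-antisym (image-mono {f = f} A e (λ h → h)) (image-mono {f = g} {f} A (λ h → sym (e h)) (λ h → h))

InjectiveOn : ∀ {n m} → (Fin n → Fin m) → Subset n → Set
InjectiveOn f A = ∀ {x y} → x ∈ A → y ∈ A → f x ≡ f y → x ≡ y

card-image : ∀ {n m} (f : Fin n → Fin m) A → InjectiveOn f A → ∣ image f A ∣ ≡ ∣ A ∣
card-image {n} {m} f = subset-induction (λ A → InjectiveOn f A → ∣ image f A ∣ ≡ ∣ A ∣)
  (λ _ → trans (cong ∣_∣ (image-∅ f)) (trans (∣⊥∣≡0 m) (sym (∣⊥∣≡0 n))))
  (λ A x x∉A ih inj → trans (cong ∣_∣ (trans (image-∪ f A ⁅ x ⁆) (cong (image f A ∪_) (image-sing f x))))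
    (trans (card-insert (image f A) (f x) (λ h → case image⁻ f A h of λ where
             (y , y∈ , e) → x∉A (subst (_∈ A) (inj (∈∪ˡ y∈) (∈∪ʳ (x∈⁅x⁆ x)) e) y∈)))
      (trans (cong suc (ih (λ a b → inj (∈∪ˡ a) (∈∪ˡ b)))) (sym (card-insert A x x∉A)))))

preimage : ∀ {n m} → (Fin n → Fin m) → Subset m → Subset n
preimage f B = tabulate (λ i → lookup B (f i))

preimage⁺ : ∀ {n m} (f : Fin n → Fin m) {B x} → f x ∈ B → x ∈ preimage f B
preimage⁺ f {B} {x} h = lookup⇒[]= x _ (trans (lookup∘tabulate _ x) ([]=⇒lookup h))

preimage⁻ : ∀ {n m} (f : Fin n → Fin m) {B x} → x ∈ preimage f B → f x ∈ B
preimage⁻ f {B} {x} h = lookup⇒[]= (f x) _ (trans (sym (lookup∘tabulate _ x)) ([]=⇒lookup h))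

image-preimage : ∀ {n m} (f : Fin n → Fin m) {A B} → B ⊆ image f A → image f (A ∩ preimage f B) ≡ B
image-preimage f {A} {B} B⊆ = ⊆-antisym fwd bwd
  where
  fwd : image f (A ∩ preimage f B) ⊆ B
  fwd h with image⁻ f (A ∩ preimage f B) h
  ... | x , x∈ , refl = preimage⁻ f (proj₂ (x∈p∩q⁻ A (preimage f B) x∈))
  bwd : B ⊆ image f (A ∩ preimage f B)
  bwd h with image⁻ f A (B⊆ h)
  ... | x , x∈ , refl = image⁺ f (A ∩ preimage f B) (x∈p∩q⁺ (x∈ , preimage⁺ f h))

_[_↦_] : ∀ {n m} → (Fin n → Fin m) → Fin n → Fin m → Fin n → Fin m
(f [ x ↦ y ]) z with z ≟ x
... | yes _ = y
... | no _ = f z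

update-at : ∀ {n m} (f : Fin n → Fin m) x y → (f [ x ↦ y ]) x ≡ y
update-at f x y with x ≟ x
... | yes _ = refl
... | no ne = ⊥-elim (ne refl)

update-off : ∀ {n m} (f : Fin n → Fin m) x y {z} → z ≢ x → (f [ x ↦ y ]) z ≡ f z
update-off f x y {z} ne with z ≟ x
... | yes e = ⊥-elim (ne e)
... | no _ = refl

record Bijects {n m} (f : Fin n → Fin m) (A : Subset n) (B : Subset m) : Set where
  constructor bijects
  field
    inj : InjectiveOn f A
    into : ∀ {x} → x ∈ A → f x ∈ B
    onto : ∀ {y} → y ∈ B → ∃[ x ] (x ∈ A × f x ≡ y)

open Bijects public

bijects-extend : ∀ {n m} {f : Fin n → Fin m} {A B} x y → x ∉ A → y ∉ B → Bijects f A B →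
                 Bijects (f [ x ↦ y ]) (A ∪ ⁅ x ⁆) (B ∪ ⁅ y ⁆)
bijects-extend {f = f} {A} {B} x y x∉A y∉B b = bijects inj′ into′ onto′
  where
  g = f [ x ↦ y ]
  off : ∀ {z} → z ∈ A → g z ≡ f z
  off z∈ = update-off f x y (λ { refl → x∉A z∈ })
  at-x : ∀ {z} → z ∈ ⁅ x ⁆ → g z ≡ y
  at-x h rewrite x∈⁅y⁆⇒x≡y x h = update-at f x y
  inj′ : InjectiveOn g (A ∪ ⁅ x ⁆)
  inj′ {u} {v} hu hv e with ∈∪⁻ hu | ∈∪⁻ hv
  ... | inj₁ a | inj₁ c = inj b a c (trans (sym (off a)) (trans e (off c)))
  ... | inj₁ a | inj₂ c = ⊥-elim (y∉B (subst (_∈ B) (trans (sym (off a)) (trans e (at-x c))) (into b a)))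
  ... | inj₂ a | inj₁ c = ⊥-elim (y∉B (subst (_∈ B) (trans (sym (off c)) (trans (sym e) (at-x a))) (into b c)))
  ... | inj₂ a | inj₂ c = trans (x∈⁅y⁆⇒x≡y x a) (sym (x∈⁅y⁆⇒x≡y x c))
  into′ : ∀ {z} → z ∈ A ∪ ⁅ x ⁆ → g z ∈ B ∪ ⁅ y ⁆
  into′ h with ∈∪⁻ h
  ... | inj₁ a = ∈∪ˡ (subst (_∈ B) (sym (off a)) (into b a))
  ... | inj₂ a = ∈∪ʳ (subst (_∈ ⁅ y ⁆) (sym (at-x a)) (x∈⁅x⁆ y))
  onto′ : ∀ {w} → w ∈ B ∪ ⁅ y ⁆ → ∃[ z ] (z ∈ A ∪ ⁅ x ⁆ × g z ≡ w)
  onto′ h with ∈∪⁻ h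
  ... | inj₁ c = let z , z∈ , e = onto b c in z , ∈∪ˡ z∈ , trans (off z∈) e
  ... | inj₂ c = x , ∈∪ʳ (x∈⁅x⁆ x) , trans (update-at f x y) (sym (x∈⁅y⁆⇒x≡y y c))

-- The initial map only serves to show that Fin m is inhabited when Fin n is.
equal-size⇒bijects : ∀ {n m} → (Fin n → Fin m) → ∀ A (B : Subset m) → ∣ A ∣ ≡ ∣ B ∣ → ∃[ f ] Bijects {n} f A B
equal-size⇒bijects {n} {m} f₀ = subset-induction (λ A → ∀ (B : Subset m) → ∣ A ∣ ≡ ∣ B ∣ → ∃[ f ] Bijects f A B)
  (λ B e → f₀ , bijects (λ h → ⊥-elim (∉⊥ h)) (λ h → ⊥-elim (∉⊥ h))
    (λ {y} h → ⊥-elim (<-irrefl refl (≤-trans (≤-trans (s≤s z≤n) (x∈p⇒∣p-x∣<∣p∣ h)) (≤-reflexive (trans (sym e) (∣⊥∣≡0 n)))))))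
  step
  where
  step : ∀ A x → x ∉ A → (∀ (B : Subset m) → ∣ A ∣ ≡ ∣ B ∣ → ∃[ f ] Bijects f A B) →
         ∀ (B : Subset m) → ∣ A ∪ ⁅ x ⁆ ∣ ≡ ∣ B ∣ → ∃[ f ] Bijects f (A ∪ ⁅ x ⁆) B
  step A x x∉A ih B e with card-pos {A = B} (≤-trans (s≤s z≤n) (≤-reflexive (trans (sym (card-insert A x x∉A)) e)))
  ... | y , y∈B = let f , b = ih (B ─ ⁅ y ⁆) size in
                  f [ x ↦ y ] , subst (Bijects (f [ x ↦ y ]) (A ∪ ⁅ x ⁆)) B≡ (bijects-extend x y x∉A y∉ b)
    where
    y∉ : y ∉ B ─ ⁅ y ⁆
    y∉ h = proj₂ (∈─⁻ h) (x∈⁅x⁆ y)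
    B≡ : (B ─ ⁅ y ⁆) ∪ ⁅ y ⁆ ≡ B
    B≡ = ⊆-antisym (S.by-rank 2 (λ a s → s ⊑ a ⇒ ⊢ ((a ∖ s) ⊔ s) ⊑ a) B ⁅ y ⁆ (sing⊆ y∈B))
                   (S.by-rank 2 (λ a s → ⊢ a ⊑ ((a ∖ s) ⊔ s)) B ⁅ y ⁆)
    size : ∣ A ∣ ≡ ∣ B ─ ⁅ y ⁆ ∣
    size = suc-injective (trans (sym (card-insert A x x∉A)) (trans e
             (trans (cong ∣_∣ (sym B≡)) (card-insert (B ─ ⁅ y ⁆) y y∉))))

-- Rank functions and matroids

-- The axioms mention no ground set. For the rank of a matroid on `E` the elements outside `E`
-- behave as loops, so minors never require a change of carrier.
record IsRank {n} (r : Subset n → ℕ) : Set where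
  field
    r-∅    : r ∅ ≡ 0
    r-mono : ∀ {A B} → A ⊆ B → r A ≤ r B
    r-sub  : ∀ A B → r (A ∪ B) + r (A ∩ B) ≤ r A + r B
    r-sing : ∀ x → r ⁅ x ⁆ ≤ 1

module RankTheory {n} {r : Subset n → ℕ} (isRank : IsRank r) where
  open IsRank isRank public
  open RankSolver r r-mono r-sub public using (by-rank)

  insert-≤ : ∀ A x → r (A ∪ ⁅ x ⁆) ≤ r A + 1
  insert-≤ A x = by-rank 2 (λ a s → ρ s ≼ # 1 ⇒ sub a s ⇒ ⊢ ρ (a ⊔ s) ≼ ρ a ⊞ # 1) A ⁅ x ⁆ (r-sing x)

  absorb : ∀ A B → (∀ {x} → x ∈ B → r (A ∪ ⁅ x ⁆) ≤ r A) → r (A ∪ B) ≤ r A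
  absorb A = subset-induction (λ B → (∀ {x} → x ∈ B → r (A ∪ ⁅ x ⁆) ≤ r A) → r (A ∪ B) ≤ r A)
    (λ _ → r-mono (∪-lub (λ m → m) (λ m → ⊥-elim (∉⊥ m))))
    (λ B x _ ih h → by-rank 3
      (λ a b s → ρ (a ⊔ b) ≼ ρ a ⇒ ρ (a ⊔ s) ≼ ρ a ⇒ sub (a ⊔ b) (a ⊔ s) ⇒ ⊢ ρ (a ⊔ (b ⊔ s)) ≼ ρ a)
      A B ⁅ x ⁆ (ih (λ m → h (p⊆p∪q ⁅ x ⁆ m))) (h (q⊆p∪q B ⁅ x ⁆ (x∈⁅x⁆ x))))

  cl : Subset n → Subset n
  cl A = tabulate (λ x → ⌊ r (A ∪ ⁅ x ⁆) ≤? r A ⌋)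

  cl⁺ : ∀ A {x} → r (A ∪ ⁅ x ⁆) ≤ r A → x ∈ cl A
  cl⁺ A {x} h = lookup⇒[]= x _ (trans (lookup∘tabulate _ x) (holds (_ ≤? _) h))

  cl⁻ : ∀ A {x} → x ∈ cl A → r (A ∪ ⁅ x ⁆) ≤ r A
  cl⁻ A {x} h with r (A ∪ ⁅ x ⁆) ≤? r A | trans (sym (lookup∘tabulate (λ x → ⌊ r (A ∪ ⁅ x ⁆) ≤? r A ⌋) x)) ([]=⇒lookup h)
  ... | yes le | _ = le

  ∉cl⁻ : ∀ A {x} → x ∉ cl A → r A + 1 ≤ r (A ∪ ⁅ x ⁆)
  ∉cl⁻ A {x} h = subst (_≤ r (A ∪ ⁅ x ⁆)) (+-comm 1 (r A)) (≰⇒> (λ le → h (cl⁺ A le)))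

  ∉cl⁺ : ∀ A {x} → r A + 1 ≤ r (A ∪ ⁅ x ⁆) → x ∉ cl A
  ∉cl⁺ A h m = <-irrefl refl (≤-trans (≤-trans (≤-reflexive (+-comm 1 (r A))) h) (cl⁻ A m))

  ⊆cl : ∀ A → A ⊆ cl A
  ⊆cl A {x} m = cl⁺ A (r-mono (∪-lub (λ h → h) (sing⊆ m)))

  r-cl : ∀ A → r (cl A) ≤ r A
  r-cl A = ≤-trans (r-mono (q⊆p∪q A (cl A))) (absorb A (cl A) (λ m → cl⁻ A m))

  cl-mono : ∀ {A B} → A ⊆ B → cl A ⊆ cl B
  cl-mono {A} {B} A⊆B {x} m = cl⁺ B (by-rank 3
    (λ a b s → a ⊑ b ⇒ ρ (a ⊔ s) ≼ ρ a ⇒ sub b (a ⊔ s) ⇒ ⊢ ρ (b ⊔ s) ≼ ρ b) A B ⁅ x ⁆ A⊆B (cl⁻ A m))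

  outside-two : ∀ E A B → ¬ E ⊆ cl A ∪ cl B → ∃[ z ] (z ∈ E × z ∉ cl A × z ∉ cl B)
  outside-two E A B h with any? (λ z → (z ∈? E) ×-dec (¬? (z ∈? cl A) ×-dec ¬? (z ∈? cl B)))
  ... | yes w = w
  ... | no none = ⊥-elim (h λ {z} m → case z ∈? cl A of λ where
        (yes a) → p⊆p∪q (cl B) a
        (no ¬a) → case z ∈? cl B of λ where
          (yes b) → q⊆p∪q (cl A) (cl B) b
          (no ¬b) → ⊥-elim (none (z , m , ¬a , ¬b)))

  outside : ∀ A B → r A < r (A ∪ B) → ∃[ z ] (z ∈ B × z ∉ cl A)
  outside A B h with any? (λ z → (z ∈? B) ×-dec ¬? (z ∈? cl A))
  ... | yes w = w
  ... | no none = ⊥-elim (<-irrefl refl (≤-trans h (absorb A B (λ {z} m → case z ∈? cl A of λ where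
        (yes c) → cl⁻ A c
        (no ¬c) → ⊥-elim (none (z , m , ¬c))))))

  union-≤ : ∀ A B → r (A ∪ B) ≤ r A + ∣ B ∣
  union-≤ A = subset-induction (λ B → r (A ∪ B) ≤ r A + ∣ B ∣)
    (≤-trans (r-mono (∪-lub (λ m → m) (λ m → ⊥-elim (∉⊥ m)))) (m≤m+n _ _))
    (λ B x x∉B ih → ≤-trans (≤-reflexive (cong r (sym (∪-assoc A B ⁅ x ⁆)))) (≤-trans (insert-≤ (A ∪ B) x)
      (≤-trans (+-monoˡ-≤ 1 ih) (≤-reflexive (trans (+-assoc (r A) ∣ B ∣ 1) (cong (r A +_) (trans (+-comm ∣ B ∣ 1) (sym (card-insert B x x∉B)))))))))

  r≤card : ∀ A → r A ≤ ∣ A ∣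
  r≤card A = ≤-trans (r-mono (q⊆p∪q ∅ A)) (≤-trans (union-≤ ∅ A) (≤-reflexive (cong (_+ ∣ A ∣) r-∅)))

  contracted : Subset n → Subset n → ℕ
  contracted K A = r (A ∪ K) ∸ r K

  contracted-+ : ∀ K A → contracted K A + r K ≡ r (A ∪ K)
  contracted-+ K A = m∸n+n≡m (r-mono (q⊆p∪q A K))

  contracted-isRank : ∀ K → IsRank (contracted K)
  contracted-isRank K = record
    { r-∅ = trans (cong (λ X → r X ∸ r K) (∪-identityˡ K)) (n∸n≡0 (r K))
    ; r-mono = λ {A} {B} h → ∸-monoˡ-≤ (r K) (by-rank 3 (λ a b k → a ⊑ b ⇒ ⊢ ρ (a ⊔ k) ≼ ρ (b ⊔ k)) A B K h)
    ; r-sub = λ A B → +-cancelʳ-≤ (r K + r K) _ _ (subst₂ _≤_ (split (A ∪ B) (A ∩ B)) (split A B)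
        (by-rank 3 (λ a b k → sub (a ⊔ k) (b ⊔ k) ⇒ ⊢ ρ ((a ⊔ b) ⊔ k) ⊞ ρ ((a ⊓ b) ⊔ k) ≼ ρ (a ⊔ k) ⊞ ρ (b ⊔ k)) A B K))
    ; r-sing = λ x → +-cancelʳ-≤ (r K) _ _ (≤-trans (≤-reflexive (contracted-+ K ⁅ x ⁆))
        (by-rank 2 (λ s k → ρ s ≼ # 1 ⇒ sub s k ⇒ ⊢ ρ (s ⊔ k) ≼ # 1 ⊞ ρ k) ⁅ x ⁆ K (r-sing x)))
    }
    where
    split : ∀ A B → r (A ∪ K) + r (B ∪ K) ≡ contracted K A + contracted K B + (r K + r K)
    split A B = trans (sym (cong₂ _+_ (contracted-+ K A) (contracted-+ K B))) (interchange (contracted K A) (r K) (contracted K B) (r K))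

  basis : ∀ X → ∃[ Y ] (Y ⊆ X × r Y ≡ ∣ Y ∣ × r Y ≡ r X)
  basis = subset-induction (λ X → ∃[ Y ] (Y ⊆ X × r Y ≡ ∣ Y ∣ × r Y ≡ r X))
    (∅ , (λ m → m) , trans r-∅ (sym (∣⊥∣≡0 n)) , refl) step
    where
    step : ∀ X x → x ∉ X → ∃[ Y ] (Y ⊆ X × r Y ≡ ∣ Y ∣ × r Y ≡ r X) →
           ∃[ Y ] (Y ⊆ X ∪ ⁅ x ⁆ × r Y ≡ ∣ Y ∣ × r Y ≡ r (X ∪ ⁅ x ⁆))
    step X x x∉X (Y , Y⊆X , free , full) with x ∈? cl X
    ... | yes x∈cl = Y , (λ m → p⊆p∪q ⁅ x ⁆ (Y⊆X m)) , free , trans full (≤-antisym (r-mono (p⊆p∪q ⁅ x ⁆)) (cl⁻ X x∈cl))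
    ... | no x∉cl = Y ∪ ⁅ x ⁆ , S.by-rank 3 (λ a b s → a ⊑ b ⇒ ⊢ (a ⊔ s) ⊑ (b ⊔ s)) Y X ⁅ x ⁆ Y⊆X ,
                    trans grow (trans (cong (_+ 1) free) (trans (+-comm ∣ Y ∣ 1) (sym (card-insert Y x (x∉X ∘ Y⊆X))))) ,
                    trans grow (trans (cong (_+ 1) full) (sym growX))
      where
      growX : r (X ∪ ⁅ x ⁆) ≡ r X + 1
      growX = ≤-antisym (insert-≤ X x) (∉cl⁻ X x∉cl)
      grow : r (Y ∪ ⁅ x ⁆) ≡ r Y + 1
      grow = ≤-antisym (insert-≤ Y x) (∉cl⁻ Y (λ m → x∉cl (cl-mono Y⊆X m)))

  -- The rank rises by at most one with each inserted element, so no value is skipped.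
  rank-intermediate : ∀ A B m → r A ≤ m → m ≤ r (A ∪ B) → ∃[ X ] (A ⊆ X × X ⊆ A ∪ B × r X ≡ m)
  rank-intermediate A B m lo hi with m≤n⇒m<n∨m≡n hi
  ... | inj₂ eq = A ∪ B , p⊆p∪q B , (λ h → h) , sym eq
  ... | inj₁ lt with last-good {Q = λ X → r X ≤ m} (λ X → r X ≤? m) A B lo (<⇒≱ lt)
  ...   | X , y , A⊆X , X⊆ , _ , q , ¬q′ = X , A⊆X , X⊆ ,
          ≤-antisym q (≤-pred (≤-trans (≰⇒> ¬q′) (≤-trans (insert-≤ X y) (≤-reflexive (+-comm (r X) 1)))))

module _ {n} {r : Subset n → ℕ} (isRank : IsRank r) (W : Subset n) where
  open RankTheory isRank

  private
    test : Subset n → Bool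
    test X = ⌊ (X ⊆? W) ×-dec (r X ℕ.≟ ∣ X ∣) ⌋

    test⁻ : ∀ {X} → test X ≡ true → X ⊆ W × r X ≡ ∣ X ∣
    test⁻ {X} h with (X ⊆? W) ×-dec (r X ℕ.≟ ∣ X ∣)
    ... | yes p = p

    test⁺ : ∀ {X} → X ⊆ W → r X ≡ ∣ X ∣ → test X ≡ true
    test⁺ {X} a b = holds ((X ⊆? W) ×-dec (r X ℕ.≟ ∣ X ∣)) ((λ {x} → a {x}) , b)

    -- The elements of `X ─ Y` raise the rank by at most their number, so a deficit of `Y` would
    -- persist in `X`.
    down : ∀ X Y → Y ⊆ X → r X ≡ ∣ X ∣ → r Y ≡ ∣ Y ∣
    down X Y Y⊆X free = ≤-antisym (r≤card Y) (+-cancelʳ-≤ ∣ X ─ Y ∣ _ _ (begin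
      ∣ Y ∣ + ∣ X ─ Y ∣     ≤⟨ +-monoˡ-≤ _ (p⊆q⇒∣p∣≤∣q∣ (λ m → x∈p∩q⁺ (Y⊆X m , m))) ⟩
      ∣ X ∩ Y ∣ + ∣ X ─ Y ∣ ≡⟨ sym (card-split X Y) ⟩
      ∣ X ∣                 ≡⟨ sym free ⟩
      r X                   ≤⟨ by-rank 2 (λ x y → ⊢ ρ x ≼ ρ (y ⊔ (x ∖ y))) X Y ⟩
      r (Y ∪ (X ─ Y))       ≤⟨ union-≤ Y (X ─ Y) ⟩
      r Y + ∣ X ─ Y ∣       ∎))
      where open ≤-Reasoning

    aug : ∀ X Y → r X ≡ ∣ X ∣ → r Y ≡ ∣ Y ∣ → ∣ X ∣ < ∣ Y ∣ → ∃[ e ] (e ∈ Y × e ∉ X × r (X ∪ ⁅ e ⁆) ≡ ∣ X ∪ ⁅ e ⁆ ∣)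
    aug X Y fX fY lt with outside X Y (≤-trans (subst₂ _<_ (sym fX) (sym fY) lt) (r-mono (q⊆p∪q X Y)))
    ... | e , e∈Y , e∉cl = e , e∈Y , (λ m → e∉cl (⊆cl X m)) ,
      trans (≤-antisym (insert-≤ X e) (∉cl⁻ X e∉cl)) (trans (cong (_+ 1) fX) (trans (+-comm ∣ X ∣ 1) (sym (card-insert X e (λ m → e∉cl (⊆cl X m))))))

  fromRank : Matroid n
  fromRank = record
    { E = W
    ; indep = test
    ; indep⊆E = λ X h → proj₁ (test⁻ {X} h)
    ; indep-∅ = test⁺ (λ m → ⊥-elim (∉⊥ m)) (trans r-∅ (sym (∣⊥∣≡0 n)))
    ; indep-down = λ X Y Y⊆X h → test⁺ (λ m → proj₁ (test⁻ {X} h) (Y⊆X m)) (down X Y Y⊆X (proj₂ (test⁻ {X} h)))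
    ; indep-aug = λ X Y hX hY lt → case aug X Y (proj₂ (test⁻ {X} hX)) (proj₂ (test⁻ {Y} hY)) lt of λ where
        (e , e∈Y , e∉X , free) → e , e∈Y , e∉X ,
          test⁺ (∪-lub (proj₁ (test⁻ {X} hX)) (sing⊆ (proj₁ (test⁻ {Y} hY) e∈Y))) free
    }

  fromRank-indep⁻ : ∀ X → indep fromRank X ≡ true → X ⊆ W × r X ≡ ∣ X ∣
  fromRank-indep⁻ X = test⁻ {X}

  fromRank-indep⁺ : ∀ X → X ⊆ W → r X ≡ ∣ X ∣ → indep fromRank X ≡ true
  fromRank-indep⁺ X = test⁺ {X}

module _ {n} (M : Matroid n) where

  private
    size : Subset n → Subset n → ℕ
    size X Y = if indep M (Y ∩ X) then ∣ Y ∩ X ∣ else 0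

    max : Subset n → List (Subset n) → ℕ
    max X = foldr (λ Y r → size X Y ℕ.⊔ r) 0

    max-≥ : ∀ X {Y Ys} → Y ∈ₗ Ys → size X Y ≤ max X Ys
    max-≥ X (here refl) = m≤m⊔n _ _
    max-≥ X (there m) = ≤-trans (max-≥ X m) (m≤n⊔m _ _)

    max-attained : ∀ X Ys → ∃[ J ] (J ⊆ X × indep M J ≡ true × ∣ J ∣ ≡ max X Ys)
    max-attained X [] = ∅ , (λ m → ⊥-elim (∉⊥ m)) , indep-∅ M , ∣⊥∣≡0 n
    max-attained X (Y ∷ Ys) with max-attained X Ys | indep M (Y ∩ X) in e
    ... | J , J⊆X , iJ , eq | false = J , J⊆X , iJ , eq
    ... | J , J⊆X , iJ , eq | true with ≤-total ∣ Y ∩ X ∣ (max X Ys)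
    ...   | inj₁ le = J , J⊆X , iJ , trans eq (sym (m≤n⇒m⊔n≡n le))
    ...   | inj₂ ge = Y ∩ X , p∩q⊆q Y X , e , sym (m≥n⇒m⊔n≡m ge)

    all-subsets : ∀ {m} (Y : Subset m) → Y ∈ₗ allSubsets m
    all-subsets [] = here refl
    all-subsets (false ∷ Y) = ∈-++⁺ˡ (∈-map⁺ _ (all-subsets Y))
    all-subsets {suc m} (true ∷ Y) = ∈-++⁺ʳ (map (false ∷_) (allSubsets m)) (∈-map⁺ _ (all-subsets Y))

  rank-≥ : ∀ {X Y} → Y ⊆ X → indep M Y ≡ true → ∣ Y ∣ ≤ rank M X
  rank-≥ {X} {Y} Y⊆X i = subst (_≤ rank M X) eq (max-≥ X (all-subsets Y))
    where
    Y∩X≡Y : Y ∩ X ≡ Y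
    Y∩X≡Y = ⊆-antisym (p∩q⊆p Y X) (λ m → x∈p∩q⁺ (m , Y⊆X m))
    eq : size X Y ≡ ∣ Y ∣
    eq rewrite Y∩X≡Y | i = refl

  rank-basis : ∀ X → ∃[ J ] (J ⊆ X × indep M J ≡ true × ∣ J ∣ ≡ rank M X)
  rank-basis X = max-attained X (allSubsets n)

  extend-basis : ∀ {I X} → I ⊆ X → indep M I ≡ true → ∃[ J ] (I ⊆ J × J ⊆ X × indep M J ≡ true × ∣ J ∣ ≡ rank M X)
  extend-basis {I} {X} I⊆X iI = go (rank M X) I I⊆X iI (m≤m+n _ _)
    where
    go : ∀ fuel I → I ⊆ X → indep M I ≡ true → rank M X ≤ fuel + ∣ I ∣ →
         ∃[ J ] (I ⊆ J × J ⊆ X × indep M J ≡ true × ∣ J ∣ ≡ rank M X)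
    go fuel I I⊆X iI bound with m≤n⇒m<n∨m≡n (rank-≥ I⊆X iI)
    ... | inj₂ eq = I , (λ m → m) , I⊆X , iI , eq
    go zero I I⊆X iI bound | inj₁ lt = ⊥-elim (<-irrefl refl (≤-trans lt bound))
    go (suc fuel) I I⊆X iI bound | inj₁ lt with rank-basis X
    ... | B , B⊆X , iB , eB with indep-aug M I B iI iB (subst (_ <_) (sym eB) lt)
    ...   | e , e∈B , e∉I , i′ with go fuel (I ∪ ⁅ e ⁆) (∪-lub I⊆X (sing⊆ (B⊆X e∈B))) i′
              (≤-trans bound (≤-reflexive (trans (sym (+-suc fuel ∣ I ∣)) (cong (fuel +_) (sym (card-insert I e e∉I))))))
    ...     | J , I⊆J , J⊆X , iJ , eJ = J , (λ m → I⊆J (p⊆p∪q ⁅ e ⁆ m)) , J⊆X , iJ , eJ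

  rank-mono : ∀ {A B} → A ⊆ B → rank M A ≤ rank M B
  rank-mono {A} A⊆B with rank-basis A
  ... | J , J⊆A , iJ , eq = subst (_≤ _) eq (rank-≥ (λ m → A⊆B (J⊆A m)) iJ)

  rank-isRank : IsRank (rank M)
  rank-isRank = record
    { r-∅ = n≤0⇒n≡0 (bound ∅ (≤-reflexive (∣⊥∣≡0 n)))
    ; r-mono = rank-mono
    ; r-sub = submodular
    ; r-sing = λ x → bound ⁅ x ⁆ (≤-reflexive (∣⁅x⁆∣≡1 x))
    }
    where
    bound : ∀ A {m} → ∣ A ∣ ≤ m → rank M A ≤ m
    bound A h with rank-basis A
    ... | J , J⊆A , _ , eq = ≤-trans (≤-reflexive (sym eq)) (≤-trans (p⊆q⇒∣p∣≤∣q∣ J⊆A) h)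
    -- A basis `I` of `A ∩ B` is extended to a basis `J` of `A ∪ B`. The elements of `I` are counted
    -- both in `J ∩ A` and in `J ∩ B`, and these two sets are independent.
    submodular : ∀ A B → rank M (A ∪ B) + rank M (A ∩ B) ≤ rank M A + rank M B
    submodular A B with rank-basis (A ∩ B)
    ... | I , I⊆ , iI , eI with extend-basis {I} {A ∪ B} (λ m → p⊆p∪q B (p∩q⊆p A B (I⊆ m))) iI
    ...   | J , I⊆J , J⊆ , iJ , eJ = begin
      rank M (A ∪ B) + rank M (A ∩ B) ≡⟨ sym (cong₂ _+_ eJ eI) ⟩
      ∣ J ∣ + ∣ I ∣                   ≤⟨ CardSolver.by-rank 4
          (λ a b i j → i ⊑ (a ⊓ b) ⇒ i ⊑ j ⇒ j ⊑ (a ⊔ b) ⇒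
             ρ ((j ⊓ a) ⊔ (j ⊓ b)) ⊞ ρ ((j ⊓ a) ⊓ (j ⊓ b)) ≼ ρ (j ⊓ a) ⊞ ρ (j ⊓ b) ⇒
             ⊢ ρ j ⊞ ρ i ≼ ρ (j ⊓ a) ⊞ ρ (j ⊓ b)) A B I J I⊆ I⊆J J⊆ (≤-reflexive (card-modular (J ∩ A) (J ∩ B))) ⟩
      ∣ J ∩ A ∣ + ∣ J ∩ B ∣           ≤⟨ +-mono-≤ (part A) (part B) ⟩
      rank M A + rank M B ∎
      where
      open ≤-Reasoning
      part : ∀ A → ∣ J ∩ A ∣ ≤ rank M A
      part A = rank-≥ (p∩q⊆q J A) (indep-down M J (J ∩ A) (p∩q⊆p J A) iJ)

  indep⇒rank : ∀ {X} → indep M X ≡ true → rank M X ≡ ∣ X ∣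
  indep⇒rank {X} i = ≤-antisym (RankTheory.r≤card rank-isRank X) (rank-≥ (λ m → m) i)

  rank⇒indep : ∀ {X} → rank M X ≡ ∣ X ∣ → indep M X ≡ true
  rank⇒indep {X} eq with rank-basis X
  ... | J , J⊆X , iJ , eJ = subst (λ Y → indep M Y ≡ true)
        (⊆-antisym J⊆X (card-≥⇒⊇ J⊆X (≤-reflexive (trans (sym eq) (sym eJ))))) iJ

  rank-⊆E : ∀ A → rank M A ≤ rank M (E M)
  rank-⊆E A with rank-basis A
  ... | J , _ , iJ , eJ = subst (_≤ _) eJ (rank-≥ (indep⊆E M J iJ) iJ)

  -- Either rank of `X` is attained by a free subset of `X`, and the two notions of freeness agree
  -- within `E M`.
  rank-determined : ∀ {r} → IsRank r →
    (∀ X → indep M X ≡ true → r X ≡ ∣ X ∣) → (∀ X → X ⊆ E M → r X ≡ ∣ X ∣ → indep M X ≡ true) →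
    ∀ X → X ⊆ E M → rank M X ≡ r X
  rank-determined {r} isRank sound complete X X⊆E = ≤-antisym lower upper
    where
    lower : rank M X ≤ r X
    lower with rank-basis X
    ... | J , J⊆X , iJ , eJ = ≤-trans (≤-reflexive (trans (sym eJ) (sym (sound J iJ)))) (IsRank.r-mono isRank J⊆X)
    upper : r X ≤ rank M X
    upper with RankTheory.basis isRank X
    ... | J , J⊆X , free , full = ≤-trans (≤-reflexive (trans (sym full) free)) (rank-≥ J⊆X (complete J (λ m → X⊆E (J⊆X m)) free))

fromRank-rank : ∀ {n} {r : Subset n → ℕ} (isRank : IsRank r) W X → X ⊆ W → rank (fromRank isRank W) X ≡ r X
fromRank-rank isRank W = rank-determined (fromRank isRank W) isRank
  (λ X h → proj₂ (fromRank-indep⁻ isRank W X h)) (fromRank-indep⁺ isRank W)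

-- Separations of a triangle

absurd : ∀ {A : Set} → 1 ≤ 0 → A
absurd ()

-- The facts about `M` and its triangle on which the contraction process rests; binarity enters
-- through `meets`.
record Triangular {n} (r : Subset n → ℕ) (E T : Subset n) : Set where
  field
    isRank : IsRank r
    top : ∀ A → r A ≤ r E
    T⊆E : T ⊆ E
    rank-T : r T ≤ 2
    pair : ∀ {s t} → s ∈ T → t ∈ T → s ≢ t → 2 ≤ r (⁅ s ⁆ ∪ ⁅ t ⁆)
    size-T : ∣ T ∣ ≡ 3
    -- A hyperplane of a binary matroid meets every triangle.
    meets : ∀ Q → r (Q ∪ T) ≡ r Q + 1 → ∃[ t ] (t ∈ T × r (Q ∪ ⁅ t ⁆) ≤ r Q)

module Separations {n} {r : Subset n → ℕ} {E T : Subset n} (tri : Triangular r E T) where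
  open Triangular tri public
  open RankTheory isRank public

  nonloop-T : ∀ {t} → t ∈ T → 1 ≤ r ⁅ t ⁆
  nonloop-T {t} t∈ with card-two {A = T} (≤-trans (s≤s (s≤s z≤n)) (≤-reflexive (sym size-T)))
  ... | x , y , x∈ , y∈ , x≢y = other (x ≟ t)
    where
    using-pair : ∀ {s} → s ∈ T → s ≢ t → 1 ≤ r ⁅ t ⁆
    using-pair {s} s∈ s≢t = by-rank 2 (λ s t → # 2 ≼ ρ (s ⊔ t) ⇒ ρ s ≼ # 1 ⇒ sub s t ⇒ ⊢ # 1 ≼ ρ t) ⁅ s ⁆ ⁅ t ⁆ (pair s∈ t∈ s≢t) (r-sing s)
    other : Dec (x ≡ t) → 1 ≤ r ⁅ t ⁆
    other (yes x≡t) = using-pair y∈ (λ y≡t → x≢y (trans x≡t (sym y≡t)))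
    other (no x≢t) = using-pair x∈ x≢t

  -- A separation of `M / K` with the triangle on the second side. Allowing overlaps makes the
  -- notion stable under closures and under uncrossing, that is, under the passage to (X ∪ X₂, Y ∩
  -- Y₂) and (X ∩ X₂, Y ∪ Y₂).
  record Cover (K X Y : Subset n) : Set where
    constructor covers
    field
      cover : E ⊆ X ∪ Y
      K⊆X : K ⊆ X
      K⊆Y : K ⊆ Y
      T⊆Y : T ⊆ Y
  open Cover public

  -- The number r(X) + r(Y) - r(E) - r(K) is the connectivity of the cover in `M / K`. Demanding at
  -- least 2 excludes every 1- and 2-separation with `T` on one side and `P` on the other.
  Linked : Subset n → (Subset n → Set) → Set
  Linked K P = ∀ {X Y} → Cover K X Y → P X → r E + r K + 2 ≤ r X + r Y

  Separated : Subset n → (Subset n → Set) → Set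
  Separated K P = ∃[ X ] ∃[ Y ] (Cover K X Y × P X × r X + r Y ≤ r E + r K + 1)

  linked? : ∀ K {P} → (∀ X → Dec (P X)) → Linked K P ⊎ Separated K P
  linked? K {P} P? with anySubset? (λ X → anySubset? (λ Y →
      (E ⊆? (X ∪ Y)) ×-dec ((K ⊆? X) ×-dec ((K ⊆? Y) ×-dec ((T ⊆? Y) ×-dec (P? X ×-dec (r X + r Y ≤? r E + r K + 1)))))))
  ... | yes (X , Y , a , b , c , d , p , le) = inj₂ (X , Y , covers a b c d , p , le)
  ... | no none = inj₁ λ {X} {Y} cov p → ≮⇒≥ λ lt → none (X , Y ,
          (λ {x} → cover cov {x}) , (λ {x} → K⊆X cov {x}) , (λ {x} → K⊆Y cov {x}) , (λ {x} → T⊆Y cov {x}) , p ,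
          ≤-pred (≤-trans lt (≤-reflexive (+-suc (r E + r K) 1))))

  rank-K∪T-≤ : ∀ K → r (K ∪ T) ≤ r K + 2
  rank-K∪T-≤ K = by-rank 2 (λ k t → ρ t ≼ # 2 ⇒ sub k t ⇒ ⊢ ρ (k ⊔ t) ≼ ρ k ⊞ # 2) K T rank-T

  -- In a cover whose second side is `K ∪ T`, the first side has at most the rank of `E`, so `K ∪ T`
  -- must supply the whole connectivity.
  rank-K∪T-≥ : ∀ {K P A} → (∀ {X Y} → X ⊆ Y → P X → P Y) → P A → Linked K P → r K + 2 ≤ r (K ∪ T)
  rank-K∪T-≥ {K} {P} {A} up p linked = by-rank 3
    (λ k t e → ρ e ⊞ ρ k ⊞ # 2 ≼ ρ e ⊞ ρ (k ⊔ t) ⇒ ⊢ ρ k ⊞ # 2 ≼ ρ (k ⊔ t)) K T E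
    (≤-trans (linked {A ∪ (K ∪ E)} {K ∪ T} (covers
        (S.by-rank 4 (λ a k e t → ⊢ e ⊑ ((a ⊔ (k ⊔ e)) ⊔ (k ⊔ t))) A K E T)
        (S.by-rank 3 (λ a k e → ⊢ k ⊑ (a ⊔ (k ⊔ e))) A K E) (p⊆p∪q T) (q⊆p∪q K T)) (up (p⊆p∪q (K ∪ E)) p))
      (+-monoˡ-≤ (r (K ∪ T)) (top (A ∪ (K ∪ E)))))

  -- The uncrossing argument for an arbitrary monotone `P`, which will be `Big S` in the contraction
  -- process and `Off` in the case of three parallel elements. A rejection must come with
  -- `P (X₀ ∩ X)`, because `linked` is applied to the intersection of first sides.
  module Exchange {K P X₀ Y₀} (linked : Linked K P) (up : ∀ {X Y} → X ⊆ Y → P X → P Y)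
    (cov₀ : Cover K X₀ Y₀) (p₀ : P X₀)
    {Good : Fin n → Set}
    (test : ∀ z → z ∈ E → z ∉ cl X₀ → z ∉ cl (K ∪ T) →
      Good z ⊎ ∃[ X ] ∃[ Y ] (Cover K X Y × z ∈ X × z ∈ Y × P (X₀ ∩ X) × r X + r Y ≤ r E + r K + 2)) where

    Result : Set
    Result = ∃[ z ] (z ∈ E × z ∉ cl X₀ × z ∉ cl (K ∪ T) × Good z)

    private
      -- If the closures of `X` and `K ∪ T` covered `E`, linkedness would give `X` full rank. But
      -- `Y` contains `K ∪ T` and `e`, hence has rank at least r(K) + 3, and the cover could not be
      -- tight.
      some-outside : ∀ {X Y e} → X₀ ⊆ X → Cover K X Y → r X + r Y ≤ r E + r K + 2 →
        e ∈ X → e ∈ Y → e ∉ cl (K ∪ T) → ¬ E ⊆ cl X ∪ cl (K ∪ T)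
      some-outside {X} {Y} {e} X₀⊆X cov tight e∈X e∈Y e∉ covered = absurd (by-rank 6
        (λ x y k t s e′ → ρ e′ ⊞ ρ k ⊞ # 2 ≼ ρ x ⊞ ρ (k ⊔ t) ⇒ ρ (k ⊔ t) ≼ ρ k ⊞ # 2 ⇒
           ρ k ⊞ # 2 ≼ ρ (k ⊔ t) ⇒ ρ (k ⊔ t) ⊞ # 1 ≼ ρ ((k ⊔ t) ⊔ s) ⇒ ρ ((k ⊔ t) ⊔ s) ≼ ρ y ⇒
           ρ x ⊞ ρ y ≼ ρ e′ ⊞ ρ k ⊞ # 2 ⇒ ⊢ # 1 ≼ # 0) X Y K T ⁅ e ⁆ E
        (≤-trans (linked (covers covered (λ m → ⊆cl X (K⊆X cov m)) (λ m → ⊆cl (K ∪ T) (p⊆p∪q T m)) (λ m → ⊆cl (K ∪ T) (q⊆p∪q K T m)))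
                         (up (λ m → ⊆cl X (X₀⊆X m)) p₀))
                 (+-mono-≤ (r-cl X) (r-cl (K ∪ T))))
        (rank-K∪T-≤ K) (rank-K∪T-≥ up p₀ linked) (∉cl⁻ (K ∪ T) e∉)
        (r-mono (∪-lub (∪-lub (K⊆Y cov) (T⊆Y cov)) (sing⊆ e∈Y))) tight)

      -- Uncrossing a tight cover (X , Y) with the tight cover through a rejected z
      -- gives a tight cover that has z on both sides and a larger first member.
      go : ∀ fuel {X Y e} → r E < fuel + r X → X₀ ⊆ X → Cover K X Y → r X + r Y ≤ r E + r K + 2 →
           e ∈ X → e ∈ Y → e ∉ cl (K ∪ T) → Result
      go zero {X} bound = ⊥-elim (<-irrefl refl (≤-trans bound (top X)))
      go (suc fuel) {X} {Y} bound X₀⊆X cov tight e∈X e∈Y e∉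
        with outside-two E X (K ∪ T) (some-outside X₀⊆X cov tight e∈X e∈Y e∉)
      ... | z , z∈E , z∉X , z∉KT with test z z∈E (λ m → z∉X (cl-mono X₀⊆X m)) z∉KT
      ...   | inj₁ good = z , z∈E , (λ m → z∉X (cl-mono X₀⊆X m)) , z∉KT , good
      ...   | inj₂ (X₂ , Y₂ , cov₂ , z∈X₂ , z∈Y₂ , p , tight₂) =
              go fuel {X ∪ X₂} {Y ∩ Y₂} {z}
                (≤-trans bound (≤-trans (≤-reflexive (sym (+-suc fuel (r X)))) (+-monoʳ-≤ fuel
                  (≤-trans (≤-reflexive (+-comm 1 (r X))) (≤-trans (∉cl⁻ X z∉X) (r-mono (∪-lub (p⊆p∪q X₂) (λ m → q⊆p∪q X X₂ (sing⊆ z∈X₂ m)))))))))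
                (λ m → p⊆p∪q X₂ (X₀⊆X m))
                (covers (S.by-rank 5 (λ e x y u v → e ⊑ (x ⊔ y) ⇒ e ⊑ (u ⊔ v) ⇒ ⊢ e ⊑ ((x ⊔ u) ⊔ (y ⊓ v))) E X Y X₂ Y₂ (cover cov) (cover cov₂))
                        (λ m → p⊆p∪q X₂ (K⊆X cov m)) (λ m → x∈p∩q⁺ (K⊆Y cov m , K⊆Y cov₂ m)) (λ m → x∈p∩q⁺ (T⊆Y cov m , T⊆Y cov₂ m)))
                (by-rank 6 (λ e x y u v k → ρ e ⊞ ρ k ⊞ # 2 ≼ ρ (x ⊓ u) ⊞ ρ (y ⊔ v) ⇒
                     ρ x ⊞ ρ y ≼ ρ e ⊞ ρ k ⊞ # 2 ⇒ ρ u ⊞ ρ v ≼ ρ e ⊞ ρ k ⊞ # 2 ⇒ sub x u ⇒ sub y v ⇒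
                     ⊢ ρ (x ⊔ u) ⊞ ρ (y ⊓ v) ≼ ρ e ⊞ ρ k ⊞ # 2) E X Y X₂ Y₂ K
                  (linked (covers (S.by-rank 5 (λ e x y u v → e ⊑ (x ⊔ y) ⇒ e ⊑ (u ⊔ v) ⇒
                      ⊢ e ⊑ ((x ⊓ u) ⊔ (y ⊔ v))) E X Y X₂ Y₂ (cover cov) (cover cov₂))
                             (λ m → x∈p∩q⁺ (K⊆X cov m , K⊆X cov₂ m)) (λ m → p⊆p∪q Y₂ (K⊆Y cov m)) (λ m → p⊆p∪q Y₂ (T⊆Y cov m)))
                          (up (λ m → x∈p∩q⁺ (X₀⊆X (proj₁ (x∈p∩q⁻ X₀ X₂ m)) , proj₂ (x∈p∩q⁻ X₀ X₂ m))) p))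
                  tight tight₂)
                (q⊆p∪q X X₂ z∈X₂) (x∈p∩q⁺ ([ (λ z∈X → ⊥-elim (z∉X (⊆cl X z∈X))) , (λ m → m) ]′ (x∈p∪q⁻ X Y (cover cov z∈E)) , z∈Y₂)) z∉KT

    exchange : ∀ {e} → r X₀ + r Y₀ ≤ r E + r K + 2 → e ∈ X₀ → e ∈ Y₀ → e ∉ cl (K ∪ T) → Result
    exchange tight = go (suc (r E)) (m≤m+n (suc (r E)) (r X₀)) (λ m → m) cov₀ tight

-- Labelled minors

Connected : ∀ {n} → (Subset n → ℕ) → Subset n → Set
Connected r F = ∀ k A → 1 ≤ k → k < 3 → A ⊆ F → k ≤ ∣ A ∣ → k ≤ ∣ F ─ A ∣ → k + r F ≤ r A + r (F ─ A)

module Labels {n m} {r : Subset n → ℕ} {E T : Subset n} (tri : Triangular r E T) (F : Subset m) (rF : Subset m → ℕ) where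
  open Separations tri public

  -- f identifies the contraction of D, restricted to S, with the matroid on F with rank function rF.
  record Label (S : Subset n) (f : Fin n → Fin m) (D : Subset n) : Set where
    constructor label
    field
      bij : Bijects f S F
      quot : ∀ I → I ⊆ S → r (I ∪ D) ≡ rF (image f I) + r D
      S⊆E : S ⊆ E
  open Label public

  cross : ∀ {a b c d x : ℕ} → a + b ≡ c + d → c ≡ x + b → a ≡ x + d
  cross {a} {b} {c} {d} {x} e refl = +-cancelʳ-≡ b a (x + d) (trans e (xy∙z≈xz∙y x b d))

  recontract : ∀ {S f D D′} → Label S f D → (∀ I → I ⊆ S → r (I ∪ D′) + r D ≡ r (I ∪ D) + r D′) → Label S f D′
  recontract L e = label (bij L) (λ I I⊆S → cross (e I I⊆S) (quot L I I⊆S)) (S⊆E L)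

  -- The element `y` inherits the label of `x`. The two equations compare the contractions of `D′`
  -- and `D`, free of subtraction: first on sets without the exchanged element, then on sets with
  -- it.
  relabel : ∀ {S f D D′ x y} → Label S f D → x ∈ S → y ∈ E → y ∉ S ─ ⁅ x ⁆ →
    (∀ I → I ⊆ S ─ ⁅ x ⁆ → r (I ∪ D′) + r D ≡ r (I ∪ D) + r D′) →
    (∀ I → I ⊆ S ─ ⁅ x ⁆ → r ((I ∪ ⁅ y ⁆) ∪ D′) + r D ≡ r ((I ∪ ⁅ x ⁆) ∪ D) + r D′) →
    Label ((S ─ ⁅ x ⁆) ∪ ⁅ y ⁆) (f [ y ↦ f x ]) D′
  relabel {S} {f} {D} {D′} {x} {y} L x∈S y∈E y∉ e₀ e₁ = label bij′ quot′ (∪-lub (λ m → S⊆E L (proj₁ (∈─⁻ m))) (sing⊆ y∈E))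
    where
    g = f [ y ↦ f x ]
    S₀ = S ─ ⁅ x ⁆
    S₀⊆S : S₀ ⊆ S
    S₀⊆S m = proj₁ (∈─⁻ m)
    F≡ : (F ─ ⁅ f x ⁆) ∪ ⁅ f x ⁆ ≡ F
    F≡ = ⊆-antisym (SetSolver.by-rank 2 (λ a s → s ⊑ a ⇒ ⊢ ((a ∖ s) ⊔ s) ⊑ a) F ⁅ f x ⁆ (sing⊆ (into (bij L) x∈S)))
                   (SetSolver.by-rank 2 (λ a s → ⊢ a ⊑ ((a ∖ s) ⊔ s)) F ⁅ f x ⁆)
    bij₀ : Bijects f S₀ (F ─ ⁅ f x ⁆)
    bij₀ = bijects (λ a b → inj (bij L) (S₀⊆S a) (S₀⊆S b))
      (λ {z} m → x∈p∧x∉q⇒x∈p─q (into (bij L) (S₀⊆S m)) (λ h → proj₂ (∈─⁻ m)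
          (subst (_∈ ⁅ x ⁆) (sym (inj (bij L) (S₀⊆S m) x∈S (x∈⁅y⁆⇒x≡y (f x) h))) (x∈⁅x⁆ x))))
      onto₀
      where
      onto₀ : ∀ {w} → w ∈ F ─ ⁅ f x ⁆ → ∃[ z ] (z ∈ S₀ × f z ≡ w)
      onto₀ {w} h with onto (bij L) (proj₁ (∈─⁻ h))
      ... | z , z∈ , refl = z , x∈p∧x∉q⇒x∈p─q z∈ (λ c → proj₂ (∈─⁻ h) (subst (λ u → f z ∈ ⁅ f u ⁆) (x∈⁅y⁆⇒x≡y x c) (x∈⁅x⁆ (f z)))) , refl
    bij′ : Bijects g (S₀ ∪ ⁅ y ⁆) F
    bij′ = subst (Bijects g (S₀ ∪ ⁅ y ⁆)) F≡ (bijects-extend y (f x) y∉ (λ h → proj₂ (∈─⁻ h) (x∈⁅x⁆ (f x))) bij₀)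
    im₀ : ∀ I → I ⊆ S₀ → image g I ≡ image f I
    im₀ I I⊆ = image-cong I (λ m → update-off f y (f x) (λ { refl → y∉ (I⊆ m) }))
    quot′ : ∀ I → I ⊆ S₀ ∪ ⁅ y ⁆ → r (I ∪ D′) ≡ rF (image g I) + r D′
    quot′ I I⊆ with y ∈? I
    ... | no y∉I = trans (cross (e₀ I I⊆S₀) (quot L I (λ m → S₀⊆S (I⊆S₀ m)))) (cong (λ J → rF J + r D′) (sym (im₀ I I⊆S₀)))
      where
      I⊆S₀ : I ⊆ S₀
      I⊆S₀ {z} m = [ (λ a → a) , (λ b → ⊥-elim (y∉I (subst (_∈ I) (x∈⁅y⁆⇒x≡y y b) m))) ]′ (x∈p∪q⁻ S₀ ⁅ y ⁆ (I⊆ m))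
    ... | yes y∈I = trans (cong (λ J → r (J ∪ D′)) (sym I≡))
                      (trans (cross (e₁ I₀ I₀⊆S₀) (quot L (I₀ ∪ ⁅ x ⁆) (∪-lub (λ m → S₀⊆S (I₀⊆S₀ m)) (sing⊆ x∈S))))
                        (cong (λ J → rF J + r D′) im))
      where
      I₀ = I ─ ⁅ y ⁆
      I≡ : I₀ ∪ ⁅ y ⁆ ≡ I
      I≡ = ⊆-antisym (S.by-rank 2 (λ a s → s ⊑ a ⇒ ⊢ ((a ∖ s) ⊔ s) ⊑ a) I ⁅ y ⁆ (sing⊆ y∈I))
                     (S.by-rank 2 (λ a s → ⊢ a ⊑ ((a ∖ s) ⊔ s)) I ⁅ y ⁆)
      I₀⊆S₀ : I₀ ⊆ S₀
      I₀⊆S₀ = S.by-rank 3 (λ a s b → a ⊑ (b ⊔ s) ⇒ ⊢ (a ∖ s) ⊑ b) I ⁅ y ⁆ S₀ I⊆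
      im : image f (I₀ ∪ ⁅ x ⁆) ≡ image g I
      im = trans (image-∪ f I₀ ⁅ x ⁆) (trans (cong₂ _∪_ (sym (im₀ I₀ I₀⊆S₀))
             (trans (image-sing f x) (trans (cong ⁅_⁆ (sym (update-at f y (f x)))) (sym (image-sing g y)))))
           (trans (sym (image-∪ g I₀ ⁅ y ⁆)) (cong (image g) I≡)))

  label-image : ∀ {S f D} → Label S f D → image f S ≡ F
  label-image {S} {f} L = ⊆-antisym fwd bwd
    where
    fwd : image f S ⊆ F
    fwd h with image⁻ f S h
    ... | x , x∈ , refl = into (bij L) x∈
    bwd : F ⊆ image f S
    bwd h with onto (bij L) h
    ... | x , x∈ , refl = image⁺ f S x∈

  label-size : ∀ {S f D} → Label S f D → ∣ S ∣ ≡ ∣ F ∣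
  label-size {S} {f} L = trans (sym (card-image f S (inj (bij L)))) (cong ∣_∣ (label-image L))

  -- Connectivity of the restriction of `M / D` to `S`, with 2 r(D) added on both sides to avoid
  -- subtraction.
  Split : Subset n → Subset n → Set
  Split S D = ∀ k A → 1 ≤ k → k < 3 → A ⊆ S → k ≤ ∣ A ∣ → k ≤ ∣ S ─ A ∣ → k + r (S ∪ D) + r D ≤ r (A ∪ D) + r ((S ─ A) ∪ D)

  label-split : Connected rF F → ∀ {S f D} → Label S f D → Split S D
  label-split conn {S} {f} {D} L k A 1≤k k<3 A⊆S k≤A k≤ =
    subst₂ _≤_ lhs rhs (+-monoˡ-≤ (r D + r D) (conn k (image f A) 1≤k k<3 imA⊆F
      (≤-trans k≤A (≤-reflexive (sym (card-image f A (λ a b → inj (bij L) (A⊆S a) (A⊆S b))))))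
      (≤-trans k≤ (≤-reflexive (trans (sym (card-image f (S ─ A) (λ a b → inj (bij L) (proj₁ (∈─⁻ a)) (proj₁ (∈─⁻ b))))) (cong ∣_∣ imS─A))))))
    where
    imA⊆F : image f A ⊆ F
    imA⊆F h with image⁻ f A h
    ... | x , x∈ , refl = into (bij L) (A⊆S x∈)
    imS─A : image f (S ─ A) ≡ F ─ image f A
    imS─A = ⊆-antisym fwd bwd
      where
      fwd : image f (S ─ A) ⊆ F ─ image f A
      fwd h with image⁻ f (S ─ A) h
      ... | x , x∈ , refl = x∈p∧x∉q⇒x∈p─q (into (bij L) (proj₁ (∈─⁻ x∈))) λ h′ → contra h′
        where
        contra : ¬ f x ∈ image f A
        contra h′ with image⁻ f A h′
        ... | y , y∈ , e = proj₂ (∈─⁻ x∈) (subst (_∈ A) (inj (bij L) (A⊆S y∈) (proj₁ (∈─⁻ x∈)) e) y∈)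
      bwd : F ─ image f A ⊆ image f (S ─ A)
      bwd h with onto (bij L) (proj₁ (∈─⁻ h))
      ... | x , x∈ , refl = image⁺ f (S ─ A) (x∈p∧x∉q⇒x∈p─q x∈ (λ a → proj₂ (∈─⁻ h) (image⁺ f A a)))
    lhs : k + rF F + (r D + r D) ≡ k + r (S ∪ D) + r D
    lhs = begin
      k + rF F + (r D + r D)   ≡⟨ sym (+-assoc (k + rF F) (r D) (r D)) ⟩
      k + rF F + r D + r D     ≡⟨ cong (_+ r D) (+-assoc k (rF F) (r D)) ⟩
      k + (rF F + r D) + r D   ≡⟨ cong (λ z → k + z + r D) (trans (cong (λ J → rF J + r D) (sym (label-image L))) (sym (quot L S (λ m → m)))) ⟩
      k + r (S ∪ D) + r D ∎
      where open ≡-Reasoning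
    rhs : rF (image f A) + rF (F ─ image f A) + (r D + r D) ≡ r (A ∪ D) + r ((S ─ A) ∪ D)
    rhs = trans (interchange (rF (image f A)) (rF (F ─ image f A)) (r D) (r D))
      (cong₂ _+_ (sym (quot L A A⊆S)) (trans (cong (λ J → rF J + r D) (sym imS─A)) (sym (quot L (S ─ A) (λ m → proj₁ (∈─⁻ m))))))

  module _ {S D} (split : Split S D) where

    other : ∀ s → 2 ≤ ∣ S ∣ → 1 ≤ ∣ S ─ ⁅ s ⁆ ∣
    other s h = +-cancelˡ-≤ 1 1 _ (≤-trans h (≤-trans (≤-reflexive (card-split S ⁅ s ⁆))
      (+-monoˡ-≤ _ (≤-trans (p⊆q⇒∣p∣≤∣q∣ (p∩q⊆q S ⁅ s ⁆)) (≤-reflexive (∣⁅x⁆∣≡1 s))))))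

    nonloop : 2 ≤ ∣ S ∣ → ∀ {s} → s ∈ S → r D + 1 ≤ r (⁅ s ⁆ ∪ D)
    nonloop h {s} s∈ = by-rank 3 (λ s a d → # 1 ⊞ ρ (s ⊔ d) ⊞ ρ d ≼ ρ (a ⊔ d) ⊞ ρ ((s ∖ a) ⊔ d) ⇒ ⊢ ρ d ⊞ # 1 ≼ ρ (a ⊔ d)) S ⁅ s ⁆ D
      (split 1 ⁅ s ⁆ ≤-refl (s≤s (s≤s z≤n)) (sing⊆ s∈) (≤-reflexive (sym (∣⁅x⁆∣≡1 s))) (other s h))

    noncoloop : 2 ≤ ∣ S ∣ → ∀ {s} → s ∈ S → r (S ∪ D) ≤ r ((S ─ ⁅ s ⁆) ∪ D)
    noncoloop h {s} s∈ = by-rank 3 (λ s a d → # 1 ⊞ ρ (s ⊔ d) ⊞ ρ d ≼ ρ (a ⊔ d) ⊞ ρ ((s ∖ a) ⊔ d) ⇒ ρ a ≼ # 1 ⇒ sub a d ⇒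
        ⊢ ρ (s ⊔ d) ≼ ρ ((s ∖ a) ⊔ d)) S ⁅ s ⁆ D
      (split 1 ⁅ s ⁆ ≤-refl (s≤s (s≤s z≤n)) (sing⊆ s∈) (≤-reflexive (sym (∣⁅x⁆∣≡1 s))) (other s h)) (r-sing s)

    -- Two parallel elements would form one side of a 2-separation; four elements leave two for the
    -- other side.
    simple : 4 ≤ ∣ S ∣ → ∀ {s t} → s ∈ S → t ∈ S → s ≢ t → r D + 2 ≤ r ((⁅ s ⁆ ∪ ⁅ t ⁆) ∪ D)
    simple h {s} {t} s∈ t∈ s≢t = by-rank 3 (λ s a d → # 2 ⊞ ρ (s ⊔ d) ⊞ ρ d ≼ ρ (a ⊔ d) ⊞ ρ ((s ∖ a) ⊔ d) ⇒
        ⊢ ρ d ⊞ # 2 ≼ ρ (a ⊔ d)) S (⁅ s ⁆ ∪ ⁅ t ⁆) D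
      (split 2 (⁅ s ⁆ ∪ ⁅ t ⁆) (s≤s z≤n) ≤-refl (∪-lub (sing⊆ s∈) (sing⊆ t∈))
        (two-card (p⊆p∪q ⁅ t ⁆ (x∈⁅x⁆ s)) (q⊆p∪q ⁅ s ⁆ ⁅ t ⁆ (x∈⁅x⁆ t)) s≢t)
        (+-cancelˡ-≤ 2 2 _ (≤-trans h (≤-trans (≤-reflexive (card-split S (⁅ s ⁆ ∪ ⁅ t ⁆)))
          (+-monoˡ-≤ _ (≤-trans (p⊆q⇒∣p∣≤∣q∣ (p∩q⊆q S (⁅ s ⁆ ∪ ⁅ t ⁆))) (≤-trans (CardSolver.by-rank 2 (λ a b → sub a b ⇒
              ⊢ ρ (a ⊔ b) ≼ ρ a ⊞ ρ b) ⁅ s ⁆ ⁅ t ⁆)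
            (≤-reflexive (cong₂ _+_ (∣⁅x⁆∣≡1 s) (∣⁅x⁆∣≡1 t))))))))))

    -- Connectivity does not grow in minors: a 2-separation of `M / K` with two elements of `S` in
    -- `X` and two outside would induce a 2-separation of the minor on `S`.
    small-side : ∀ {K X Y} → S ⊆ E → D ⊆ E → K ⊆ D → E ⊆ X ∪ Y → K ⊆ X → K ⊆ Y → r X + r Y ≤ r E + r K + 1 →
                 2 ≤ ∣ S ∩ X ∣ → ∣ S ─ X ∣ ≤ 1
    small-side {K} {X} {Y} S⊆E D⊆E K⊆D cov K⊆X K⊆Y tight big with ∣ S ─ X ∣ ≤? 1
    ... | yes le = le
    ... | no gt = absurd (by-rank 6
      (λ e x y k s d → e ⊑ (x ⊔ y) ⇒ k ⊑ x ⇒ k ⊑ y ⇒ k ⊑ d ⇒ d ⊑ e ⇒ s ⊑ e ⇒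
         ρ x ⊞ ρ y ≼ ρ e ⊞ ρ k ⊞ # 1 ⇒
         # 2 ⊞ ρ (s ⊔ d) ⊞ ρ d ≼ ρ ((s ⊓ x) ⊔ d) ⊞ ρ ((s ∖ (s ⊓ x)) ⊔ d) ⇒
         sub x d ⇒ sub y d ⇒ sub (x ⊓ d) (y ⊓ d) ⇒ sub (s ⊔ d) (x ⊔ d) ⇒ sub ((s ⊔ d) ⊔ (x ⊔ d)) (y ⊔ d) ⇒
         ⊢ # 1 ≼ # 0) E X Y K S D cov K⊆X K⊆Y K⊆D D⊆E S⊆E tight
      (split 2 (S ∩ X) (s≤s z≤n) ≤-refl (p∩q⊆p S X) big
        (≤-trans (≰⇒> gt) (p⊆q⇒∣p∣≤∣q∣ (S.by-rank 2 (λ s x → ⊢ (s ∖ x) ⊑ (s ∖ (s ⊓ x))) S X)))))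

-- Moving a minor across a 2-separation

module Process {n m} {r : Subset n → ℕ} {E T : Subset n} (tri : Triangular r E T)
  (F : Subset m) (rF : Subset m → ℕ) (conn : Connected rF F) (large : 4 ≤ ∣ F ∣) where
  open Labels tri F rF public

  large-S : ∀ {S f D} → Label S f D → 4 ≤ ∣ S ∣
  large-S L = ≤-trans large (≤-reflexive (sym (label-size L)))

  two-S : ∀ {S f D} → Label S f D → 2 ≤ ∣ S ∣
  two-S L = ≤-trans (s≤s (s≤s z≤n)) (large-S L)

  -- The two inequalities say that the cover has connectivity exactly 1 in `M / A`: over `A`, the
  -- spans of `X` and `Y` share one point, possibly not an element of the matroid.
  module Skew {A X Y : Subset n} (cov : E ⊆ X ∪ Y) (A⊆X : A ⊆ X) (A⊆Y : A ⊆ Y)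
    (tight≤ : r X + r Y ≤ r E + r A + 1) (tight≥ : r E + r A + 1 ≤ r X + r Y) where

    -- B is skew to X over A; otherwise B determines, modulo A, the point common to the spans of X and Y.
    Skew : Subset n → Set
    Skew B = r B + r X ≤ r (X ∪ B) + r A

    skew? : ∀ B → Dec (Skew B)
    skew? B = _ ≤? _

    ¬skew : ∀ {B} → ¬ Skew B → r (X ∪ B) + r A + 1 ≤ r B + r X
    ¬skew {B} h = ≤-trans (≤-reflexive (+-comm _ 1)) (≰⇒> h)

    -- In other words, contracting `B` has the same effect on subsets of `X` as contracting `A`.
    skew-rank : ∀ {B Z} → Skew B → A ⊆ B → A ⊆ Z → Z ⊆ X → r (Z ∪ B) + r A ≡ r Z + r B
    skew-rank {B} {Z} skew A⊆B A⊆Z Z⊆X = ≤-antisym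
      (by-rank 3 (λ a b z → a ⊑ b ⇒ a ⊑ z ⇒ sub z b ⇒ ⊢ ρ (z ⊔ b) ⊞ ρ a ≼ ρ z ⊞ ρ b) A B Z A⊆B A⊆Z)
      (by-rank 4 (λ a b z x → z ⊑ x ⇒ ρ b ⊞ ρ x ≼ ρ (x ⊔ b) ⊞ ρ a ⇒ sub x (z ⊔ b) ⇒ ⊢ ρ z ⊞ ρ b ≼ ρ (z ⊔ b) ⊞ ρ a) A B Z X Z⊆X skew)

    -- All that `Y` shares with the span of `X` over `A` is one point, and `C` has it already. So
    -- contracting `C` affects `X` just as contracting `Y` does.
    nonskew-rank : ∀ {C Z} → r (X ∪ C) + r A + 1 ≤ r C + r X → A ⊆ C → C ⊆ Y → A ⊆ Z → Z ⊆ X → r (Z ∪ Y) + r C ≡ r (Z ∪ C) + r Y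
    nonskew-rank {C} {Z} ns A⊆C C⊆Y A⊆Z Z⊆X = ≤-antisym
      (by-rank 3 (λ c y z → c ⊑ y ⇒ sub (z ⊔ c) y ⇒ ⊢ ρ (z ⊔ y) ⊞ ρ c ≼ ρ (z ⊔ c) ⊞ ρ y) C Y Z C⊆Y)
      (by-rank 6 (λ a c z x y e → e ⊑ (x ⊔ y) ⇒ z ⊑ x ⇒ c ⊑ y ⇒ ρ (x ⊔ c) ⊞ ρ a ⊞ # 1 ≼ ρ c ⊞ ρ x ⇒
          ρ x ⊞ ρ y ≼ ρ e ⊞ ρ a ⊞ # 1 ⇒ sub (z ⊔ y) (x ⊔ c) ⇒ ⊢ ρ (z ⊔ c) ⊞ ρ y ≼ ρ (z ⊔ y) ⊞ ρ c) A C Z X Y E cov Z⊆X C⊆Y ns tight≤)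

    module _ {D} (A⊆D : A ⊆ D) (D⊆E : D ⊆ E) where

      private
        D⊆ : D ⊆ X ∪ Y
        D⊆ m = cov (D⊆E m)

        A⊆DX : A ⊆ D ∩ X
        A⊆DX m = x∈p∩q⁺ (A⊆D m , A⊆X m)
        A⊆DY : A ⊆ D ∩ Y
        A⊆DY m = x∈p∩q⁺ (A⊆D m , A⊆Y m)
        DX⊆ : D ∩ X ⊆ X
        DX⊆ = p∩q⊆q D X
        A⊆Z : ∀ I → A ⊆ I ∪ (D ∩ X)
        A⊆Z I m = q⊆p∪q I (D ∩ X) (A⊆DX m)
        Z⊆ : ∀ {I} → I ⊆ X → I ∪ (D ∩ X) ⊆ X
        Z⊆ h = ∪-lub h DX⊆

      -- Neither `D ∩ Y` nor `z` affects `X`, hence `z` can stand in for all of `D ∩ Y`.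
      contract-skew : Skew (D ∩ Y) → ∀ {z} → z ∉ cl X → ∀ I → I ⊆ X →
                      r (I ∪ ((D ∩ X) ∪ ⁅ z ⁆)) + r D ≡ r (I ∪ D) + r ((D ∩ X) ∪ ⁅ z ⁆)
      contract-skew skew {z} z∉ I I⊆X = ≤-antisym
        (by-rank 6 (λ i d x y s a → i ⊑ x ⇒ d ⊑ (x ⊔ y) ⇒
            ρ (i ⊔ (d ⊓ x)) ⊞ ρ (d ⊓ y) ≼ ρ ((i ⊔ (d ⊓ x)) ⊔ (d ⊓ y)) ⊞ ρ a ⇒
            ρ ((d ⊓ x) ⊔ (d ⊓ y)) ⊞ ρ a ≼ ρ (d ⊓ x) ⊞ ρ (d ⊓ y) ⇒
            ρ ((i ⊔ (d ⊓ x)) ⊔ s) ≼ ρ (i ⊔ (d ⊓ x)) ⊞ # 1 ⇒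
            ρ (d ⊓ x) ⊞ # 1 ≼ ρ ((d ⊓ x) ⊔ s) ⇒
            ⊢ ρ (i ⊔ ((d ⊓ x) ⊔ s)) ⊞ ρ d ≼ ρ (i ⊔ d) ⊞ ρ ((d ⊓ x) ⊔ s)) I D X Y ⁅ z ⁆ A I⊆X D⊆
          (≤-reflexive (sym (skew-rank skew A⊆DY (A⊆Z I) (Z⊆ I⊆X))))
          (≤-reflexive (skew-rank skew A⊆DY A⊆DX DX⊆))
          (insert-≤ (I ∪ (D ∩ X)) z) (∉cl⁻ (D ∩ X) (λ h → z∉ (cl-mono DX⊆ h))))
        (by-rank 6 (λ i d x y s a → i ⊑ x ⇒ d ⊑ (x ⊔ y) ⇒
            ρ ((i ⊔ (d ⊓ x)) ⊔ (d ⊓ y)) ⊞ ρ a ≼ ρ (i ⊔ (d ⊓ x)) ⊞ ρ (d ⊓ y) ⇒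
            ρ (d ⊓ x) ⊞ ρ (d ⊓ y) ≼ ρ ((d ⊓ x) ⊔ (d ⊓ y)) ⊞ ρ a ⇒
            ρ ((d ⊓ x) ⊔ s) ≼ ρ (d ⊓ x) ⊞ # 1 ⇒
            ρ (i ⊔ (d ⊓ x)) ⊞ # 1 ≼ ρ ((i ⊔ (d ⊓ x)) ⊔ s) ⇒
            ⊢ ρ (i ⊔ d) ⊞ ρ ((d ⊓ x) ⊔ s) ≼ ρ (i ⊔ ((d ⊓ x) ⊔ s)) ⊞ ρ d) I D X Y ⁅ z ⁆ A I⊆X D⊆
          (≤-reflexive (skew-rank skew A⊆DY (A⊆Z I) (Z⊆ I⊆X)))
          (≤-reflexive (sym (skew-rank skew A⊆DY A⊆DX DX⊆)))
          (insert-≤ (D ∩ X) z) (∉cl⁻ (I ∪ (D ∩ X)) (λ h → z∉ (cl-mono (Z⊆ I⊆X) h))))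

      -- The common point is contracted already with `D ∩ Y`, so the rest of `Y` can be contracted
      -- as well; this includes every candidate `z`.
      contract-nonskew : ¬ Skew (D ∩ Y) → ∀ I → I ⊆ X → r (I ∪ (D ∪ Y)) + r D ≡ r (I ∪ D) + r (D ∪ Y)
      contract-nonskew ns I I⊆X = ≤-antisym
        (by-rank 4 (λ i d x y → i ⊑ x ⇒ d ⊑ (x ⊔ y) ⇒
            ρ ((i ⊔ (d ⊓ x)) ⊔ y) ⊞ ρ (d ⊓ y) ≼ ρ ((i ⊔ (d ⊓ x)) ⊔ (d ⊓ y)) ⊞ ρ y ⇒
            ρ ((d ⊓ x) ⊔ (d ⊓ y)) ⊞ ρ y ≼ ρ ((d ⊓ x) ⊔ y) ⊞ ρ (d ⊓ y) ⇒
            ⊢ ρ (i ⊔ (d ⊔ y)) ⊞ ρ d ≼ ρ (i ⊔ d) ⊞ ρ (d ⊔ y)) I D X Y I⊆X D⊆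
          (≤-reflexive (nonskew-rank (¬skew ns) A⊆DY (p∩q⊆q D Y) (A⊆Z I) (Z⊆ I⊆X)))
          (≤-reflexive (sym (nonskew-rank (¬skew ns) A⊆DY (p∩q⊆q D Y) A⊆DX DX⊆))))
        (by-rank 4 (λ i d x y → i ⊑ x ⇒ d ⊑ (x ⊔ y) ⇒
            ρ ((i ⊔ (d ⊓ x)) ⊔ (d ⊓ y)) ⊞ ρ y ≼ ρ ((i ⊔ (d ⊓ x)) ⊔ y) ⊞ ρ (d ⊓ y) ⇒
            ρ ((d ⊓ x) ⊔ y) ⊞ ρ (d ⊓ y) ≼ ρ ((d ⊓ x) ⊔ (d ⊓ y)) ⊞ ρ y ⇒
            ⊢ ρ (i ⊔ d) ⊞ ρ (d ⊔ y) ≼ ρ (i ⊔ (d ⊔ y)) ⊞ ρ d) I D X Y I⊆X D⊆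
          (≤-reflexive (sym (nonskew-rank (¬skew ns) A⊆DY (p∩q⊆q D Y) (A⊆Z I) (Z⊆ I⊆X))))
          (≤-reflexive (nonskew-rank (¬skew ns) A⊆DY (p∩q⊆q D Y) A⊆DX DX⊆)))

      module _ {S f x} (L : Label S f D) (x∈S : x ∈ S) (x∉X : x ∉ X) (x∈Y : x ∈ Y) (S─x⊆X : S ─ ⁅ x ⁆ ⊆ X) where
        private
          DY = D ∩ Y
          split = label-split conn L

          grows : r DY + 1 ≤ r (DY ∪ ⁅ x ⁆)
          grows = by-rank 3 (λ d y s → ρ d ⊞ # 1 ≼ ρ (s ⊔ d) ⇒ sub d ((d ⊓ y) ⊔ s) ⇒ ⊢ ρ (d ⊓ y) ⊞ # 1 ≼ ρ ((d ⊓ y) ⊔ s))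
            D Y ⁅ x ⁆ (nonloop split (two-S L) x∈S)

          spanned : r ((X ∪ DY) ∪ ⁅ x ⁆) ≤ r (X ∪ DY)
          spanned = by-rank 5 (λ d y s x c → c ⊑ s ⇒ (s ∖ c) ⊑ x ⇒ d ⊑ (x ⊔ y) ⇒ ρ (s ⊔ d) ≼ ρ ((s ∖ c) ⊔ d) ⇒
               sub (x ⊔ (d ⊓ y)) (s ⊔ d) ⇒ ⊢ ρ ((x ⊔ (d ⊓ y)) ⊔ c) ≼ ρ (x ⊔ (d ⊓ y)))
            D Y S X ⁅ x ⁆ (sing⊆ x∈S) S─x⊆X D⊆ (noncoloop split (two-S L) x∈S)

        -- If `DY` had the common point, then `x`, which lies in `Y` and is spanned by `X ∪ DY`,
        -- would be spanned by `DY` alone and be a loop of the minor.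
        point-skew : Skew DY
        point-skew = by-rank 6 (λ e x y d s a → e ⊑ (x ⊔ y) ⇒ d ⊑ y ⇒ s ⊑ y ⇒ ρ d ⊞ # 1 ≼ ρ (d ⊔ s) ⇒ ρ ((x ⊔ d) ⊔ s) ≼ ρ (x ⊔ d) ⇒
             ρ x ⊞ ρ y ≼ ρ e ⊞ ρ a ⊞ # 1 ⇒ sub ((x ⊔ d) ⊔ s) y ⇒ ⊢ ρ d ⊞ ρ x ≼ ρ (x ⊔ d) ⊞ ρ a) E X Y DY ⁅ x ⁆ A
          cov (p∩q⊆q D Y) (sing⊆ x∈Y) grows spanned tight≤

        -- Over `DY` the element `x` is no loop and lies in the span of `X`, so it represents the
        -- common point.
        point-nonskew : r (X ∪ (DY ∪ ⁅ x ⁆)) + r A + 1 ≤ r (DY ∪ ⁅ x ⁆) + r X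
        point-nonskew = by-rank 4 (λ x d s a → a ⊑ x ⇒ a ⊑ d ⇒ ρ d ⊞ # 1 ≼ ρ (d ⊔ s) ⇒ ρ ((x ⊔ d) ⊔ s) ≼ ρ (x ⊔ d) ⇒ sub x d ⇒
             ⊢ ρ (x ⊔ (d ⊔ s)) ⊞ ρ a ⊞ # 1 ≼ ρ (d ⊔ s) ⊞ ρ x) X DY ⁅ x ⁆ A A⊆X A⊆DY grows spanned

        -- Once all of B is contracted, y takes over the place of x.
        module _ {B y} (A⊆B : A ⊆ B) (B⊆Y : B ⊆ Y) (y∈Y : y ∈ Y) (skew : Skew B) (ns : ¬ Skew (B ∪ ⁅ y ⁆)) where
          private
            D′ = (D ∩ X) ∪ B
            grows-y : r B + 1 ≤ r (B ∪ ⁅ y ⁆)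
            grows-y = by-rank 4 (λ b s x a → ρ b ⊞ ρ x ≼ ρ (x ⊔ b) ⊞ ρ a ⇒ ρ (x ⊔ (b ⊔ s)) ⊞ ρ a ⊞ # 1 ≼ ρ (b ⊔ s) ⊞ ρ x ⇒
              ⊢ ρ b ⊞ # 1 ≼ ρ (b ⊔ s)) B ⁅ y ⁆ X A skew (¬skew ns)
            I⊆X : ∀ {I} → I ⊆ S ─ ⁅ x ⁆ → I ⊆ X
            I⊆X h m = S─x⊆X (h m)
            By⊆Y : B ∪ ⁅ y ⁆ ⊆ Y
            By⊆Y = ∪-lub B⊆Y (sing⊆ y∈Y)
            DYx⊆Y : DY ∪ ⁅ x ⁆ ⊆ Y
            DYx⊆Y = ∪-lub (p∩q⊆q D Y) (sing⊆ x∈Y)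
            A⊆By : A ⊆ B ∪ ⁅ y ⁆
            A⊆By m = p⊆p∪q ⁅ y ⁆ (A⊆B m)
            A⊆DYx : A ⊆ DY ∪ ⁅ x ⁆
            A⊆DYx m = p⊆p∪q ⁅ x ⁆ (A⊆DY m)

          -- Both `B` and `D ∩ Y` are skew to `X`, so it makes no difference to the sets inside `X`
          -- which of them is contracted.
          replace-rest : ∀ I → I ⊆ S ─ ⁅ x ⁆ → r (I ∪ D′) + r D ≡ r (I ∪ D) + r D′
          replace-rest I I⊆ = ≤-antisym
            (by-rank 6 (λ i d x y b a → d ⊑ (x ⊔ y) ⇒
               ρ ((i ⊔ (d ⊓ x)) ⊔ b) ⊞ ρ a ≼ ρ (i ⊔ (d ⊓ x)) ⊞ ρ b ⇒
               ρ (d ⊓ x) ⊞ ρ b ≼ ρ ((d ⊓ x) ⊔ b) ⊞ ρ a ⇒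
               ρ (i ⊔ (d ⊓ x)) ⊞ ρ (d ⊓ y) ≼ ρ ((i ⊔ (d ⊓ x)) ⊔ (d ⊓ y)) ⊞ ρ a ⇒
               ρ ((d ⊓ x) ⊔ (d ⊓ y)) ⊞ ρ a ≼ ρ (d ⊓ x) ⊞ ρ (d ⊓ y) ⇒
               ⊢ ρ (i ⊔ ((d ⊓ x) ⊔ b)) ⊞ ρ d ≼ ρ (i ⊔ d) ⊞ ρ ((d ⊓ x) ⊔ b)) I D X Y B A D⊆
              (≤-reflexive a₁) (≤-reflexive (sym a₂)) (≤-reflexive (sym a₃)) (≤-reflexive a₄))
            (by-rank 6 (λ i d x y b a → d ⊑ (x ⊔ y) ⇒
               ρ (i ⊔ (d ⊓ x)) ⊞ ρ b ≼ ρ ((i ⊔ (d ⊓ x)) ⊔ b) ⊞ ρ a ⇒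
               ρ ((d ⊓ x) ⊔ b) ⊞ ρ a ≼ ρ (d ⊓ x) ⊞ ρ b ⇒
               ρ ((i ⊔ (d ⊓ x)) ⊔ (d ⊓ y)) ⊞ ρ a ≼ ρ (i ⊔ (d ⊓ x)) ⊞ ρ (d ⊓ y) ⇒
               ρ (d ⊓ x) ⊞ ρ (d ⊓ y) ≼ ρ ((d ⊓ x) ⊔ (d ⊓ y)) ⊞ ρ a ⇒
               ⊢ ρ (i ⊔ d) ⊞ ρ ((d ⊓ x) ⊔ b) ≼ ρ (i ⊔ ((d ⊓ x) ⊔ b)) ⊞ ρ d) I D X Y B A D⊆
              (≤-reflexive (sym a₁)) (≤-reflexive a₂) (≤-reflexive a₃) (≤-reflexive (sym a₄)))
            where
            a₁ = skew-rank skew A⊆B (A⊆Z I) (Z⊆ (I⊆X I⊆))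
            a₂ = skew-rank skew A⊆B A⊆DX DX⊆
            a₃ = skew-rank point-skew A⊆DY (A⊆Z I) (Z⊆ (I⊆X I⊆))
            a₄ = skew-rank point-skew A⊆DY A⊆DX DX⊆

          -- Both `B ∪ ⁅ y ⁆` and `DY ∪ ⁅ x ⁆` have the common point. Each acts on `X` as `Y` does,
          -- and the two are compared through `Z ∪ Y`.
          replace-point : ∀ I → I ⊆ S ─ ⁅ x ⁆ → r ((I ∪ ⁅ y ⁆) ∪ D′) + r D ≡ r ((I ∪ ⁅ x ⁆) ∪ D) + r D′
          replace-point I I⊆ = +-cancelʳ-≡ (r (Z ∪ Y) + r (Z ∪ Y)) _ _ (≤-antisym
            (by-rank 8 (λ i d x y b a s t → d ⊑ (x ⊔ y) ⇒
               ρ ((i ⊔ (d ⊓ x)) ⊔ (b ⊔ t)) ⊞ ρ y ≼ ρ ((i ⊔ (d ⊓ x)) ⊔ y) ⊞ ρ (b ⊔ t) ⇒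
               ρ (d ⊓ x) ⊞ ρ b ≼ ρ ((d ⊓ x) ⊔ b) ⊞ ρ a ⇒
               ρ ((i ⊔ (d ⊓ x)) ⊔ y) ⊞ ρ ((d ⊓ y) ⊔ s) ≼ ρ ((i ⊔ (d ⊓ x)) ⊔ ((d ⊓ y) ⊔ s)) ⊞ ρ y ⇒
               ρ ((d ⊓ x) ⊔ (d ⊓ y)) ⊞ ρ a ≼ ρ (d ⊓ x) ⊞ ρ (d ⊓ y) ⇒
               ρ (b ⊔ t) ≼ ρ b ⊞ # 1 ⇒ ρ (d ⊓ y) ⊞ # 1 ≼ ρ ((d ⊓ y) ⊔ s) ⇒
               ⊢ ρ ((i ⊔ t) ⊔ ((d ⊓ x) ⊔ b)) ⊞ ρ d ⊞ (ρ ((i ⊔ (d ⊓ x)) ⊔ y) ⊞ ρ ((i ⊔ (d ⊓ x)) ⊔ y)) ≼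
                 ρ ((i ⊔ s) ⊔ d) ⊞ ρ ((d ⊓ x) ⊔ b) ⊞ (ρ ((i ⊔ (d ⊓ x)) ⊔ y) ⊞ ρ ((i ⊔ (d ⊓ x)) ⊔ y))) I D X Y B A ⁅ x ⁆ ⁅ y ⁆ D⊆
              (≤-reflexive (sym a₁)) (≤-reflexive (sym a₂)) (≤-reflexive a₃) (≤-reflexive a₄) (insert-≤ B y) grows)
            (by-rank 8 (λ i d x y b a s t → d ⊑ (x ⊔ y) ⇒
               ρ ((i ⊔ (d ⊓ x)) ⊔ y) ⊞ ρ (b ⊔ t) ≼ ρ ((i ⊔ (d ⊓ x)) ⊔ (b ⊔ t)) ⊞ ρ y ⇒
               ρ ((d ⊓ x) ⊔ b) ⊞ ρ a ≼ ρ (d ⊓ x) ⊞ ρ b ⇒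
               ρ ((i ⊔ (d ⊓ x)) ⊔ ((d ⊓ y) ⊔ s)) ⊞ ρ y ≼ ρ ((i ⊔ (d ⊓ x)) ⊔ y) ⊞ ρ ((d ⊓ y) ⊔ s) ⇒
               ρ (d ⊓ x) ⊞ ρ (d ⊓ y) ≼ ρ ((d ⊓ x) ⊔ (d ⊓ y)) ⊞ ρ a ⇒
               ρ b ⊞ # 1 ≼ ρ (b ⊔ t) ⇒ ρ ((d ⊓ y) ⊔ s) ≼ ρ (d ⊓ y) ⊞ # 1 ⇒
               ⊢ ρ ((i ⊔ s) ⊔ d) ⊞ ρ ((d ⊓ x) ⊔ b) ⊞ (ρ ((i ⊔ (d ⊓ x)) ⊔ y) ⊞ ρ ((i ⊔ (d ⊓ x)) ⊔ y)) ≼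
                 ρ ((i ⊔ t) ⊔ ((d ⊓ x) ⊔ b)) ⊞ ρ d ⊞ (ρ ((i ⊔ (d ⊓ x)) ⊔ y) ⊞ ρ ((i ⊔ (d ⊓ x)) ⊔ y))) I D X Y B A ⁅ x ⁆ ⁅ y ⁆ D⊆
              (≤-reflexive a₁) (≤-reflexive a₂) (≤-reflexive (sym a₃)) (≤-reflexive (sym a₄)) grows-y (insert-≤ DY x)))
            where
            Z = I ∪ (D ∩ X)
            a₁ = nonskew-rank (¬skew ns) A⊆By By⊆Y (A⊆Z I) (Z⊆ (I⊆X I⊆))
            a₂ = skew-rank skew A⊆B A⊆DX DX⊆
            a₃ = nonskew-rank point-nonskew A⊆DYx DYx⊆Y (A⊆Z I) (Z⊆ (I⊆X I⊆))
            a₄ = skew-rank point-skew A⊆DY A⊆DX DX⊆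

          -- Otherwise `replace-point` for the set `⁅ y ⁆` would equate the rank of `y` over `D′`,
          -- at most one, with the rank of `x` and `y` over `D`, which is two since the minor is
          -- simple.
          new-point : y ∉ S ─ ⁅ x ⁆
          new-point y∈ = absurd (by-rank 4 (λ d d′ s t → ρ ((t ⊔ s) ⊔ d) ⊞ ρ d′ ≼ ρ ((t ⊔ t) ⊔ d′) ⊞ ρ d ⇒
              ρ (d′ ⊔ t) ≼ ρ d′ ⊞ # 1 ⇒ ρ d ⊞ # 2 ≼ ρ ((t ⊔ s) ⊔ d) ⇒ ⊢ # 1 ≼ # 0) D D′ ⁅ x ⁆ ⁅ y ⁆
            (≤-reflexive (sym (replace-point ⁅ y ⁆ (sing⊆ y∈)))) (insert-≤ D′ y)
            (simple split (large-S L) (proj₁ (∈─⁻ y∈)) x∈S (λ { refl → proj₂ (∈─⁻ y∈) (x∈⁅x⁆ y) })))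

          move-point : Y ⊆ E → Label ((S ─ ⁅ x ⁆) ∪ ⁅ y ⁆) (f [ y ↦ f x ]) D′
          move-point Y⊆E = relabel L x∈S (Y⊆E y∈Y) new-point replace-rest replace-point

    -- `A ∪ ⁅ z ⁆` is skew because `z` is outside the closure of `X`, and adding all of `Y` destroys
    -- skewness by `tight≥`. The insertion that breaks it yields `y`.
    last-skew : ∀ {z} → Y ⊆ E → z ∈ Y → z ∉ cl X →
      ∃[ B ] ∃[ y ] (A ∪ ⁅ z ⁆ ⊆ B × B ⊆ Y × y ∈ Y × Skew B × ¬ Skew (B ∪ ⁅ y ⁆))
    last-skew {z} Y⊆E z∈Y z∉ with last-good {Q = Skew} skew? (A ∪ ⁅ z ⁆) Y
        (by-rank 3 (λ a s x → ρ (a ⊔ s) ≼ ρ a ⊞ # 1 ⇒ ρ x ⊞ # 1 ≼ ρ (x ⊔ s) ⇒ ⊢ ρ (a ⊔ s) ⊞ ρ x ≼ ρ (x ⊔ (a ⊔ s)) ⊞ ρ a)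
          A ⁅ z ⁆ X (insert-≤ A z) (∉cl⁻ X z∉))
        (λ q → absurd (by-rank 5 (λ a s x y e → ρ ((a ⊔ s) ⊔ y) ⊞ ρ x ≼ ρ (x ⊔ ((a ⊔ s) ⊔ y)) ⊞ ρ a ⇒
            ρ (x ⊔ ((a ⊔ s) ⊔ y)) ≼ ρ e ⇒ ρ e ⊞ ρ a ⊞ # 1 ≼ ρ x ⊞ ρ y ⇒ ⊢ # 1 ≼ # 0) A ⁅ z ⁆ X Y E q (top _) tight≥))
    ... | B , y , ⊆B , B⊆ , y∈Y , sk , ns = B , y , ⊆B , (λ m → ∪-lub (∪-lub A⊆Y (sing⊆ z∈Y)) (λ h → h) (B⊆ m)) , y∈Y , sk , ns

    -- Wherever `D` lies, the minor can be realised with `z` among the contracted elements, at the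
    -- cost of at most the one element of `S` outside `X`.
    transfer : ∀ {S f D z} → Label S f D → A ⊆ D → D ⊆ E → Y ⊆ E → ∣ S ─ X ∣ ≤ 1 → z ∈ Y → z ∉ cl X →
      ∃[ S′ ] ∃[ f′ ] ∃[ D′ ] (Label S′ f′ D′ × A ∪ ⁅ z ⁆ ⊆ D′ × D′ ⊆ E × S ∩ X ⊆ S′)
    transfer {S} {f} {D} {z} L A⊆D D⊆E Y⊆E small z∈Y z∉ with nonempty? (S ─ X)
    ... | no empty = inside
      where
      S⊆X : S ⊆ X
      S⊆X {x} m with x ∈? X
      ... | yes h = h
      ... | no h = ⊥-elim (empty (x , x∈p∧x∉q⇒x∈p─q m h))
      inside : ∃[ S′ ] ∃[ f′ ] ∃[ D′ ] (Label S′ f′ D′ × A ∪ ⁅ z ⁆ ⊆ D′ × D′ ⊆ E × S ∩ X ⊆ S′)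
      inside with skew? (D ∩ Y)
      ... | yes sk = S , f , (D ∩ X) ∪ ⁅ z ⁆ , recontract L (λ I h → contract-skew A⊆D D⊆E sk z∉ I (λ m → S⊆X (h m))) ,
              ∪-lub (λ m → p⊆p∪q ⁅ z ⁆ (x∈p∩q⁺ (A⊆D m , A⊆X m))) (q⊆p∪q (D ∩ X) ⁅ z ⁆) ,
              ∪-lub (λ m → D⊆E (p∩q⊆p D X m)) (sing⊆ (Y⊆E z∈Y)) , p∩q⊆p S X
      ... | no ns = S , f , D ∪ Y , recontract L (λ I h → contract-nonskew A⊆D D⊆E ns I (λ m → S⊆X (h m))) ,
              ∪-lub (λ m → p⊆p∪q Y (A⊆D m)) (λ m → q⊆p∪q D Y (sing⊆ z∈Y m)) , ∪-lub D⊆E Y⊆E , p∩q⊆p S X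
    ... | yes (x , x∈) with last-skew Y⊆E z∈Y z∉
    ...   | B , y , ⊆B , B⊆Y , y∈Y , sk , ns = (S ─ ⁅ x ⁆) ∪ ⁅ y ⁆ , f [ y ↦ f x ] , (D ∩ X) ∪ B ,
              move-point A⊆D D⊆E L (proj₁ (∈─⁻ x∈)) (proj₂ (∈─⁻ x∈)) x∈Y rest (λ m → ⊆B (p⊆p∪q ⁅ z ⁆ m)) B⊆Y y∈Y sk ns Y⊆E ,
              (λ m → q⊆p∪q (D ∩ X) B (⊆B m)) , ∪-lub (λ m → D⊆E (p∩q⊆p D X m)) (λ m → Y⊆E (B⊆Y m)) , kept
      where
      x∈Y : x ∈ Y
      x∈Y = [ (λ h → ⊥-elim (proj₂ (∈─⁻ x∈) h)) , (λ h → h) ]′ (x∈p∪q⁻ X Y (cov (S⊆E L (proj₁ (∈─⁻ x∈)))))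
      rest : S ─ ⁅ x ⁆ ⊆ X
      rest {w} m with w ∈? X
      ... | yes h = h
      ... | no h = ⊥-elim (proj₂ (∈─⁻ m) (subst (_∈ ⁅ x ⁆) (card-one small x∈ (x∈p∧x∉q⇒x∈p─q (proj₁ (∈─⁻ m)) h)) (x∈⁅x⁆ x)))
      kept : S ∩ X ⊆ (S ─ ⁅ x ⁆) ∪ ⁅ y ⁆
      kept {w} m with x∈p∩q⁻ S X m
      ... | w∈S , w∈X = p⊆p∪q ⁅ y ⁆ (x∈p∧x∉q⇒x∈p─q w∈S (λ h → proj₂ (∈─⁻ x∈) (subst (_∈ X) (x∈⁅y⁆⇒x≡y x h) w∈X)))

-- The contraction process

module Finals {n m} {r : Subset n → ℕ} {E T : Subset n} (tri : Triangular r E T) (F : Subset m) (rF : Subset m → ℕ) where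
  open Labels tri F rF public

  -- By `spans`, separations of the restriction of `M / K` to `S ∪ T` can be measured against r(E).
  -- The last field is for separations that put a single element of `S`, spanned by `K ∪ T`, on the
  -- side that spans the triangle.
  record Final (K U S : Subset n) (f : Fin n → Fin m) : Set where
    constructor final
    field
      U⊆T : U ⊆ T
      K⊆E : K ⊆ E
      free : r K + 2 ≤ r (K ∪ T)
      lab : Label S f (K ∪ U)
      spans : r E ≤ r (S ∪ K)
      spans-without : ∀ {x} → x ∈ S → x ∈ cl (K ∪ T) → r E ≤ r ((S ─ ⁅ x ⁆) ∪ K)

module Descent {n m} {r : Subset n → ℕ} {E T : Subset n} (tri : Triangular r E T)
  (F : Subset m) (rF : Subset m → ℕ) (conn : Connected rF F) (large : 4 ≤ ∣ F ∣) where
  open Process tri F rF conn large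
  open Finals tri F rF using (Final; final)

  Big : Subset n → Subset n → Set
  Big S X = 2 ≤ ∣ S ∩ X ∣

  big-up : ∀ S {X Y} → X ⊆ Y → Big S X → Big S Y
  big-up S {X} {Y} h b = ≤-trans b (p⊆q⇒∣p∣≤∣q∣ (S.by-rank 3 (λ s x y → x ⊑ y ⇒ ⊢ (s ⊓ x) ⊑ (s ⊓ y)) S X Y h))

  record State (K S : Subset n) (f : Fin n → Fin m) (D : Subset n) : Set where
    constructor state
    field
      lab : Label S f D
      K⊆D : K ⊆ D
      D⊆E : D ⊆ E
      linked : Linked K (Big S)

  big-all : ∀ {S f D} → Label S f D → Big S S
  big-all {S} L = ≤-trans (two-S L) (p⊆q⇒∣p∣≤∣q∣ {p = S} (λ m → x∈p∩q⁺ (m , m)))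

  module _ {K S f D} (st : State K S f D) where
    open State st

    private split = label-split conn lab

    T-free : r K + 2 ≤ r (K ∪ T)
    T-free = rank-K∪T-≥ (big-up S) (big-all lab) linked

    Good : Fin n → Set
    Good z = ∃[ S′ ] ∃[ f′ ] ∃[ D′ ] State (K ∪ ⁅ z ⁆) S′ f′ D′

    private
      module Blocked {e X Y} (e∈D : e ∈ D) (e∉ : e ∉ cl (K ∪ T)) (cov : Cover (K ∪ ⁅ e ⁆) X Y) (big : Big S X)
        (tight : r X + r Y ≤ r E + r (K ∪ ⁅ e ⁆) + 1) where

        Y₀ A : Subset n
        -- `transfer` may contract the whole second side, which therefore has to lie in `E`.
        Y₀ = Y ∩ E
        A = K ∪ ⁅ e ⁆
        e∈A : e ∈ A
        e∈A = q⊆p∪q K ⁅ e ⁆ (x∈⁅x⁆ e)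
        K⊆A : K ⊆ A
        K⊆A = p⊆p∪q ⁅ e ⁆
        A⊆D : A ⊆ D
        A⊆D = ∪-lub K⊆D (sing⊆ e∈D)
        A⊆Y₀ : A ⊆ Y₀
        A⊆Y₀ m = x∈p∩q⁺ (K⊆Y cov m , D⊆E (A⊆D m))
        covE : E ⊆ X ∪ Y₀
        covE = S.by-rank 3 (λ e x y → e ⊑ (x ⊔ y) ⇒ ⊢ e ⊑ (x ⊔ (y ⊓ e))) E X Y (cover cov)
        cov₀ : Cover K X Y₀
        cov₀ = covers covE (λ m → K⊆X cov (K⊆A m)) (λ m → A⊆Y₀ (K⊆A m)) (λ m → x∈p∩q⁺ (T⊆Y cov m , T⊆E m))
        tight₁ : r X + r Y₀ ≤ r E + r A + 1
        tight₁ = ≤-trans (+-monoʳ-≤ (r X) (r-mono (p∩q⊆p Y E))) tight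
        lower : ∀ X Y z → r X + r Y ≤ r E + r (K ∪ ⁅ z ⁆) + 1 → r X + r Y ≤ r E + r K + 2
        lower X Y z h = by-rank 5 (λ x y e k s → ρ x ⊞ ρ y ≼ ρ e ⊞ ρ (k ⊔ s) ⊞ # 1 ⇒ ρ (k ⊔ s) ≼ ρ k ⊞ # 1 ⇒ ⊢ ρ x ⊞ ρ y ≼ ρ e ⊞ ρ k ⊞ # 2)
          X Y E K ⁅ z ⁆ h (insert-≤ K z)
        -- The cover has connectivity at least two over `K`, and contracting `e` lowers this by at
        -- most one.
        tight≥ : r E + r A + 1 ≤ r X + r Y₀
        tight≥ = by-rank 5 (λ x y e k s → ρ e ⊞ ρ k ⊞ # 2 ≼ ρ x ⊞ ρ y ⇒ ρ (k ⊔ s) ≼ ρ k ⊞ # 1 ⇒ ⊢ ρ e ⊞ ρ (k ⊔ s) ⊞ # 1 ≼ ρ x ⊞ ρ y)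
          X Y₀ E K ⁅ e ⁆ (linked cov₀ big) (insert-≤ K e)
        small : ∣ S ─ X ∣ ≤ 1
        small = small-side split (S⊆E lab) D⊆E A⊆D covE (K⊆X cov) A⊆Y₀ tight₁ big

        Rejected : Fin n → Set
        Rejected z = ∃[ X₂ ] ∃[ Y₂ ] (Cover K X₂ Y₂ × z ∈ X₂ × z ∈ Y₂ × Big S (X ∩ X₂) × r X₂ + r Y₂ ≤ r E + r K + 2)

        decide : ∀ {z S′ f′ D′} → Label S′ f′ D′ → K ∪ ⁅ z ⁆ ⊆ D′ → D′ ⊆ E → S ∩ X ⊆ S′ →
                 Linked (K ∪ ⁅ z ⁆) (Big S′) ⊎ Separated (K ∪ ⁅ z ⁆) (Big S′) → Good z ⊎ Rejected z
        decide L′ Kz⊆D′ D′⊆E kept (inj₁ ok) = inj₁ (_ , _ , _ , state L′ Kz⊆D′ D′⊆E ok)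
        decide {z} {S′} L′ Kz⊆D′ D′⊆E kept (inj₂ (X₂ , Y₂ , cov₂ , big₂ , tight₂)) = inj₂ (X₂ , Y₂ ,
          covers (cover cov₂) (λ m → K⊆X cov₂ (p⊆p∪q ⁅ z ⁆ m)) (λ m → K⊆Y cov₂ (p⊆p∪q ⁅ z ⁆ m)) (T⊆Y cov₂) ,
          K⊆X cov₂ (q⊆p∪q K ⁅ z ⁆ (x∈⁅x⁆ z)) , K⊆Y cov₂ (q⊆p∪q K ⁅ z ⁆ (x∈⁅x⁆ z)) ,
          -- At most one of the four or more elements of `S` is outside `X`. The others belong to
          -- `S′`, so at most one of them is outside `X₂`, and two remain.
          CardSolver.by-rank 4 (λ s x u s′ → (s ⊓ x) ⊑ s′ ⇒ ρ (s′ ∖ u) ≼ # 1 ⇒ ρ (s ∖ x) ≼ # 1 ⇒ # 4 ≼ ρ s ⇒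
             sub (s ⊓ (x ⊓ u)) (s′ ∖ u) ⇒ sub (s ⊓ x) (s ∖ x) ⇒ ⊢ # 2 ≼ ρ (s ⊓ (x ⊓ u))) S X X₂ S′ kept small₂ small (large-S lab) ,
          lower X₂ Y₂ z tight₂)
          where
          small₂ : ∣ S′ ─ X₂ ∣ ≤ 1
          small₂ = small-side (label-split conn L′) (S⊆E L′) D′⊆E Kz⊆D′ (cover cov₂) (K⊆X cov₂) (K⊆Y cov₂) tight₂ big₂

        test : ∀ z → z ∈ E → z ∉ cl X → z ∉ cl (K ∪ T) → Good z ⊎ Rejected z
        test z z∈E z∉X z∉KT = use (Skew.transfer covE (K⊆X cov) A⊆Y₀ tight₁ tight≥ lab A⊆D D⊆E (p∩q⊆q Y E) small
            ([ (λ h → ⊥-elim (z∉X (⊆cl X h))) , (λ h → h) ]′ (x∈p∪q⁻ X Y₀ (covE z∈E))) z∉X)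
          where
          use : ∃[ S′ ] ∃[ f′ ] ∃[ D′ ] (Label S′ f′ D′ × A ∪ ⁅ z ⁆ ⊆ D′ × D′ ⊆ E × S ∩ X ⊆ S′) → Good z ⊎ Rejected z
          use (S′ , f′ , D′ , L′ , Az⊆D′ , D′⊆E , kept) =
            decide L′ (∪-lub (λ m → Az⊆D′ (p⊆p∪q ⁅ z ⁆ (K⊆A m))) (λ m → Az⊆D′ (q⊆p∪q A ⁅ z ⁆ m))) D′⊆E kept
              (linked? (K ∪ ⁅ z ⁆) (λ X → 2 ≤? ∣ S′ ∩ X ∣))

        result : ∃[ z ] (z ∈ E × z ∉ cl X × z ∉ cl (K ∪ T) × Good z)
        result = Exchange.exchange linked (big-up S) cov₀ big test (lower X Y₀ e tight₁) (K⊆X cov e∈A) (A⊆Y₀ e∈A) e∉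

    step : ∀ {e} → e ∈ D → e ∉ cl (K ∪ T) → ∃[ z ] (z ∉ cl (K ∪ T) × Good z)
    step {e} e∈D e∉ = use (linked? (K ∪ ⁅ e ⁆) (λ X → 2 ≤? ∣ S ∩ X ∣))
      where
      use : Linked (K ∪ ⁅ e ⁆) (Big S) ⊎ Separated (K ∪ ⁅ e ⁆) (Big S) → ∃[ z ] (z ∉ cl (K ∪ T) × Good z)
      use (inj₁ ok) = e , e∉ , S , f , D , state lab (∪-lub K⊆D (sing⊆ e∈D)) D⊆E ok
      use (inj₂ (X , Y , cov , big , tight)) = let z , _ , _ , z∉ , good = Blocked.result e∈D e∉ cov big tight in z , z∉ , good

    -- The closures of `X` and `K ∪ T` cannot cover `E`: `T` adds only two to the rank of `K`, and
    -- `X` is not spanning, so the connectivity would be below two.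
    escape : ∀ X → Big S X → K ⊆ X → r X + 1 ≤ r E → ∃[ z ] (z ∈ E × z ∉ cl X × z ∉ cl (K ∪ T))
    escape X big K⊆X small = outside-two E X (K ∪ T) λ cov → absurd (by-rank 6
      (λ x e k t c d → ρ e ⊞ ρ k ⊞ # 2 ≼ ρ c ⊞ ρ d ⇒ ρ c ≼ ρ x ⇒ ρ d ≼ ρ (k ⊔ t) ⇒ ρ (k ⊔ t) ≼ ρ k ⊞ # 2 ⇒
         ρ x ⊞ # 1 ≼ ρ e ⇒ ⊢ # 1 ≼ # 0) X E K T (cl X) (cl (K ∪ T))
      (linked (covers cov (λ m → ⊆cl X (K⊆X m)) (λ m → ⊆cl (K ∪ T) (p⊆p∪q T m)) (λ m → ⊆cl (K ∪ T) (q⊆p∪q K T m)))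
              (big-up S (⊆cl X) big))
      (r-cl X) (r-cl (K ∪ T)) (rank-K∪T-≤ K) small)

    -- `K` stays the same, but some contracted set now has an element outside the closure of
    -- `K ∪ T`, so that `step` applies again.
    Advance : Set
    Advance = ∃[ z ] (z ∉ cl (K ∪ T) × ∃[ S′ ] ∃[ f′ ] ∃[ D′ ] (State K S′ f′ D′ × z ∈ D′))

    Finish : Set
    Finish = Advance ⊎ ∃[ U ] Final K U S f

    private
      K⊆E : K ⊆ E
      K⊆E m = D⊆E (K⊆D m)

    advance : ∀ {D′} → Label S f D′ → K ⊆ D′ → D′ ⊆ E → ∀ {z} → z ∈ D′ → z ∉ cl (K ∪ T) → Advance
    advance L K⊆ ⊆E {z} z∈ z∉ = z , z∉ , S , f , _ , state L K⊆ ⊆E linked , z∈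

    -- An element outside the closure of `S ∪ D′` is skew to `S` over `D′`, and its contraction
    -- changes no rank on `S`.
    contract-outside : ∀ {D₀ D′ z} → Label S f D₀ → z ∉ cl (S ∪ D′) →
      (∀ I → I ⊆ S → r (I ∪ D′) + r D₀ ≡ r (I ∪ D₀) + r D′) → Label S f (D′ ∪ ⁅ z ⁆)
    contract-outside {D₀} {D′} {z} L z∉ e = recontract L λ I I⊆S → ≤-antisym
      (by-rank 4 (λ i d d′ s → ρ (i ⊔ d′) ⊞ ρ d ≼ ρ (i ⊔ d) ⊞ ρ d′ ⇒ ρ ((i ⊔ d′) ⊔ s) ≼ ρ (i ⊔ d′) ⊞ # 1 ⇒ ρ d′ ⊞ # 1 ≼ ρ (d′ ⊔ s) ⇒
         ⊢ ρ (i ⊔ (d′ ⊔ s)) ⊞ ρ d ≼ ρ (i ⊔ d) ⊞ ρ (d′ ⊔ s)) I D₀ D′ ⁅ z ⁆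
        (≤-reflexive (e I I⊆S)) (insert-≤ (I ∪ D′) z) (∉cl⁻ D′ (λ h → z∉ (cl-mono (q⊆p∪q S D′) h))))
      (by-rank 4 (λ i d d′ s → ρ (i ⊔ d) ⊞ ρ d′ ≼ ρ (i ⊔ d′) ⊞ ρ d ⇒ ρ (d′ ⊔ s) ≼ ρ d′ ⊞ # 1 ⇒ ρ (i ⊔ d′) ⊞ # 1 ≼ ρ ((i ⊔ d′) ⊔ s) ⇒
         ⊢ ρ (i ⊔ d) ⊞ ρ (d′ ⊔ s) ≼ ρ (i ⊔ (d′ ⊔ s)) ⊞ ρ d) I D₀ D′ ⁅ z ⁆
        (≤-reflexive (sym (e I I⊆S))) (insert-≤ D′ z)
        (∉cl⁻ (I ∪ D′) (λ h → z∉ (cl-mono (S.by-rank 3 (λ i s d → i ⊑ s ⇒ ⊢ (i ⊔ d) ⊑ (s ⊔ d)) I S D′ I⊆S) h))))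

    -- The bounds say that `D₀` is skew to `S` over `D′`: it adds at least as much to the rank of
    -- `S ∪ D′` as to that of `D′`. This is how contracted elements of the triangle are given up.
    extend-equal : ∀ {D₀ D′ δ} → r (S ∪ D′) + δ ≤ r (S ∪ D₀) → D′ ⊆ D₀ → r D₀ ≤ r D′ + δ →
      ∀ I → I ⊆ S → r (I ∪ D′) + r D₀ ≡ r (I ∪ D₀) + r D′
    extend-equal {D₀} {D′} {δ} lo D′⊆ hi I I⊆S = ≤-antisym
      (begin
        r (I ∪ D′) + r D₀       ≤⟨ +-monoʳ-≤ (r (I ∪ D′)) hi ⟩
        r (I ∪ D′) + (r D′ + δ) ≡⟨ x∙yz≈xz∙y (r (I ∪ D′)) (r D′) δ ⟩
        r (I ∪ D′) + δ + r D′   ≤⟨ +-monoˡ-≤ (r D′) raised ⟩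
        r (I ∪ D₀) + r D′ ∎)
      (by-rank 3 (λ i d d′ → d′ ⊑ d ⇒ sub (i ⊔ d′) d ⇒ ⊢ ρ (i ⊔ d) ⊞ ρ d′ ≼ ρ (i ⊔ d′) ⊞ ρ d) I D₀ D′ D′⊆)
      where
      open ≤-Reasoning
      raised : r (I ∪ D′) + δ ≤ r (I ∪ D₀)
      raised = +-cancelˡ-≤ (r (S ∪ D′)) _ _ (begin
        r (S ∪ D′) + (r (I ∪ D′) + δ) ≡⟨ x∙yz≈xz∙y (r (S ∪ D′)) (r (I ∪ D′)) δ ⟩
        r (S ∪ D′) + δ + r (I ∪ D′)   ≤⟨ +-monoˡ-≤ (r (I ∪ D′)) lo ⟩
        r (S ∪ D₀) + r (I ∪ D′)       ≤⟨ by-rank 4 (λ i s d d′ → i ⊑ s ⇒ d′ ⊑ d ⇒ sub (i ⊔ d) (s ⊔ d′) ⇒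
              ⊢ ρ (s ⊔ d) ⊞ ρ (i ⊔ d′) ≼ ρ (s ⊔ d′) ⊞ ρ (i ⊔ d)) I S D₀ D′ I⊆S D′⊆ ⟩
        r (S ∪ D′) + r (I ∪ D₀) ∎)

    same-span : ∀ {D₀ D′} → Label S f D₀ → r (D₀ ∪ D′) ≤ r D₀ → r (D₀ ∪ D′) ≤ r D′ → Label S f D′
    same-span {D₀} {D′} L h h′ = recontract L λ I _ → ≤-antisym
      (by-rank 3 (λ i d d′ → ρ (d ⊔ d′) ≼ ρ d′ ⇒ sub (i ⊔ d) (d ⊔ d′) ⇒ ⊢ ρ (i ⊔ d′) ⊞ ρ d ≼ ρ (i ⊔ d) ⊞ ρ d′) I D₀ D′ h′)
      (by-rank 3 (λ i d d′ → ρ (d ⊔ d′) ≼ ρ d ⇒ sub (i ⊔ d′) (d ⊔ d′) ⇒ ⊢ ρ (i ⊔ d) ⊞ ρ d′ ≼ ρ (i ⊔ d′) ⊞ ρ d) I D₀ D′ h)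

    rank-K∪t : ∀ {t} → t ∈ T → r (K ∪ T) ≤ r (K ∪ ⁅ t ⁆) + 1
    rank-K∪t {t} t∈ = by-rank 3 (λ k t s → s ⊑ t ⇒ ρ t ≼ # 2 ⇒ # 1 ≼ ρ s ⇒ sub (k ⊔ s) t ⇒ ⊢ ρ (k ⊔ t) ≼ ρ (k ⊔ s) ⊞ # 1)
      K T ⁅ t ⁆ (sing⊆ t∈) rank-T (nonloop-T t∈)

    private
      below : ∀ {a b} → ¬ a ≤ b → b + 1 ≤ a
      below {b = b} h = ≤-trans (≤-reflexive (+-comm b 1)) (≰⇒> h)

      K∪T⊆E : K ∪ T ⊆ E
      K∪T⊆E = ∪-lub K⊆E T⊆E

    -- The three cases are: D spans nothing of T, a point of T, or all of T over K.
    finish-∅ : r D ≤ r K → Finish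
    finish-∅ rD≤ = use (r E ≤? r (S ∪ K))
      where
      L : Label S f K
      L = same-span lab (r-mono (∪-lub (λ m → m) K⊆D)) (≤-trans (r-mono (∪-lub (λ m → m) K⊆D)) rD≤)
      L∅ : Label S f (K ∪ ∅)
      L∅ = subst (Label S f) (sym (∪-identityʳ K)) L
      use : Dec (r E ≤ r (S ∪ K)) → Finish
      use (yes spans) = inj₂ (∅ , final (λ m → ⊥-elim (∉⊥ m)) K⊆E T-free L∅ spans
        λ {x} x∈ _ → ≤-trans spans (noncoloop (label-split conn L) (two-S L) x∈))
      use (no ¬spans) = let z , z∈E , z∉ , z∉KT = escape (S ∪ K) (big-up S (p⊆p∪q K) (big-all lab)) (q⊆p∪q S K) (below ¬spans) in
        inj₁ (advance (contract-outside L z∉ (λ _ _ → refl)) (p⊆p∪q ⁅ z ⁆) (∪-lub K⊆E (sing⊆ z∈E)) (q⊆p∪q K ⁅ z ⁆ (x∈⁅x⁆ z)) z∉KT)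

    finish-T : D ⊆ cl (K ∪ T) → r K + 2 ≤ r D → Finish
    finish-T D⊆ rD≥ = use (r E ≤? r (S ∪ K)) (r E ≤? r (S ∪ (K ∪ T)))
      where
      joint : r (D ∪ (K ∪ T)) ≤ r (K ∪ T)
      joint = ≤-trans (r-mono (∪-lub D⊆ (⊆cl (K ∪ T)))) (r-cl (K ∪ T))
      L : Label S f (K ∪ T)
      L = same-span lab (≤-trans joint (≤-trans (rank-K∪T-≤ K) rD≥)) joint
      use : Dec (r E ≤ r (S ∪ K)) → Dec (r E ≤ r (S ∪ (K ∪ T))) → Finish
      -- An element of `S` in the closure of `K ∪ T` would be a loop after the contraction of `T`.
      use (yes spans) _ = inj₂ (T , final (λ m → m) K⊆E T-free L spans λ {x} x∈ x∈cl → ⊥-elim (∉cl⁺ (K ∪ T)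
        (≤-trans (nonloop (label-split conn L) (two-S L) x∈) (≤-reflexive (cong r (∪-comm ⁅ x ⁆ (K ∪ T))))) x∈cl))
      use (no _) (no ¬spans) = let z , z∈E , z∉ = outside (S ∪ (K ∪ T)) E (≤-trans (≰⇒> ¬spans) (r-mono (q⊆p∪q _ E))) in
        inj₁ (advance (contract-outside L z∉ (λ _ _ → refl)) (λ m → p⊆p∪q ⁅ z ⁆ (p⊆p∪q T m)) (∪-lub K∪T⊆E (sing⊆ z∈E))
          (q⊆p∪q (K ∪ T) ⁅ z ⁆ (x∈⁅x⁆ z)) (λ h → z∉ (cl-mono (q⊆p∪q S (K ∪ T)) h)))
      use (no ¬spans) (yes spansT) = go point
        where
        -- If `S ∪ K` falls short of full rank by two, any `t` leaves `S ∪ (K ∪ ⁅ t ⁆)`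
        -- non-spanning. If it falls short by one, `meets` finds `t` in its closure.
        point : ∃[ t ] (t ∈ T × r (S ∪ (K ∪ ⁅ t ⁆)) + 1 ≤ r E)
        point with r (S ∪ K) + 2 ≤? r E
        ... | yes low with card-pos {A = T} (≤-trans (s≤s z≤n) (≤-reflexive (sym size-T)))
        ...   | t , t∈ = t , t∈ , by-rank 4 (λ s k t e → ρ ((s ⊔ k) ⊔ t) ≼ ρ (s ⊔ k) ⊞ # 1 ⇒ ρ (s ⊔ k) ⊞ # 2 ≼ ρ e ⇒
                  ⊢ ρ (s ⊔ (k ⊔ t)) ⊞ # 1 ≼ ρ e) S K ⁅ t ⁆ E (insert-≤ (S ∪ K) t) low
        point | no high with meets (S ∪ K) (≤-antisym
                (≤-trans (top _) (≤-pred (≤-trans (≰⇒> high) (≤-reflexive (+-suc (r (S ∪ K)) 1)))))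
                (≤-trans (below ¬spans) (≤-trans spansT (≤-reflexive (cong r (sym (∪-assoc S K T)))))))
        ...   | t , t∈ , le = t , t∈ , by-rank 4 (λ s k t e → ρ ((s ⊔ k) ⊔ t) ≼ ρ (s ⊔ k) ⇒ ρ (s ⊔ k) ⊞ # 1 ≼ ρ e ⇒
                  ⊢ ρ (s ⊔ (k ⊔ t)) ⊞ # 1 ≼ ρ e) S K ⁅ t ⁆ E le (below ¬spans)
        go : ∃[ t ] (t ∈ T × r (S ∪ (K ∪ ⁅ t ⁆)) + 1 ≤ r E) → Finish
        go (t , t∈ , small) = let z , z∈E , z∉ , z∉KT = escape (S ∪ (K ∪ ⁅ t ⁆)) (big-up S (p⊆p∪q _) (big-all lab)) (λ m → q⊆p∪q S _ (p⊆p∪q ⁅ t ⁆ m)) small in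
          inj₁ (advance (contract-outside L z∉ (extend-equal (≤-trans small spansT) (∪-lub (p⊆p∪q T) (λ m → q⊆p∪q K T (sing⊆ t∈ m))) (rank-K∪t t∈)))
            (λ m → p⊆p∪q ⁅ z ⁆ (p⊆p∪q ⁅ t ⁆ m)) (∪-lub (∪-lub K⊆E (λ m → T⊆E (sing⊆ t∈ m))) (sing⊆ z∈E)) (q⊆p∪q _ ⁅ z ⁆ (x∈⁅x⁆ z)) z∉KT)

    module Point {u} (u∈T : u ∈ T) (L : Label S f (K ∪ ⁅ u ⁆)) where

      private
        Ku : Subset n
        Ku = K ∪ ⁅ u ⁆
        Ku⊆E : Ku ⊆ E
        Ku⊆E = ∪-lub K⊆E (λ m → T⊆E (sing⊆ u∈T m))
        usplit = label-split conn L

      -- The closure of `K ∪ T` has rank at most one over `K ∪ ⁅ u ⁆`, so two elements of `S` in it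
      -- would be parallel in the minor.
      unique : ∀ {x y} → x ∈ S → y ∈ S → x ∈ cl (K ∪ T) → y ∈ cl (K ∪ T) → x ≡ y
      unique {x} {y} x∈ y∈ x∈cl y∈cl with x ≟ y
      ... | yes e = e
      ... | no ne = absurd (by-rank 5 (λ k t u x y → u ⊑ t ⇒ ρ ((k ⊔ t) ⊔ x) ≼ ρ (k ⊔ t) ⇒ ρ ((k ⊔ t) ⊔ y) ≼ ρ (k ⊔ t) ⇒
          ρ (k ⊔ u) ⊞ # 2 ≼ ρ ((x ⊔ y) ⊔ (k ⊔ u)) ⇒ ρ (k ⊔ t) ≼ ρ (k ⊔ u) ⊞ # 1 ⇒ sub ((k ⊔ t) ⊔ x) ((k ⊔ t) ⊔ y) ⇒ ⊢ # 1 ≼ # 0)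
          K T ⁅ u ⁆ ⁅ x ⁆ ⁅ y ⁆ (sing⊆ u∈T) (cl⁻ (K ∪ T) x∈cl) (cl⁻ (K ∪ T) y∈cl) (simple usplit (large-S L) x∈ y∈ ne) (rank-K∪t u∈T))

      away : ¬ r E ≤ r (S ∪ Ku) → Finish
      away ¬spans = let z , z∈E , z∉ , z∉KT = escape (S ∪ Ku) (big-up S (p⊆p∪q Ku) (big-all lab)) (λ m → q⊆p∪q S Ku (p⊆p∪q ⁅ u ⁆ m)) (below ¬spans) in
        inj₁ (advance (contract-outside L z∉ (λ _ _ → refl)) (λ m → p⊆p∪q ⁅ z ⁆ (p⊆p∪q ⁅ u ⁆ m)) (∪-lub Ku⊆E (sing⊆ z∈E))
          (q⊆p∪q Ku ⁅ z ⁆ (x∈⁅x⁆ z)) z∉KT)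

      -- If `S ∪ K` does not span, then `u` is outside its closure and contracting `u` has no effect
      -- on `S`. So `u` can be given up in favour of an element `z` outside the closure of `K ∪ T`.
      none-in-span : r E ≤ r (S ∪ Ku) → (∀ {x} → x ∈ S → x ∉ cl (K ∪ T)) → Finish
      none-in-span spansu none = use (r E ≤? r (S ∪ K))
        where
        use : Dec (r E ≤ r (S ∪ K)) → Finish
        use (yes spans) = inj₂ (⁅ u ⁆ , final (sing⊆ u∈T) K⊆E T-free L spans (λ x∈ x∈cl → ⊥-elim (none x∈ x∈cl)))
        use (no ¬spans) = let z , z∈E , z∉ , z∉KT = escape (S ∪ K) (big-up S (p⊆p∪q K) (big-all lab)) (q⊆p∪q S K) (below ¬spans) in
          inj₁ (advance (contract-outside L z∉ (extend-equal (≤-trans (below ¬spans) spansu) (p⊆p∪q ⁅ u ⁆) (insert-≤ K u)))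
            (p⊆p∪q ⁅ z ⁆) (∪-lub K⊆E (sing⊆ z∈E)) (q⊆p∪q K ⁅ z ⁆ (x∈⁅x⁆ z)) z∉KT)

      module _ {x} (x∈S : x ∈ S) (x∈cl : x ∈ cl (K ∪ T)) (spansu : r E ≤ r (S ∪ Ku)) where

        private
          R : Subset n
          R = S ─ ⁅ x ⁆
          R⊆S : R ⊆ S
          R⊆S m = proj₁ (∈─⁻ m)
          spansR : r E ≤ r (R ∪ Ku)
          spansR = ≤-trans spansu (noncoloop usplit (two-S L) x∈S)
          bigR : Big S (R ∪ K)
          bigR = big-up S {R} (p⊆p∪q K) (CardSolver.by-rank 2 (λ s c → # 4 ≼ ρ s ⇒ ρ c ≼ # 1 ⇒ sub c (s ∖ c) ⇒
            ⊢ # 2 ≼ ρ (s ⊓ (s ∖ c))) S ⁅ x ⁆ (large-S L) (≤-reflexive (∣⁅x⁆∣≡1 x)))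

        -- Here t takes over the place of x, so that the contraction of u becomes superfluous.
        swap-in : ¬ r E ≤ r (R ∪ K) → Advance
        swap-in ¬spans = go (meets (R ∪ K) (≤-antisym
            (≤-trans (top _) (by-rank 4 (λ e a k u → ρ e ≼ ρ (a ⊔ (k ⊔ u)) ⇒ ρ ((a ⊔ k) ⊔ u) ≼ ρ (a ⊔ k) ⊞ # 1 ⇒
                ⊢ ρ e ≼ ρ (a ⊔ k) ⊞ # 1) E R K ⁅ u ⁆ spansR (insert-≤ (R ∪ K) u)))
            (≤-trans (below ¬spans) (≤-trans spansR (by-rank 4 (λ a k t u → u ⊑ t ⇒ ⊢ ρ (a ⊔ (k ⊔ u)) ≼ ρ ((a ⊔ k) ⊔ t)) R K T ⁅ u ⁆ (sing⊆ u∈T))))))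
          (escape (R ∪ K) bigR (q⊆p∪q R K) (below ¬spans))
          where
          go : ∃[ t ] (t ∈ T × r ((R ∪ K) ∪ ⁅ t ⁆) ≤ r (R ∪ K)) → ∃[ z ] (z ∈ E × z ∉ cl (R ∪ K) × z ∉ cl (K ∪ T)) → Advance
          go (t , t∈T , t∈cl) (z , z∈E , z∉ , z∉KT) = z , z∉KT , R ∪ ⁅ t ⁆ , f [ t ↦ f x ] , D′ ,
              state L′ (p⊆p∪q ⁅ z ⁆) D′⊆E linked′ , q⊆p∪q K ⁅ z ⁆ (x∈⁅x⁆ z)
            where
            D′ : Subset n
            D′ = K ∪ ⁅ z ⁆
            D′⊆E : D′ ⊆ E
            D′⊆E = ∪-lub K⊆E (sing⊆ z∈E)
            above-u : r (R ∪ K) + 1 ≤ r (R ∪ Ku)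
            above-u = ≤-trans (below ¬spans) spansR
            above-z : r (R ∪ K) + 1 ≤ r ((R ∪ K) ∪ ⁅ z ⁆)
            above-z = ∉cl⁻ (R ∪ K) z∉
            t≢u : u ≢ t
            t≢u refl = absurd (by-rank 3 (λ a k u → ρ (a ⊔ k) ⊞ # 1 ≼ ρ (a ⊔ (k ⊔ u)) ⇒ ρ ((a ⊔ k) ⊔ u) ≼ ρ (a ⊔ k) ⇒
                ⊢ # 1 ≼ # 0) R K ⁅ u ⁆ above-u t∈cl)
            t∉R : t ∉ R
            t∉R m = proj₂ (∈─⁻ m) (subst (_∈ ⁅ x ⁆) (unique x∈S (R⊆S m) x∈cl (⊆cl (K ∪ T) (q⊆p∪q K T t∈T))) (x∈⁅x⁆ x))
            rise-z : r K + 1 ≤ r D′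
            rise-z = ∉cl⁻ K (λ h → z∉ (cl-mono (q⊆p∪q R K) h))
            rise-u : r K + 1 ≤ r Ku
            rise-u = by-rank 3 (λ a k u → ρ (a ⊔ k) ⊞ # 1 ≼ ρ (a ⊔ (k ⊔ u)) ⇒ sub (a ⊔ k) (k ⊔ u) ⇒ ⊢ ρ k ⊞ # 1 ≼ ρ (k ⊔ u)) R K ⁅ u ⁆ above-u
            -- Both `u` and `z` lie outside the closure of `R ∪ K`, so contracting either leaves the
            -- ranks on `R` over `K` unchanged.
            e₀ : ∀ I → I ⊆ R → r (I ∪ D′) + r Ku ≡ r (I ∪ Ku) + r D′
            e₀ I I⊆R = ≤-antisym
              (by-rank 5 (λ i a k u z → i ⊑ a ⇒ ρ ((i ⊔ k) ⊔ z) ≼ ρ (i ⊔ k) ⊞ # 1 ⇒ ρ (k ⊔ u) ≼ ρ k ⊞ # 1 ⇒ ρ k ⊞ # 1 ≼ ρ (k ⊔ z) ⇒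
                 ρ (a ⊔ k) ⊞ # 1 ≼ ρ (a ⊔ (k ⊔ u)) ⇒ sub (a ⊔ k) (i ⊔ (k ⊔ u)) ⇒
                 ⊢ ρ (i ⊔ (k ⊔ z)) ⊞ ρ (k ⊔ u) ≼ ρ (i ⊔ (k ⊔ u)) ⊞ ρ (k ⊔ z)) I R K ⁅ u ⁆ ⁅ z ⁆ I⊆R (insert-≤ (I ∪ K) z)
                     (insert-≤ K u) rise-z above-u)
              (by-rank 5 (λ i a k u z → i ⊑ a ⇒ ρ ((i ⊔ k) ⊔ u) ≼ ρ (i ⊔ k) ⊞ # 1 ⇒ ρ (k ⊔ z) ≼ ρ k ⊞ # 1 ⇒ ρ k ⊞ # 1 ≼ ρ (k ⊔ u) ⇒
                 ρ (a ⊔ k) ⊞ # 1 ≼ ρ ((a ⊔ k) ⊔ z) ⇒ sub (a ⊔ k) (i ⊔ (k ⊔ z)) ⇒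
                 ⊢ ρ (i ⊔ (k ⊔ u)) ⊞ ρ (k ⊔ z) ≼ ρ (i ⊔ (k ⊔ z)) ⊞ ρ (k ⊔ u)) I R K ⁅ u ⁆ ⁅ z ⁆ I⊆R (insert-≤ (I ∪ K) u)
                     (insert-≤ K z) rise-u above-z)
            -- Over `K ∪ ⁅ u ⁆` the closure of `K ∪ T` has rank one, and `t` and `x` are nonloops in
            -- it; hence they are parallel.
            swap : ∀ I → r ((I ∪ ⁅ t ⁆) ∪ Ku) ≡ r ((I ∪ ⁅ x ⁆) ∪ Ku)
            swap I = ≤-antisym
              (by-rank 6 (λ i k t u s x → u ⊑ t ⇒ s ⊑ t ⇒ ρ ((k ⊔ t) ⊔ x) ≼ ρ (k ⊔ t) ⇒ ρ (k ⊔ t) ≼ ρ (k ⊔ u) ⊞ # 1 ⇒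
                 ρ (k ⊔ u) ⊞ # 1 ≼ ρ (x ⊔ (k ⊔ u)) ⇒ sub ((i ⊔ x) ⊔ (k ⊔ u)) ((k ⊔ t) ⊔ x) ⇒
                 ⊢ ρ ((i ⊔ s) ⊔ (k ⊔ u)) ≼ ρ ((i ⊔ x) ⊔ (k ⊔ u))) I K T ⁅ u ⁆ ⁅ t ⁆ ⁅ x ⁆
                (sing⊆ u∈T) (sing⊆ t∈T) (cl⁻ (K ∪ T) x∈cl) (rank-K∪t u∈T) (nonloop usplit (two-S L) x∈S))
              (by-rank 6 (λ i k t u s x → u ⊑ t ⇒ s ⊑ t ⇒ ρ ((k ⊔ t) ⊔ x) ≼ ρ (k ⊔ t) ⇒ ρ t ≼ # 2 ⇒ # 2 ≼ ρ (u ⊔ s) ⇒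
                 sub ((i ⊔ s) ⊔ (k ⊔ u)) t ⇒ sub ((i ⊔ k) ⊔ t) ((k ⊔ t) ⊔ x) ⇒
                 ⊢ ρ ((i ⊔ x) ⊔ (k ⊔ u)) ≼ ρ ((i ⊔ s) ⊔ (k ⊔ u))) I K T ⁅ u ⁆ ⁅ t ⁆ ⁅ x ⁆
                (sing⊆ u∈T) (sing⊆ t∈T) (cl⁻ (K ∪ T) x∈cl) rank-T (pair u∈T t∈T t≢u))
            e₁ : ∀ I → I ⊆ R → r ((I ∪ ⁅ t ⁆) ∪ D′) + r Ku ≡ r ((I ∪ ⁅ x ⁆) ∪ Ku) + r D′
            e₁ I I⊆R = trans (≤-antisym
              (by-rank 6 (λ i a k u z s → i ⊑ a ⇒ ρ ((a ⊔ k) ⊔ s) ≼ ρ (a ⊔ k) ⇒ ρ (((i ⊔ s) ⊔ k) ⊔ z) ≼ ρ ((i ⊔ s) ⊔ k) ⊞ # 1 ⇒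
                  ρ (k ⊔ u) ≼ ρ k ⊞ # 1 ⇒ ρ k ⊞ # 1 ≼ ρ (k ⊔ z) ⇒
                 ρ (a ⊔ k) ⊞ # 1 ≼ ρ (a ⊔ (k ⊔ u)) ⇒ sub ((a ⊔ k) ⊔ s) ((i ⊔ s) ⊔ (k ⊔ u)) ⇒
                 ⊢ ρ ((i ⊔ s) ⊔ (k ⊔ z)) ⊞ ρ (k ⊔ u) ≼ ρ ((i ⊔ s) ⊔ (k ⊔ u)) ⊞ ρ (k ⊔ z)) I R K ⁅ u ⁆ ⁅ z ⁆ ⁅ t ⁆ I⊆R t∈cl (insert-≤
                     ((I ∪ ⁅ t ⁆) ∪ K) z) (insert-≤ K u) rise-z above-u)
              (by-rank 6 (λ i a k u z s → i ⊑ a ⇒ ρ ((a ⊔ k) ⊔ s) ≼ ρ (a ⊔ k) ⇒ ρ (((i ⊔ s) ⊔ k) ⊔ u) ≼ ρ ((i ⊔ s) ⊔ k) ⊞ # 1 ⇒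
                  ρ (k ⊔ z) ≼ ρ k ⊞ # 1 ⇒ ρ k ⊞ # 1 ≼ ρ (k ⊔ u) ⇒
                 ρ (a ⊔ k) ⊞ # 1 ≼ ρ ((a ⊔ k) ⊔ z) ⇒ sub ((a ⊔ k) ⊔ s) ((i ⊔ s) ⊔ (k ⊔ z)) ⇒
                 ⊢ ρ ((i ⊔ s) ⊔ (k ⊔ u)) ⊞ ρ (k ⊔ z) ≼ ρ ((i ⊔ s) ⊔ (k ⊔ z)) ⊞ ρ (k ⊔ u)) I R K ⁅ u ⁆ ⁅ z ⁆ ⁅ t ⁆ I⊆R t∈cl (insert-≤
                     ((I ∪ ⁅ t ⁆) ∪ K) u) (insert-≤ K z) rise-u above-z))
              (cong (_+ r D′) (swap I))
            L′ : Label (R ∪ ⁅ t ⁆) (f [ t ↦ f x ]) D′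
            L′ = relabel L x∈S (T⊆E t∈T) t∉R e₀ e₁
            -- A violating cover leaves at most one element of `R ∪ ⁅ t ⁆` outside `X`. So at least
            -- three are in `X`, and two of them differ from `t` and belong to `S`, against
            -- `linked`.
            linked′ : Linked K (Big (R ∪ ⁅ t ⁆))
            linked′ with linked? K {Big (R ∪ ⁅ t ⁆)} (λ X → 2 ≤? ∣ (R ∪ ⁅ t ⁆) ∩ X ∣)
            ... | inj₁ ok = ok
            ... | inj₂ (X , Y , cov , big , tight) = ⊥-elim (<-irrefl refl (≤-trans (s≤s (linked cov
                  (CardSolver.by-rank 4 (λ s c t x → # 4 ≼ ρ ((s ∖ c) ⊔ t) ⇒ ρ (((s ∖ c) ⊔ t) ∖ x) ≼ # 1 ⇒ ρ t ≼ # 1 ⇒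
                      sub (((s ∖ c) ⊔ t) ⊓ x) (((s ∖ c) ⊔ t) ∖ x) ⇒ sub (s ⊓ x) t ⇒ ⊢ # 2 ≼ ρ (s ⊓ x)) S ⁅ x ⁆ ⁅ t ⁆ X
                    (large-S L′) (small-side (label-split conn L′) (S⊆E L′) D′⊆E (p⊆p∪q ⁅ z ⁆) (cover cov) (K⊆X cov) (K⊆Y cov) tight big)
                    (≤-reflexive (∣⁅x⁆∣≡1 t)))))
                  (≤-trans (s≤s tight) (≤-reflexive (sym (+-suc (r E + r K) 1))))))

        one-in-span : Finish
        one-in-span with r E ≤? r (R ∪ K)
        ... | yes spans = inj₂ (⁅ u ⁆ , final (sing⊆ u∈T) K⊆E T-free L
                (≤-trans spans (r-mono (S.by-rank 3 (λ s c k → ⊢ ((s ∖ c) ⊔ k) ⊑ (s ⊔ k)) S ⁅ x ⁆ K)))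
                (λ y∈ y∈cl → subst (λ w → r E ≤ r ((S ─ ⁅ w ⁆) ∪ K)) (unique x∈S y∈ x∈cl y∈cl) spans))
        ... | no ¬spans = inj₁ (swap-in ¬spans)

      finish-u : Finish
      finish-u = use (r E ≤? r (S ∪ Ku)) (any? (λ x → (x ∈? S) ×-dec (x ∈? cl (K ∪ T))))
        where
        use : Dec (r E ≤ r (S ∪ Ku)) → Dec (∃[ x ] (x ∈ S × x ∈ cl (K ∪ T))) → Finish
        use (no ¬spans) _ = away ¬spans
        use (yes spans) (no none) = none-in-span spans (λ {x} x∈ x∈cl → none (x , x∈ , x∈cl))
        use (yes spans) (yes (x , x∈ , x∈cl)) = one-in-span x∈ x∈cl spans

    finish : D ⊆ cl (K ∪ T) → Finish
    finish D⊆ = use (r D ≤? r K) (r K + 2 ≤? r D)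
      where
      joint : r (D ∪ T) ≤ r (K ∪ T)
      joint = ≤-trans (r-mono (∪-lub D⊆ (λ m → ⊆cl (K ∪ T) (q⊆p∪q K T m)))) (r-cl (K ∪ T))
      use : Dec (r D ≤ r K) → Dec (r K + 2 ≤ r D) → Finish
      use (yes lo) _ = finish-∅ lo
      use (no _) (yes hi) = finish-T D⊆ hi
      -- Here `D` has rank one over `K`, and so has `T` over `D`. Thus `meets` yields a point `u` of
      -- `T` in the closure of `D`, and `K ∪ ⁅ u ⁆` has the same span as `D`.
      use (no ¬lo) (no ¬hi) = go (meets D (≤-antisym
            (≤-trans joint (≤-trans (rank-K∪T-≤ K) (≤-trans (≤-reflexive (sym (+-assoc (r K) 1 1))) (+-monoˡ-≤ 1 (below ¬lo)))))
            (≤-trans (below ¬hi) (≤-trans T-free (by-rank 3 (λ k t d → k ⊑ d ⇒ ⊢ ρ (k ⊔ t) ≼ ρ (d ⊔ t)) K T D K⊆D)))))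
        where
        go : ∃[ u ] (u ∈ T × r (D ∪ ⁅ u ⁆) ≤ r D) → Finish
        go (u , u∈T , u∈cl) = Point.finish-u u∈T (same-span lab
          (by-rank 3 (λ k d u → k ⊑ d ⇒ ρ (d ⊔ u) ≼ ρ d ⇒ ⊢ ρ (d ⊔ (k ⊔ u)) ≼ ρ d) K D ⁅ u ⁆ K⊆D u∈cl)
          (by-rank 4 (λ k d u t → k ⊑ d ⇒ ρ (d ⊔ u) ≼ ρ d ⇒ ρ d ⊞ # 1 ≼ ρ k ⊞ # 2 ⇒ ρ k ⊞ # 2 ≼ ρ (k ⊔ t) ⇒ ρ (k ⊔ t) ≼ ρ (k ⊔ u) ⊞ # 1 ⇒
             ⊢ ρ (d ⊔ (k ⊔ u)) ≼ ρ (k ⊔ u)) K D ⁅ u ⁆ T K⊆D u∈cl (below ¬hi) T-free (rank-K∪t u∈T)))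

  descend : ∀ fuel {K S f D} → r E < fuel + r K → State K S f D → ∃[ K′ ] ∃[ U ] ∃[ S′ ] ∃[ f′ ] Final K′ U S′ f′
  descend zero {K} bound st = ⊥-elim (<-irrefl refl (≤-trans bound (top K)))
  descend (suc fuel) {K} {S} {f} {D} bound st = use (any? (λ e → (e ∈? D) ×-dec ¬? (e ∈? cl (K ∪ T))))
    where
    Result : Set
    Result = ∃[ K′ ] ∃[ U ] ∃[ S′ ] ∃[ f′ ] Final K′ U S′ f′
    next : ∀ {S f D} → State K S f D → ∀ {e} → e ∈ D → e ∉ cl (K ∪ T) → Result
    next st e∈ e∉ = let z , z∉ , S′ , f′ , D′ , st′ = step st e∈ e∉ in
      descend fuel (≤-trans bound (≤-trans (≤-reflexive (sym (+-suc fuel (r K)))) (+-monoʳ-≤ fuel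
        (≤-trans (≤-reflexive (+-comm 1 (r K))) (∉cl⁻ K (λ h → z∉ (cl-mono (p⊆p∪q T) h))))))) st′
    use : Dec (∃[ e ] (e ∈ D × e ∉ cl (K ∪ T))) → Result
    use (yes (e , e∈ , e∉)) = next st e∈ e∉
    use (no none) = conclude (finish st λ {x} m → inside x m)
      where
      inside : ∀ x → x ∈ D → x ∈ cl (K ∪ T)
      inside x m with x ∈? cl (K ∪ T)
      ... | yes h = h
      ... | no h = ⊥-elim (none (x , m , h))
      conclude : Advance st ⊎ ∃[ U ] Final K U S f → Result
      conclude (inj₁ (z , z∉ , S′ , f′ , D′ , st′ , z∈)) = next st′ z∈ z∉
      conclude (inj₂ (U , fin)) = K , U , S , f , fin

-- Exchanging parallel elements

module Reduction {n m} {r : Subset n → ℕ} {E T : Subset n} (tri : Triangular r E T)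
  (F : Subset m) (rF : Subset m → ℕ) (conn : Connected rF F) (two : 2 ≤ ∣ F ∣) where
  open Finals tri F rF public

  -- Required over `K` and not over `K ∪ U`, because `N` may consist of three parallel elements.
  Simple : Subset n → Subset n → Set
  Simple K S = ∀ {s t} → s ∈ S → t ∈ S → s ≢ t → r K + 2 ≤ r ((⁅ s ⁆ ∪ ⁅ t ⁆) ∪ K)

  module _ {K U S f} (fin : Final K U S f) where
    open Final fin

    private
      split = label-split conn lab
      two-S : 2 ≤ ∣ S ∣
      two-S = ≤-trans two (≤-reflexive (sym (label-size lab)))

    nonloop-K : ∀ {s} → s ∈ S → r K + 1 ≤ r (K ∪ ⁅ s ⁆)
    nonloop-K {s} s∈ = by-rank 3 (λ k u s → ρ (k ⊔ u) ⊞ # 1 ≼ ρ (s ⊔ (k ⊔ u)) ⇒ sub (k ⊔ u) (k ⊔ s) ⇒ ⊢ ρ k ⊞ # 1 ≼ ρ (k ⊔ s)) K U ⁅ s ⁆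
      (nonloop split two-S s∈)

    avoids-U : ∀ {s} → s ∈ S → s ∉ U
    avoids-U {s} s∈ s∈U = absurd (by-rank 3 (λ k u s → s ⊑ u ⇒ ρ (k ⊔ u) ⊞ # 1 ≼ ρ (s ⊔ (k ⊔ u)) ⇒ ⊢ # 1 ≼ # 0) K U ⁅ s ⁆
      (sing⊆ s∈U) (nonloop split two-S s∈))

    nonloop-t : ∀ {t} → t ∈ T → r K + 1 ≤ r (K ∪ ⁅ t ⁆)
    nonloop-t {t} t∈ = by-rank 3 (λ k t s → s ⊑ t ⇒ ρ t ≼ # 2 ⇒ # 1 ≼ ρ s ⇒ ρ k ⊞ # 2 ≼ ρ (k ⊔ t) ⇒ sub (k ⊔ s) t ⇒ ⊢ ρ k ⊞ # 1 ≼ ρ (k ⊔ s))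
      K T ⁅ t ⁆ (sing⊆ t∈) rank-T (nonloop-T t∈) free

    -- `T` has rank one over `K ∪ ⁅ x ⁆`, so `meets` puts one of its elements into the closure of
    -- that set.
    parallel : ∀ {x} → x ∈ S → x ∈ cl (K ∪ T) → ∃[ t ] (t ∈ T × r ((K ∪ ⁅ x ⁆) ∪ ⁅ t ⁆) ≤ r (K ∪ ⁅ x ⁆))
    parallel {x} x∈S x∈cl = meets (K ∪ ⁅ x ⁆) (≤-antisym
      (by-rank 3 (λ k t x → ρ ((k ⊔ t) ⊔ x) ≼ ρ (k ⊔ t) ⇒ ρ (k ⊔ t) ≼ ρ k ⊞ # 2 ⇒ ρ k ⊞ # 1 ≼ ρ (k ⊔ x) ⇒ ⊢ ρ ((k ⊔ x) ⊔ t) ≼ ρ (k ⊔ x) ⊞ # 1)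
        K T ⁅ x ⁆ (cl⁻ (K ∪ T) x∈cl) (rank-K∪T-≤ K) (nonloop-K x∈S))
      (by-rank 3 (λ k t x → ρ k ⊞ # 2 ≼ ρ (k ⊔ t) ⇒ ρ (k ⊔ x) ≼ ρ k ⊞ # 1 ⇒ ⊢ ρ (k ⊔ x) ⊞ # 1 ≼ ρ ((k ⊔ x) ⊔ t))
        K T ⁅ x ⁆ free (insert-≤ K x)))

    module Swap (simp : Simple K S) {x} (x∈S : x ∈ S) (x∈cl : x ∈ cl (K ∪ T)) (x∉T : x ∉ T)
      {t} (t∈T : t ∈ T) (t∥x : r ((K ∪ ⁅ x ⁆) ∪ ⁅ t ⁆) ≤ r (K ∪ ⁅ x ⁆)) where

      private
        R = S ─ ⁅ x ⁆

      S′ : Subset n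
      S′ = R ∪ ⁅ t ⁆

      private
        par : ∀ A → K ⊆ A → r (A ∪ ⁅ t ⁆) ≡ r (A ∪ ⁅ x ⁆)
        par A K⊆A = ≤-antisym
          (by-rank 4 (λ a k x t → k ⊑ a ⇒ ρ ((k ⊔ x) ⊔ t) ≼ ρ (k ⊔ x) ⇒ sub (a ⊔ x) ((k ⊔ x) ⊔ t) ⇒ ⊢ ρ (a ⊔ t) ≼ ρ (a ⊔ x)) A K ⁅ x ⁆ ⁅ t ⁆ K⊆A t∥x)
          (by-rank 4 (λ a k x t → k ⊑ a ⇒ ρ ((k ⊔ x) ⊔ t) ≼ ρ (k ⊔ x) ⇒ ρ (k ⊔ x) ≼ ρ k ⊞ # 1 ⇒ ρ k ⊞ # 1 ≼ ρ (k ⊔ t) ⇒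
             sub (a ⊔ t) ((k ⊔ x) ⊔ t) ⇒ ⊢ ρ (a ⊔ x) ≼ ρ (a ⊔ t)) A K ⁅ x ⁆ ⁅ t ⁆ K⊆A t∥x (insert-≤ K x) (nonloop-t t∈T))

        t≢x : t ≢ x
        t≢x e = x∉T (subst (_∈ T) e t∈T)

        t∉R : t ∉ R
        t∉R h = absurd (by-rank 3 (λ k x t → ρ ((k ⊔ x) ⊔ t) ≼ ρ (k ⊔ x) ⇒ ρ (k ⊔ x) ≼ ρ k ⊞ # 1 ⇒ ρ k ⊞ # 2 ≼ ρ ((t ⊔ x) ⊔ k) ⇒
            ⊢ # 1 ≼ # 0) K ⁅ x ⁆ ⁅ t ⁆
          t∥x (insert-≤ K x) (simp (proj₁ (∈─⁻ h)) x∈S t≢x))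

      swapped : Final K U S′ (f [ t ↦ f x ])
      swapped = final U⊆T K⊆E free
        (relabel lab x∈S (T⊆E t∈T) t∉R (λ _ _ → refl) (λ I _ → cong (_+ r (K ∪ U)) (shift I)))
        (≤-trans spans (≤-trans (by-rank 3 (λ s c k → c ⊑ s ⇒ ⊢ ρ (s ⊔ k) ≼ ρ (((s ∖ c) ⊔ k) ⊔ c)) S ⁅ x ⁆ K (sing⊆ x∈S))
          (≤-trans (≤-reflexive (sym (par (R ∪ K) (q⊆p∪q R K)))) (by-rank 3 (λ a k t → ⊢ ρ ((a ⊔ k) ⊔ t) ≼ ρ ((a ⊔ t) ⊔ k)) R K ⁅ t ⁆))))
        without
        where
        shift : ∀ I → r ((I ∪ ⁅ t ⁆) ∪ (K ∪ U)) ≡ r ((I ∪ ⁅ x ⁆) ∪ (K ∪ U))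
        shift I = trans (rearrange t) (trans (par (I ∪ (K ∪ U)) (λ m → q⊆p∪q I (K ∪ U) (p⊆p∪q U m))) (sym (rearrange x)))
          where
          rearrange : ∀ w → r ((I ∪ ⁅ w ⁆) ∪ (K ∪ U)) ≡ r ((I ∪ (K ∪ U)) ∪ ⁅ w ⁆)
          rearrange w = ≤-antisym (by-rank 3 (λ i d w → ⊢ ρ ((i ⊔ w) ⊔ d) ≼ ρ ((i ⊔ d) ⊔ w)) I (K ∪ U) ⁅ w ⁆)
                                  (by-rank 3 (λ i d w → ⊢ ρ ((i ⊔ d) ⊔ w) ≼ ρ ((i ⊔ w) ⊔ d)) I (K ∪ U) ⁅ w ⁆)
        disjoint : ∀ {w} → w ∉ R → (⁅ w ⁆ ∩ R) ⊆ ∅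
        disjoint {w} h {y} m with x∈p∩q⁻ ⁅ w ⁆ R m
        ... | y∈ , y∈R = ⊥-elim (h (subst (_∈ R) (x∈⁅y⁆⇒x≡y w y∈) y∈R))
        without : ∀ {y} → y ∈ S′ → y ∈ cl (K ∪ T) → r E ≤ r ((S′ ─ ⁅ y ⁆) ∪ K)
        without {y} y∈ y∈cl with x∈p∪q⁻ R ⁅ t ⁆ y∈
        ... | inj₂ y∈t rewrite x∈⁅y⁆⇒x≡y t y∈t = ≤-trans (spans-without x∈S x∈cl)
              (by-rank 3 (λ a t k → (t ⊓ a) ⊑ ∅ˢ ⇒ ⊢ ρ (a ⊔ k) ≼ ρ (((a ⊔ t) ∖ t) ⊔ k)) R ⁅ t ⁆ K (disjoint t∉R))
        ... | inj₁ y∈R = ≤-trans (spans-without (proj₁ (∈─⁻ y∈R)) y∈cl) (≤-trans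
              (by-rank 4 (λ s x y k → ⊢ ρ ((s ∖ y) ⊔ k) ≼ ρ ((((s ∖ x) ∖ y) ⊔ k) ⊔ x)) S ⁅ x ⁆ ⁅ y ⁆ K)
              (≤-trans (≤-reflexive (sym (par ((R ─ ⁅ y ⁆) ∪ K) (q⊆p∪q (R ─ ⁅ y ⁆) K))))
                (by-rank 4 (λ a y t k → (t ⊓ y) ⊑ ∅ˢ ⇒ ⊢ ρ (((a ∖ y) ⊔ k) ⊔ t) ≼ ρ (((a ⊔ t) ∖ y) ⊔ k)) R ⁅ y ⁆ ⁅ t ⁆ K apart)))
          where
          apart : (⁅ t ⁆ ∩ ⁅ y ⁆) ⊆ ∅
          apart {w} m with x∈p∩q⁻ ⁅ t ⁆ ⁅ y ⁆ m
          ... | a , b = ⊥-elim (t∉R (subst (_∈ R) (trans (sym (x∈⁅y⁆⇒x≡y y b)) (x∈⁅y⁆⇒x≡y t a)) y∈R))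

      simple-swapped : Simple K S′
      simple-swapped {a} {b} a∈ b∈ a≢b with x∈p∪q⁻ R ⁅ t ⁆ a∈ | x∈p∪q⁻ R ⁅ t ⁆ b∈
      ... | inj₁ p | inj₁ q = simp (proj₁ (∈─⁻ p)) (proj₁ (∈─⁻ q)) a≢b
      ... | inj₁ p | inj₂ q rewrite x∈⁅y⁆⇒x≡y t q = ≤-trans (simp (proj₁ (∈─⁻ p)) x∈S (λ { refl → proj₂ (∈─⁻ p) (x∈⁅x⁆ x) }))
            (≤-trans (by-rank 3 (λ a x k → ⊢ ρ ((a ⊔ x) ⊔ k) ≼ ρ ((a ⊔ k) ⊔ x)) ⁅ a ⁆ ⁅ x ⁆ K) (≤-trans (≤-reflexive (sym (par (⁅ a ⁆ ∪ K)
                (q⊆p∪q ⁅ a ⁆ K))))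
              (by-rank 3 (λ a x k → ⊢ ρ ((a ⊔ k) ⊔ x) ≼ ρ ((a ⊔ x) ⊔ k)) ⁅ a ⁆ ⁅ t ⁆ K)))
      ... | inj₂ p | inj₁ q rewrite x∈⁅y⁆⇒x≡y t p = ≤-trans (simp (proj₁ (∈─⁻ q)) x∈S (λ { refl → proj₂ (∈─⁻ q) (x∈⁅x⁆ x) }))
            (≤-trans (by-rank 3 (λ a x k → ⊢ ρ ((a ⊔ x) ⊔ k) ≼ ρ ((a ⊔ k) ⊔ x)) ⁅ b ⁆ ⁅ x ⁆ K) (≤-trans (≤-reflexive (sym (par (⁅ b ⁆ ∪ K)
                (q⊆p∪q ⁅ b ⁆ K))))
              (by-rank 3 (λ a x k → ⊢ ρ ((a ⊔ k) ⊔ x) ≼ ρ ((x ⊔ a) ⊔ k)) ⁅ b ⁆ ⁅ t ⁆ K)))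
      ... | inj₂ p | inj₂ q = ⊥-elim (a≢b (trans (x∈⁅y⁆⇒x≡y t p) (sym (x∈⁅y⁆⇒x≡y t q))))

      fewer : ∣ S′ ─ T ∣ < ∣ S ─ T ∣
      fewer = p⊂q⇒∣p∣<∣q∣ ((λ m → S.by-rank 4 (λ s x t c → t ⊑ c ⇒ ⊢ (((s ∖ x) ⊔ t) ∖ c) ⊑ (s ∖ c)) S ⁅ x ⁆ ⁅ t ⁆ T (sing⊆ t∈T) m) , x ,
        x∈p∧x∉q⇒x∈p─q x∈S x∉T , λ h → [ (λ m → proj₂ (∈─⁻ m) (x∈⁅x⁆ x)) , (λ m → t≢x (sym (x∈⁅y⁆⇒x≡y t m))) ]′ (x∈p∪q⁻ R ⁅ t ⁆ (proj₁ (∈─⁻ h))))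

  -- An element of `S ─ T` in the closure of `K ∪ T` would be parallel over `K` to an element of
  -- `T`, which gives a 2-separation of the restriction to `S ∪ T`.
  Reduced : Subset n → Subset n → Set
  Reduced K S = ∀ {x} → x ∈ S → x ∈ cl (K ∪ T) → x ∈ T

  reduce : ∀ fuel {K U S f} → ∣ S ─ T ∣ ≤ fuel → Final K U S f → Simple K S →
           ∃[ S′ ] ∃[ f′ ] (Final K U S′ f′ × Simple K S′ × Reduced K S′)
  reduce fuel {K} {U} {S} {f} bound fin simp = use fuel bound (any? (λ x → (x ∈? S) ×-dec ((x ∈? cl (K ∪ T)) ×-dec ¬? (x ∈? T))))
    where
    Result : Set
    Result = ∃[ S′ ] ∃[ f′ ] (Final K U S′ f′ × Simple K S′ × Reduced K S′)
    smaller-than-zero : ∀ {k} → ¬ k < 0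
    smaller-than-zero ()
    use : ∀ fuel → ∣ S ─ T ∣ ≤ fuel → Dec (∃[ x ] (x ∈ S × x ∈ cl (K ∪ T) × x ∉ T)) → Result
    use _ _ (no none) = S , f , fin , simp , λ {x} → inside x
      where
      inside : ∀ x → x ∈ S → x ∈ cl (K ∪ T) → x ∈ T
      inside x x∈ x∈cl with x ∈? T
      ... | yes h = h
      ... | no h = ⊥-elim (none (x , x∈ , x∈cl , h))
    use fuel bound (yes (x , x∈ , x∈cl , x∉T)) = swap fuel bound (parallel fin x∈ x∈cl)
      where
      swap : ∀ fuel → ∣ S ─ T ∣ ≤ fuel → ∃[ t ] (t ∈ T × r ((K ∪ ⁅ x ⁆) ∪ ⁅ t ⁆) ≤ r (K ∪ ⁅ x ⁆)) → Result
      swap zero bound (t , t∈ , t∥x) = ⊥-elim (smaller-than-zero (≤-trans (Swap.fewer fin simp x∈ x∈cl x∉T t∈ t∥x) bound))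
      swap (suc fuel) bound (t , t∈ , t∥x) = reduce fuel (≤-pred (≤-trans (Swap.fewer fin simp x∈ x∈cl x∉T t∈ t∥x) bound))
        (Swap.swapped fin simp x∈ x∈cl x∉T t∈ t∥x) (Swap.simple-swapped fin simp x∈ x∈cl x∉T t∈ t∥x)

  module _ {K U S f} (fin : Final K U S f) (simp : Simple K S) (reduced : Reduced K S) where
    open Final fin

    private
      W : Subset n
      W = S ∪ T
      split = label-split conn lab
      two-S : 2 ≤ ∣ S ∣
      two-S = ≤-trans two (≤-reflexive (sym (label-size lab)))

      nonloop-W : ∀ {w} → w ∈ W → r K + 1 ≤ r (K ∪ ⁅ w ⁆)
      nonloop-W w∈ = [ nonloop-K fin , nonloop-t fin ]′ (x∈p∪q⁻ S T w∈)

      pair-T : ∀ {a b} → a ∈ T → b ∈ T → a ≢ b → r K + 2 ≤ r ((⁅ a ⁆ ∪ ⁅ b ⁆) ∪ K)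
      pair-T {a} {b} a∈ b∈ a≢b = by-rank 4 (λ k t a b → a ⊑ t ⇒ b ⊑ t ⇒ ρ t ≼ # 2 ⇒ # 2 ≼ ρ (a ⊔ b) ⇒ ρ k ⊞ # 2 ≼ ρ (k ⊔ t) ⇒
        sub ((a ⊔ b) ⊔ k) t ⇒ ⊢ ρ k ⊞ # 2 ≼ ρ ((a ⊔ b) ⊔ k)) K T ⁅ a ⁆ ⁅ b ⁆ (sing⊆ a∈) (sing⊆ b∈) rank-T (pair a∈ b∈ a≢b) free

      pair-mixed : ∀ {s t} → s ∈ S → s ∉ T → t ∈ T → r K + 2 ≤ r ((⁅ s ⁆ ∪ ⁅ t ⁆) ∪ K)
      pair-mixed {s} {t} s∈ s∉T t∈ = by-rank 4 (λ k t s u → u ⊑ t ⇒ ρ (k ⊔ t) ⊞ # 1 ≼ ρ ((k ⊔ t) ⊔ s) ⇒ ρ k ⊞ # 1 ≼ ρ (k ⊔ u) ⇒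
        sub ((s ⊔ u) ⊔ k) (k ⊔ t) ⇒
            ⊢ ρ k ⊞ # 2 ≼ ρ ((s ⊔ u) ⊔ k)) K T ⁅ s ⁆ ⁅ t ⁆ (sing⊆ t∈) (∉cl⁻ (K ∪ T) (λ h → s∉T (reduced s∈ h))) (nonloop-t fin t∈)

      simple-W : ∀ {a b} → a ∈ W → b ∈ W → a ≢ b → r K + 2 ≤ r ((⁅ a ⁆ ∪ ⁅ b ⁆) ∪ K)
      simple-W {a} {b} a∈ b∈ a≢b with a ∈? T | b ∈? T
      ... | yes p | yes q = pair-T p q a≢b
      ... | yes p | no q = ≤-trans (pair-mixed (in-S b∈ q) q p) (≤-reflexive (cong (λ X → r (X ∪ K)) (∪-comm ⁅ b ⁆ ⁅ a ⁆)))
        where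
        in-S : ∀ {b} → b ∈ W → b ∉ T → b ∈ S
        in-S b∈ q = [ (λ h → h) , (λ h → ⊥-elim (q h)) ]′ (x∈p∪q⁻ S T b∈)
      ... | no p | yes q = pair-mixed ([ (λ h → h) , (λ h → ⊥-elim (p h)) ]′ (x∈p∪q⁻ S T a∈)) p q
      ... | no p | no q = simp ([ (λ h → h) , (λ h → ⊥-elim (p h)) ]′ (x∈p∪q⁻ S T a∈)) ([ (λ h → h) , (λ h → ⊥-elim (q h)) ]′ (x∈p∪q⁻ S T b∈)) a≢b

      small-rank : ∀ k {Y} → k < 3 → Y ⊆ W → k ≤ ∣ Y ∣ → r K + k ≤ r (Y ∪ K)
      small-rank 0 {Y} _ _ _ = ≤-trans (≤-reflexive (+-identityʳ _)) (r-mono (q⊆p∪q Y K))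
      small-rank 1 {Y} _ Y⊆W h with card-pos h
      ... | w , w∈ = ≤-trans (nonloop-W (Y⊆W w∈)) (r-mono (∪-lub (q⊆p∪q Y K) (λ m → p⊆p∪q K (sing⊆ w∈ m))))
      small-rank 2 {Y} _ Y⊆W h with card-two h
      ... | a , b , a∈ , b∈ , a≢b = ≤-trans (simple-W (Y⊆W a∈) (Y⊆W b∈) a≢b)
            (by-rank 4 (λ a b y k → a ⊑ y ⇒ b ⊑ y ⇒ ⊢ ρ ((a ⊔ b) ⊔ k) ≼ ρ (y ⊔ k)) ⁅ a ⁆ ⁅ b ⁆ Y K (sing⊆ a∈) (sing⊆ b∈))
      small-rank (suc (suc (suc k))) (s≤s (s≤s (s≤s ())))

      -- One side of any separation contains two of the three elements of `T` and therefore spans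
      -- `T`; this side is called `X`.
      module Side {X Y a b} (W⊆ : W ⊆ X ∪ Y) (X⊆W : X ⊆ W) (Y⊆W : Y ⊆ W)
        (a∈T : a ∈ T) (b∈T : b ∈ T) (a∈X : a ∈ X) (b∈X : b ∈ X) (a≢b : a ≢ b) where

        S⊆ : S ⊆ X ∪ Y
        S⊆ m = W⊆ (p⊆p∪q T m)

        spans-T : r ((X ∪ K) ∪ T) ≤ r (X ∪ K)
        spans-T = by-rank 5 (λ x k t a b → a ⊑ t ⇒ b ⊑ t ⇒ a ⊑ x ⇒ b ⊑ x ⇒ ρ t ≼ # 2 ⇒ # 2 ≼ ρ (a ⊔ b) ⇒ sub (x ⊔ k) t ⇒
            ⊢ ρ ((x ⊔ k) ⊔ t) ≼ ρ (x ⊔ k))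
          X K T ⁅ a ⁆ ⁅ b ⁆ (sing⊆ a∈T) (sing⊆ b∈T) (sing⊆ a∈X) (sing⊆ b∈X) rank-T (pair a∈T b∈T a≢b)

        rank-X : r K + 2 ≤ r (X ∪ K)
        rank-X = small-rank 2 ≤-refl X⊆W (two-card a∈X b∈X a≢b)

        full+ : ∀ {p q k} → r E ≤ p → r K + k ≤ q → r E + r K + k ≤ p + q
        full+ h h′ = ≤-trans (≤-reflexive (+-assoc (r E) (r K) _)) (+-mono-≤ h h′)

        +full : ∀ {p q k} → k ≤ 2 → r K + 2 ≤ p → r E ≤ q → r E + r K + k ≤ p + q
        +full {p} {q} k≤2 h h′ = ≤-trans (full+ h′ (≤-trans (+-monoʳ-≤ (r K) k≤2) h)) (≤-reflexive (+-comm q p))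

        private
          module Few {x} (few : ∣ S ∩ X ∣ ≤ 1) (x∈ : x ∈ S ∩ X) where
            x∈S : x ∈ S
            x∈S = p∩q⊆p S X x∈
            rest : S ─ ⁅ x ⁆ ⊆ Y
            rest {w} m with x∈p∪q⁻ X Y (S⊆ (proj₁ (∈─⁻ m)))
            ... | inj₂ h = h
            ... | inj₁ h = ⊥-elim (proj₂ (∈─⁻ m) (subst (_∈ ⁅ x ⁆) (card-one {A = S ∩ X} few x∈ (x∈p∩q⁺ (proj₁ (∈─⁻ m) , h))) (x∈⁅x⁆ x)))
            in-span : x ∈ cl (K ∪ T) → r E ≤ r (Y ∪ K)
            in-span x∈cl = ≤-trans (spans-without x∈S x∈cl)
              (by-rank 3 (λ a y k → a ⊑ y ⇒ ⊢ ρ (a ⊔ k) ≼ ρ (y ⊔ k)) (S ─ ⁅ x ⁆) Y K rest)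
            -- `X` spans `T` and contains `x`, so its rank over `K` is at least three, while `Y`
            -- contains `S ─ ⁅ x ⁆` and is at most one short of full rank.
            off-span : x ∉ cl (K ∪ T) → r E + r K + 2 ≤ r (X ∪ K) + r (Y ∪ K)
            off-span x∉cl = by-rank 7
              (λ e s x y k t c → c ⊑ x ⇒ c ⊑ s ⇒ (s ∖ c) ⊑ y ⇒ ρ e ≼ ρ (s ⊔ k) ⇒ ρ ((x ⊔ k) ⊔ t) ≼ ρ (x ⊔ k) ⇒ ρ (k ⊔ t) ⊞ # 1 ≼ ρ ((k ⊔ t) ⊔ c) ⇒
                 ρ k ⊞ # 2 ≼ ρ (k ⊔ t) ⇒ ρ (((s ∖ c) ⊔ k) ⊔ c) ≼ ρ ((s ∖ c) ⊔ k) ⊞ # 1 ⇒ ⊢ ρ e ⊞ ρ k ⊞ # 2 ≼ ρ (x ⊔ k) ⊞ ρ (y ⊔ k))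
              E S X Y K T ⁅ x ⁆ (sing⊆ (p∩q⊆q S X x∈)) (sing⊆ x∈S) rest spans spans-T (∉cl⁻ (K ∪ T) x∉cl) free (insert-≤ ((S ─ ⁅ x ⁆) ∪ K) x)

          -- The only element of `S` outside `X` is no coloop of the minor over `K ∪ U`, and `X`
          -- spans `U`.
          full-X : ∀ {s} → ∣ S ─ X ∣ ≤ 1 → s ∈ S ─ X → r E ≤ r (X ∪ K)
          full-X {s} few s∈ = by-rank 7 (λ e s x k t u c → (s ∖ c) ⊑ x ⇒ u ⊑ t ⇒ ρ e ≼ ρ (s ⊔ k) ⇒ ρ (s ⊔ (k ⊔ u)) ≼ ρ ((s ∖ c) ⊔ (k ⊔ u)) ⇒
                    ρ ((x ⊔ k) ⊔ t) ≼ ρ (x ⊔ k) ⇒ ⊢ ρ e ≼ ρ (x ⊔ k)) E S X K T U ⁅ s ⁆ rest U⊆T spans (noncoloop split two-S (proj₁ (∈─⁻ s∈))) spans-T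
            where
            rest : S ─ ⁅ s ⁆ ⊆ X
            rest {w} m with w ∈? X
            ... | yes h = h
            ... | no h = ⊥-elim (proj₂ (∈─⁻ m) (subst (_∈ ⁅ s ⁆) (card-one {A = S ─ X} few s∈ (x∈p∧x∉q⇒x∈p─q (proj₁ (∈─⁻ m)) h)) (x∈⁅x⁆ s)))

          -- The minor supplies connectivity two over `K ∪ U`. Returning to `K` costs nothing: `X`
          -- spans `U`, and adding `U` raises the rank of `Y ∪ K` by at most r(K ∪ U) - r(K).
          both-large : 2 ≤ ∣ S ─ X ∣ → 2 ≤ ∣ S ∩ X ∣ → r E + r K + 2 ≤ r (X ∪ K) + r (Y ∪ K)
          both-large many big = by-rank 7
                (λ e s x y k t u → s ⊑ (x ⊔ y) ⇒ u ⊑ t ⇒ ρ e ≼ ρ (s ⊔ k) ⇒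
                   # 2 ⊞ ρ (s ⊔ (k ⊔ u)) ⊞ ρ (k ⊔ u) ≼ ρ ((s ⊓ x) ⊔ (k ⊔ u)) ⊞ ρ ((s ∖ (s ⊓ x)) ⊔ (k ⊔ u)) ⇒
                   ρ ((x ⊔ k) ⊔ t) ≼ ρ (x ⊔ k) ⇒ sub (y ⊔ k) (k ⊔ u) ⇒
                   ⊢ ρ e ⊞ ρ k ⊞ # 2 ≼ ρ (x ⊔ k) ⊞ ρ (y ⊔ k)) E S X Y K T U S⊆ U⊆T spans
                (split 2 (S ∩ X) (s≤s z≤n) ≤-refl (p∩q⊆p S X) big
                  (≤-trans many (p⊆q⇒∣p∣≤∣q∣ {p = S ─ X} (S.by-rank 2 (λ s x → ⊢ (s ∖ x) ⊑ (s ∖ (s ⊓ x))) S X)))) spans-T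

        bound : ∀ k → k < 3 → k ≤ ∣ Y ∣ → r E + r K + k ≤ r (X ∪ K) + r (Y ∪ K)
        bound k k<3 k≤Y = start (nonempty? (S ─ X)) (2 ≤? ∣ S ─ X ∣) (2 ≤? ∣ S ∩ X ∣) (nonempty? (S ∩ X))
          where
          Goal : Set
          Goal = r E + r K + k ≤ r (X ∪ K) + r (Y ∪ K)
          two-suffices : r E + r K + 2 ≤ r (X ∪ K) + r (Y ∪ K) → Goal
          two-suffices = ≤-trans (+-monoʳ-≤ (r E + r K) (≤-pred k<3))
          start : Dec (Nonempty (S ─ X)) → Dec (2 ≤ ∣ S ─ X ∣) → Dec (2 ≤ ∣ S ∩ X ∣) → Dec (Nonempty (S ∩ X)) → Goal
          start (no empty) _ _ _ = full+ (≤-trans spans (by-rank 3 (λ s x k → (s ∖ x) ⊑ ∅ˢ ⇒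
              ⊢ ρ (s ⊔ k) ≼ ρ (x ⊔ k)) S X K (λ {y} m → ⊥-elim (empty (y , m))))) (small-rank k k<3 Y⊆W k≤Y)
          start (yes (s , s∈)) (no few) _ _ = full+ (full-X (≤-pred (≰⇒> few)) s∈) (small-rank k k<3 Y⊆W k≤Y)
          start _ (yes many) (yes big) _ = two-suffices (both-large many big)
          start _ (yes many) (no few) (no empty) = +full (≤-pred k<3) rank-X (≤-trans spans (by-rank 4 (λ s x y k → s ⊑ (x ⊔ y) ⇒ (s ⊓ x) ⊑ ∅ˢ ⇒
              ⊢ ρ (s ⊔ k) ≼ ρ (y ⊔ k)) S X Y K S⊆ (λ {y} m → ⊥-elim (empty (y , m)))))
          start _ (yes many) (no few) (yes (x , x∈)) = by-cl (x ∈? cl (K ∪ T))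
            where
            open Few {x} (≤-pred (≰⇒> few)) x∈
            by-cl : Dec (x ∈ cl (K ∪ T)) → Goal
            by-cl (yes x∈cl) = +full (≤-pred k<3) rank-X (in-span x∈cl)
            by-cl (no x∉cl) = two-suffices (off-span x∉cl)

    connected : Connected (contracted K) W
    connected k X 1≤k k<3 X⊆W k≤X k≤Y = +-cancelʳ-≤ (r K + r K) _ _ (≤-trans left (≤-trans main (≤-reflexive right)))
      where
      Y : Subset n
      Y = W ─ X
      Y⊆W : Y ⊆ W
      Y⊆W m = proj₁ (∈─⁻ m)
      W⊆ : W ⊆ X ∪ Y
      W⊆ = S.by-rank 2 (λ w x → ⊢ w ⊑ (x ⊔ (w ∖ x))) W X
      W⊆′ : W ⊆ Y ∪ X
      W⊆′ = S.by-rank 2 (λ w x → ⊢ w ⊑ ((w ∖ x) ⊔ x)) W X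
      left : k + contracted K W + (r K + r K) ≤ r E + r K + k
      left = ≤-trans (≤-reflexive (trans (+-assoc k (contracted K W) _) (trans (cong (k +_) (sym (+-assoc (contracted K W) (r K) (r K))))
          (+-comm k _))))
        (+-monoˡ-≤ k (+-monoˡ-≤ (r K) (≤-trans (≤-reflexive (contracted-+ K W)) (top (W ∪ K)))))
      right : r (X ∪ K) + r (Y ∪ K) ≡ contracted K X + contracted K Y + (r K + r K)
      right = trans (sym (cong₂ _+_ (contracted-+ K X) (contracted-+ K Y))) (interchange (contracted K X) (r K) (contracted K Y) (r K))
      Pair : Subset n → Set
      Pair A = ∃[ a ] ∃[ b ] (a ∈ A × b ∈ A × a ≢ b)
      in-X : Pair (T ∩ X) → r E + r K + k ≤ r (X ∪ K) + r (Y ∪ K)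
      in-X (a , b , a∈ , b∈ , a≢b) = Side.bound W⊆ X⊆W Y⊆W (p∩q⊆p T X a∈) (p∩q⊆p T X b∈) (p∩q⊆q T X a∈) (p∩q⊆q T X b∈) a≢b k k<3 k≤Y
      in-Y : Pair (T ─ X) → r E + r K + k ≤ r (X ∪ K) + r (Y ∪ K)
      in-Y (a , b , a∈ , b∈ , a≢b) = ≤-trans
        (Side.bound W⊆′ Y⊆W X⊆W (proj₁ (∈─⁻ a∈)) (proj₁ (∈─⁻ b∈)) (∈Y a∈) (∈Y b∈) a≢b k k<3 k≤X) (≤-reflexive (+-comm (r (Y ∪ K)) (r (X ∪ K))))
        where
        ∈Y : ∀ {a} → a ∈ T ─ X → a ∈ Y
        ∈Y m = x∈p∧x∉q⇒x∈p─q (q⊆p∪q S T (proj₁ (∈─⁻ m))) (proj₂ (∈─⁻ m))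
      choose : Dec (2 ≤ ∣ T ∩ X ∣) → r E + r K + k ≤ r (X ∪ K) + r (Y ∪ K)
      choose (yes h) = in-X (card-two {A = T ∩ X} h)
      choose (no few) = in-Y (card-two {A = T ─ X} (CardSolver.by-rank 2
        (λ t x → # 3 ≼ ρ t ⇒ ρ (t ⊓ x) ≼ # 1 ⇒ sub (t ⊓ x) (t ∖ x) ⇒ ⊢ # 2 ≼ ρ (t ∖ x)) T X (≤-reflexive (sym size-T)) (≤-pred (≰⇒> few))))
      main : r E + r K + k ≤ r (X ∪ K) + r (Y ∪ K)
      main = choose (2 ≤? ∣ T ∩ X ∣)

    avoids-K : ∀ {w} → w ∈ W → w ∉ K
    avoids-K {w} w∈ w∈K = absurd (by-rank 2 (λ k w → w ⊑ k ⇒ ρ k ⊞ # 1 ≼ ρ (k ⊔ w) ⇒ ⊢ # 1 ≼ # 0) K ⁅ w ⁆ (sing⊆ w∈K) (nonloop-W w∈))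

-- Minors as matroids

Conclusion : ∀ {n m} → Matroid n → Matroid m → Subset n → Set
Conclusion {n} M N T =
  Σ (Matroid n) λ M′ → IsMinor M M′ × ThreeConnected M′ × T ⊆ E M′ ×
  Σ (Matroid n) λ N′ → IsMinor M′ N′ × Isomorphic N′ N × (E M′ ─ E N′) ⊆ T

module _ {n} (M : Matroid n) where
  open RankTheory (rank-isRank M)

  minor : Subset n → Subset n → Matroid n
  minor C W = fromRank (contracted-isRank C) W

  minor-rank : ∀ C W X → X ⊆ W → rank (minor C W) X ≡ contracted C X
  minor-rank C W = fromRank-rank (contracted-isRank C) W

  minor-isMinor : ∀ C W → C ⊆ E M → W ⊆ E M → (∀ {w} → w ∈ W → w ∉ C) → IsMinor M (minor C W)
  minor-isMinor C W C⊆E W⊆E avoid = C , (E M ─ C) ─ W , C⊆E , (λ m → proj₁ (∈─⁻ (proj₁ (∈─⁻ m)))) ,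
    (λ { (x , m) → proj₂ (∈─⁻ (proj₁ (∈─⁻ (p∩q⊆q C ((E M ─ C) ─ W) m)))) (p∩q⊆p C ((E M ─ C) ─ W) m) }) ,
    ⊆-antisym (SetSolver.by-rank 3 (λ e c w → w ⊑ e ⇒ (w ⊓ c) ⊑ ∅ˢ ⇒ ⊢ w ⊑ ((e ∖ c) ∖ ((e ∖ c) ∖ w))) (E M) C W W⊆E disjoint)
              (SetSolver.by-rank 3 (λ e c w → ⊢ ((e ∖ c) ∖ ((e ∖ c) ∖ w)) ⊑ w) (E M) C W) ,
    λ I → to I , from I
    where
    disjoint : (W ∩ C) ⊆ ∅
    disjoint {x} m = ⊥-elim (avoid (p∩q⊆p W C m) (p∩q⊆q W C m))
    to : ∀ I → indep (minor C W) I ≡ true → I ⊆ W × rank M (I ∪ C) ≡ ∣ I ∣ + rank M C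
    to I h = let I⊆W , free = fromRank-indep⁻ (contracted-isRank C) W I h in
      (λ {x} → I⊆W {x}) , trans (sym (contracted-+ C I)) (cong (_+ rank M C) free)
    from : ∀ I → I ⊆ W × rank M (I ∪ C) ≡ ∣ I ∣ + rank M C → indep (minor C W) I ≡ true
    from I (I⊆W , eq) = fromRank-indep⁺ (contracted-isRank C) W I I⊆W (+-cancelʳ-≡ (rank M C) _ _ (trans (contracted-+ C I) eq))

  minor-connected : ∀ C W → Connected (contracted C) W → ThreeConnected (minor C W)
  minor-connected C W conn k X 1≤k k<3 (X⊆W , k≤X , k≤Y , lt) = <⇒≱ lt
    (subst₂ _≤_ (cong (k +_) (sym (minor-rank C W W (λ m → m))))
      (cong₂ _+_ (sym (minor-rank C W X X⊆W)) (sym (minor-rank C W (W ─ X) (λ m → proj₁ (∈─⁻ m)))))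
      (conn k X 1≤k k<3 X⊆W k≤X k≤Y))

bool-iff : ∀ {a b : Bool} → (a ≡ true → b ≡ true) → (b ≡ true → a ≡ true) → a ≡ b
bool-iff {true} f g = sym (f refl)
bool-iff {false} {true} f g = g refl
bool-iff {false} {false} f g = refl

connected⇐ : ∀ {m} (N : Matroid m) → ThreeConnected N → Connected (rank N) (E N)
connected⇐ N conn k A 1≤k k<3 A⊆ k≤A k≤ = ≮⇒≥ (λ lt → conn k A 1≤k k<3 ((λ {x} → A⊆ {x}) , k≤A , k≤ , lt))

module _ {n m} (M : Matroid n) (N : Matroid m) (T : Subset n) where
  open RankTheory (rank-isRank M)

  -- The single contraction of `K ∪ U` is carried out in two stages: `K` on the way from `M` to
  -- `M′`, and `U`, which remains in `M′`, on the way to `N′`.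
  package : ∀ {K W U S f} → K ⊆ E M → W ⊆ E M → (∀ {w} → w ∈ W → w ∉ K) → T ⊆ W → U ⊆ W → S ⊆ W →
    (∀ {s} → s ∈ S → s ∉ U) → W ─ S ⊆ T → Connected (contracted K) W → Bijects f S (E N) →
    (∀ I → I ⊆ S → rank M (I ∪ (K ∪ U)) ≡ rank N (image f I) + rank M (K ∪ U)) → Conclusion M N T
  package {K} {W} {U} {S} {f} K⊆E W⊆E avoidK T⊆W U⊆W S⊆W avoidU rest conn b quot =
    M′ , minor-isMinor M K W K⊆E W⊆E avoidK , minor-connected M K W conn , T⊆W ,
    minor M′ U S , minor-isMinor M′ U S U⊆W S⊆W avoidU ,
    (f , (λ _ _ → inj b) , (λ _ → into b) , (λ _ → onto b) , same-indep) , rest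
    where
    M′ : Matroid n
    M′ = minor M K W
    module R′ = RankTheory (rank-isRank M′)
    rank-eq : ∀ X → X ⊆ S → R′.contracted U X ≡ rank N (image f X)
    rank-eq X X⊆S = +-cancelʳ-≡ (rank M′ U + rank M K) _ _ (begin
      R′.contracted U X + (rank M′ U + rank M K)   ≡⟨ sym (+-assoc (R′.contracted U X) (rank M′ U) (rank M K)) ⟩
      R′.contracted U X + rank M′ U + rank M K     ≡⟨ cong (_+ rank M K) (R′.contracted-+ U X) ⟩
      rank M′ (X ∪ U) + rank M K                   ≡⟨ in-M (X ∪ U) (∪-lub (λ h → S⊆W (X⊆S h)) U⊆W) ⟩
      rank M ((X ∪ U) ∪ K)                         ≡⟨ cong (rank M) (trans (∪-assoc X U K) (cong (X ∪_) (∪-comm U K))) ⟩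
      rank M (X ∪ (K ∪ U))                         ≡⟨ quot X X⊆S ⟩
      rank N (image f X) + rank M (K ∪ U)          ≡⟨ cong (λ Z → rank N (image f X) + rank M Z) (∪-comm K U) ⟩
      rank N (image f X) + rank M (U ∪ K)          ≡⟨ cong (rank N (image f X) +_) (sym (in-M U U⊆W)) ⟩
      rank N (image f X) + (rank M′ U + rank M K)  ∎)
      where
      open ≡-Reasoning
      in-M : ∀ A → A ⊆ W → rank M′ A + rank M K ≡ rank M (A ∪ K)
      in-M A A⊆W = trans (cong (_+ rank M K) (minor-rank M K W A A⊆W)) (contracted-+ K A)
    same-indep : ∀ X → X ⊆ S → indep (minor M′ U S) X ≡ indep N (image f X)
    same-indep X X⊆S = bool-iff
      (λ h → rank⇒indep N (trans (sym (rank-eq X X⊆S)) (trans (proj₂ (fromRank-indep⁻ (R′.contracted-isRank U) S X h)) (sym card))))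
      (λ h → fromRank-indep⁺ (R′.contracted-isRank U) S X X⊆S (trans (rank-eq X X⊆S) (trans (indep⇒rank N h) card)))
      where
      card : ∣ image f X ∣ ≡ ∣ X ∣
      card = card-image f X (λ a c → inj b (X⊆S a) (X⊆S c))

  minor⇒quotient : ∀ {N₀} → IsMinor M N₀ → Isomorphic N₀ N →
    ∃[ S ] ∃[ C ] ∃[ f ] (S ⊆ E M × C ⊆ E M × Bijects f S (E N) × (∀ {s} → s ∈ S → s ∉ C) × (∀ I → I ⊆ S → rank M (I ∪ C) ≡ rank N
        (image f I) + rank M C))
  minor⇒quotient {N₀} (C , D , C⊆E , D⊆E , _ , E≡ , ind) (f , inj′ , into′ , onto′ , same) =
    E N₀ , C , f , S⊆E , C⊆E , bijects (inj′ _ _) (into′ _) (onto′ _) , avoid , quot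
    where
    in-minor : ∀ {s} → s ∈ E N₀ → s ∈ E M ─ C
    in-minor m = proj₁ (∈─⁻ (subst (_ ∈_) E≡ m))
    S⊆E : E N₀ ⊆ E M
    S⊆E m = proj₁ (∈─⁻ (in-minor m))
    avoid : ∀ {s} → s ∈ E N₀ → s ∉ C
    avoid m = proj₂ (∈─⁻ (in-minor m))
    rank₀ : ∀ X → X ⊆ E N₀ → rank N₀ X ≡ contracted C X
    rank₀ = rank-determined N₀ (contracted-isRank C)
      (λ X h → +-cancelʳ-≡ (rank M C) _ _ (trans (contracted-+ C X) (proj₂ (proj₁ (ind X) h))))
      (λ X X⊆ e → proj₂ (ind X) ((λ {x} → X⊆ {x}) , trans (sym (contracted-+ C X)) (cong (_+ rank M C) e)))
    card : ∀ X → X ⊆ E N₀ → ∣ image f X ∣ ≡ ∣ X ∣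
    card X X⊆ = card-image f X (λ a c → inj′ _ _ (X⊆ a) (X⊆ c))
    rankN : ∀ X → X ⊆ E N₀ → rank N (image f X) ≡ rank N₀ X
    rankN X X⊆ = ≤-antisym upper lower
      where
      lower : rank N₀ X ≤ rank N (image f X)
      lower with rank-basis N₀ X
      ... | B , B⊆X , iJ , eJ = ≤-trans (≤-reflexive (trans (sym eJ) (sym (card B B⊆))))
            (rank-≥ N (image-mono {f = f} B (λ _ → refl) B⊆X) (trans (sym (same B B⊆)) iJ))
        where
        B⊆ : B ⊆ E N₀
        B⊆ m = X⊆ (B⊆X m)
      upper : rank N (image f X) ≤ rank N₀ X
      upper with rank-basis N (image f X)
      ... | Z , Z⊆ , iZ , eZ = ≤-trans (≤-reflexive (trans (sym eZ) (trans (cong ∣_∣ (sym eq)) (card B B⊆))))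
            (rank-≥ N₀ (p∩q⊆p X (preimage f Z)) (trans (same B B⊆) (trans (cong (indep N) eq) iZ)))
        where
        B : Subset n
        B = X ∩ preimage f Z
        B⊆ : B ⊆ E N₀
        B⊆ m = X⊆ (p∩q⊆p X (preimage f Z) m)
        eq : image f B ≡ Z
        eq = image-preimage f {X} Z⊆
    quot : ∀ I → I ⊆ E N₀ → rank M (I ∪ C) ≡ rank N (image f I) + rank M C
    quot I I⊆ = trans (sym (contracted-+ C I)) (cong (_+ rank M C) (sym (trans (rankN I I⊆) (rank₀ I I⊆))))

-- Binary matroids

infixl 6 _⊕ᵛ_

_⊕ᵛ_ : ∀ {k} → Vec Bool k → Vec Bool k → Vec Bool k
_⊕ᵛ_ = zipWith _xor_

⊕ᵛ-self : ∀ {k} (a : Vec Bool k) → a ⊕ᵛ a ≡ zeroV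
⊕ᵛ-self [] = refl
⊕ᵛ-self (x ∷ a) = cong₂ _∷_ (xor-same x) (⊕ᵛ-self a)

⊕ᵛ-zero : ∀ {k} (a : Vec Bool k) → zeroV ⊕ᵛ a ≡ a
⊕ᵛ-zero = zipWith-identityˡ xor-identityˡ

⊕ᵛ-interchange : ∀ {k} (a b c d : Vec Bool k) → (a ⊕ᵛ b) ⊕ᵛ (c ⊕ᵛ d) ≡ (a ⊕ᵛ c) ⊕ᵛ (b ⊕ᵛ d)
⊕ᵛ-interchange a b c d = begin
  (a ⊕ᵛ b) ⊕ᵛ (c ⊕ᵛ d)  ≡⟨ zipWith-assoc xor-assoc a b (c ⊕ᵛ d) ⟩
  a ⊕ᵛ (b ⊕ᵛ (c ⊕ᵛ d))  ≡⟨ cong (a ⊕ᵛ_) (sym (zipWith-assoc xor-assoc b c d)) ⟩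
  a ⊕ᵛ ((b ⊕ᵛ c) ⊕ᵛ d)  ≡⟨ cong (λ z → a ⊕ᵛ (z ⊕ᵛ d)) (zipWith-comm xor-comm b c) ⟩
  a ⊕ᵛ ((c ⊕ᵛ b) ⊕ᵛ d)  ≡⟨ cong (a ⊕ᵛ_) (zipWith-assoc xor-assoc c b d) ⟩
  a ⊕ᵛ (c ⊕ᵛ (b ⊕ᵛ d))  ≡⟨ sym (zipWith-assoc xor-assoc a c (b ⊕ᵛ d)) ⟩
  (a ⊕ᵛ c) ⊕ᵛ (b ⊕ᵛ d)  ∎
  where open ≡-Reasoning

_△_ : ∀ {n} → Subset n → Subset n → Subset n
_△_ = zipWith _xor_

sumOver-△ : ∀ {n k} (Y Z : Subset n) (v : Fin n → Vec Bool k) → sumOver (Y △ Z) v ≡ sumOver Y v ⊕ᵛ sumOver Z v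
sumOver-△ [] [] v = sym (⊕ᵛ-zero zeroV)
sumOver-△ {k = k} (a ∷ Y) (b ∷ Z) v = trans
  (cong₂ _⊕ᵛ_ (head a b) (sumOver-△ Y Z (λ i → v (suc i))))
  (⊕ᵛ-interchange (scale a) (scale b) (sumOver Y _) (sumOver Z _))
  where
  scale : Bool → Vec Bool k
  scale c = if c then v zero else zeroV
  head : ∀ a b → scale (a xor b) ≡ scale a ⊕ᵛ scale b
  head false b = sym (⊕ᵛ-zero (scale b))
  head true false = trans (sym (⊕ᵛ-zero (v zero))) (zipWith-comm xor-comm zeroV (v zero))
  head true true = sym (⊕ᵛ-self (v zero))

module _ {n} (M : Matroid n) (binary : IsBinary M) (T : Subset n) (triangle : IsTriangle M T) where
  open RankTheory (rank-isRank M)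

  private
    v = proj₁ (proj₂ binary)
    T⊆E : T ⊆ E M
    T⊆E = proj₁ (proj₁ triangle)
    size : ∣ T ∣ ≡ 3
    size = proj₂ triangle

    Relation : Subset n → Subset n → Set
    Relation X Y = Y ⊆ X × Nonempty Y × sumOver Y v ≡ zeroV

    independent : ∀ {X Y} → indep M X ≡ true → ¬ Relation X Y
    independent {X} {Y} i (Y⊆X , ne , s) = proj₁ (proj₂ (proj₂ binary) X (indep⊆E M X i)) i Y Y⊆X ne s

    dependent : ∀ {X} → X ⊆ E M → indep M X ≢ true → ∃[ Y ] Relation X Y
    dependent {X} X⊆E d with anySubset? (λ Y → (Y ⊆? X) ×-dec (nonempty? Y ×-dec (≡-dec Bool._≟_ (sumOver Y v) zeroV)))
    ... | yes (Y , a , b , c) = Y , a , b , c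
    ... | no none = ⊥-elim (d (proj₂ (proj₂ (proj₂ binary) X X⊆E) (λ Y Y⊆X ne s → none (Y , (λ {x} → Y⊆X {x}) , ne , s))))

  proper-rank : ∀ {Y} → Y ⊆ T → ∣ Y ∣ ≤ 2 → rank M Y ≡ ∣ Y ∣
  proper-rank {Y} Y⊆T small = indep⇒rank M (proj₂ (proj₂ (proj₁ triangle)) Y (proper (nonempty? (T ─ Y))))
    where
    proper : Dec (Nonempty (T ─ Y)) → Y ⊂ T
    proper (yes (x , x∈)) = Y⊆T , x , proj₁ (∈─⁻ x∈) , proj₂ (∈─⁻ x∈)
    proper (no empty) = absurd (CardSolver.by-rank 2 (λ t y → (t ∖ y) ⊑ ∅ˢ ⇒ # 3 ≼ ρ t ⇒ ρ y ≼ # 2 ⇒ ⊢ # 1 ≼ # 0) T Y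
      (λ {x} m → ⊥-elim (empty (x , m))) (≤-reflexive (sym size)) small)

  private
    -- A relation within `T` has to involve all of `T`, since its proper subsets are independent.
    sum-T : sumOver T v ≡ zeroV
    sum-T with dependent T⊆E (λ i → case-bool (trans (sym i) (proj₁ (proj₂ (proj₁ triangle)))))
      where
      case-bool : true ≢ false
      case-bool ()
    ... | Y , Y⊆T , ne , s = subst (λ Z → sumOver Z v ≡ zeroV) (⊆-antisym Y⊆T T⊆Y) s
      where
      T⊆Y : T ⊆ Y
      T⊆Y {x} x∈T with x ∈? Y
      ... | yes h = h
      ... | no h = ⊥-elim (independent (proj₂ (proj₂ (proj₁ triangle)) Y (Y⊆T , x , x∈T , h)) ((λ m → m) , ne , s))

    rank-T≤2 : rank M T ≤ 2
    rank-T≤2 with rank M T ≤? 2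
    ... | yes h = h
    ... | no h = ⊥-elim (not-true (trans (sym (rank⇒indep M (≤-antisym (r≤card T) (≤-trans (≤-reflexive size) (≰⇒> h))))) (proj₁ (proj₂ (proj₁ triangle)))))
      where
      not-true : true ≢ false
      not-true ()

    pair-rank : ∀ {s t} → s ∈ T → t ∈ T → s ≢ t → 2 ≤ rank M (⁅ s ⁆ ∪ ⁅ t ⁆)
    pair-rank {s} {t} s∈ t∈ s≢t = ≤-reflexive (sym (trans (proper-rank (∪-lub (sing⊆ s∈) (sing⊆ t∈)) (≤-reflexive two)) two))
      where
      two : ∣ ⁅ s ⁆ ∪ ⁅ t ⁆ ∣ ≡ 2
      two = trans (card-insert ⁅ s ⁆ t (λ h → s≢t (sym (x∈⁅y⁆⇒x≡y s h)))) (cong suc (∣⁅x⁆∣≡1 s))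

    third : ∃[ a ] ∃[ b ] ∃[ c ] (a ∈ T × b ∈ T × c ∈ T × a ≢ b × a ≢ c × b ≢ c × T ⊆ (⁅ a ⁆ ∪ ⁅ b ⁆) ∪ ⁅ c ⁆)
    third with card-two {A = T} (≤-trans (s≤s (s≤s z≤n)) (≤-reflexive (sym size)))
    ... | a , b , a∈ , b∈ , a≢b with card-pos {A = T ─ (⁅ a ⁆ ∪ ⁅ b ⁆)} (CardSolver.by-rank 3
          (λ t a b → # 3 ≼ ρ t ⇒ ρ a ≼ # 1 ⇒ ρ b ≼ # 1 ⇒ sub a b ⇒ sub (t ∖ (a ⊔ b)) (a ⊔ b) ⇒ ⊢ # 1 ≼ ρ (t ∖ (a ⊔ b))) T ⁅ a ⁆ ⁅ b ⁆
          (≤-reflexive (sym size)) (≤-reflexive (∣⁅x⁆∣≡1 a)) (≤-reflexive (∣⁅x⁆∣≡1 b)))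
    ...   | c , c∈ = a , b , c , a∈ , b∈ , proj₁ (∈─⁻ c∈) , a≢b , a≢c , b≢c ,
              card-≥⇒⊇ {A = (⁅ a ⁆ ∪ ⁅ b ⁆) ∪ ⁅ c ⁆} {T} (∪-lub (∪-lub (sing⊆ a∈) (sing⊆ b∈)) (sing⊆ (proj₁ (∈─⁻ c∈)))) (≤-reflexive (trans size (sym
                (trans (card-insert (⁅ a ⁆ ∪ ⁅ b ⁆) c (proj₂ (∈─⁻ c∈))) (cong suc (trans (card-insert ⁅ a ⁆ b (λ h → a≢b (sym (x∈⁅y⁆⇒x≡y a h))))
                    (cong suc (∣⁅x⁆∣≡1 a))))))))
      where
      a≢c : a ≢ c
      a≢c refl = proj₂ (∈─⁻ c∈) (p⊆p∪q ⁅ b ⁆ (x∈⁅x⁆ a))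
      b≢c : b ≢ c
      b≢c refl = proj₂ (∈─⁻ c∈) (q⊆p∪q ⁅ a ⁆ ⁅ b ⁆ (x∈⁅x⁆ b))

    -- A parity count over `T`, `Y₁` and `Y₂`: `b` and `c` each occur twice and cancel, whereas `a`
    -- occurs three times and survives, so the sum is nonempty and inside `B ∪ ⁅ a ⁆`.
    combine : ∀ {a b c B Y₁ Y₂} → a ∈ T → b ∈ T → c ∈ T → a ≢ b → a ≢ c → b ≢ c → T ⊆ (⁅ a ⁆ ∪ ⁅ b ⁆) ∪ ⁅ c ⁆ → b ∉ B → c ∉ B →
      Y₁ ⊆ (B ∪ ⁅ a ⁆) ∪ ⁅ b ⁆ → Y₂ ⊆ (B ∪ ⁅ a ⁆) ∪ ⁅ c ⁆ → a ∈ Y₁ → b ∈ Y₁ → sumOver Y₁ v ≡ zeroV → a ∈ Y₂ → c ∈ Y₂ → sumOver Y₂ v ≡ zeroV →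
      Relation (B ∪ ⁅ a ⁆) (T △ (Y₁ △ Y₂))
    combine {a} {b} {c} {B} {Y₁} {Y₂} a∈ b∈ c∈ a≢b a≢c b≢c T⊆abc b∉B c∉B Y₁⊆ Y₂⊆ a∈₁ b∈₁ s₁ a∈₂ c∈₂ s₂ = Z⊆ , (a , a∈Z) , sum-Z
      where
      Z : Subset n
      Z = T △ (Y₁ △ Y₂)
      sum-Z : sumOver Z v ≡ zeroV
      sum-Z = trans (sumOver-△ T (Y₁ △ Y₂) v) (trans (cong₂ _⊕ᵛ_ sum-T (trans (sumOver-△ Y₁ Y₂ v)
        (trans (cong₂ _⊕ᵛ_ s₁ s₂) (⊕ᵛ-zero zeroV)))) (⊕ᵛ-zero zeroV))
      lookup-Z : ∀ x → lookup Z x ≡ lookup T x xor (lookup Y₁ x xor lookup Y₂ x)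
      lookup-Z x = trans (lookup-zipWith _xor_ x T (Y₁ △ Y₂)) (cong (lookup T x xor_) (lookup-zipWith _xor_ x Y₁ Y₂))
      out : ∀ {x A} → x ∉ A → lookup A x ≡ false
      out {x} {A} h = ¬-not (λ e → h (lookup⇒[]= x A e))
      a∈Z : a ∈ Z
      a∈Z = lookup⇒[]= a Z (trans (lookup-Z a) (cong₂ _xor_ ([]=⇒lookup a∈)
        (cong₂ _xor_ ([]=⇒lookup a∈₁) ([]=⇒lookup a∈₂))))
      b∉Y₂ : b ∉ Y₂
      b∉Y₂ h = [ (λ m → [ b∉B , (λ m → a≢b (sym (x∈⁅y⁆⇒x≡y a m))) ]′ (x∈p∪q⁻ B ⁅ a ⁆ m)) , (λ m → b≢c (x∈⁅y⁆⇒x≡y c m)) ]′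
        (x∈p∪q⁻ (B ∪ ⁅ a ⁆) ⁅ c ⁆ (Y₂⊆ h))
      c∉Y₁ : c ∉ Y₁
      c∉Y₁ h = [ (λ m → [ c∉B , (λ m → a≢c (sym (x∈⁅y⁆⇒x≡y a m))) ]′ (x∈p∪q⁻ B ⁅ a ⁆ m)) , (λ m → b≢c (sym (x∈⁅y⁆⇒x≡y b m))) ]′
        (x∈p∪q⁻ (B ∪ ⁅ a ⁆) ⁅ b ⁆ (Y₁⊆ h))
      false∉ : ∀ {x} → lookup Z x ≡ false → x ∉ Z
      false∉ {x} e h with trans (sym e) ([]=⇒lookup h)
      ... | ()
      b∉Z : b ∉ Z
      b∉Z = false∉ (trans (lookup-Z b) (cong₂ _xor_ ([]=⇒lookup b∈) (cong₂ _xor_ ([]=⇒lookup b∈₁) (out b∉Y₂))))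
      c∉Z : c ∉ Z
      c∉Z = false∉ (trans (lookup-Z c) (cong₂ _xor_ ([]=⇒lookup c∈) (cong₂ _xor_ (out c∉Y₁) ([]=⇒lookup c∈₂))))
      Z⊆ : Z ⊆ B ∪ ⁅ a ⁆
      Z⊆ {x} x∈Z with x ∈? B ∪ ⁅ a ⁆
      ... | yes h = h
      ... | no h = ⊥-elim (false∉ (trans (lookup-Z x) (cong₂ _xor_ (out x∉T) (cong₂ _xor_ (out x∉Y₁) (out x∉Y₂)))) x∈Z)
        where
        x∉a : x ∉ ⁅ a ⁆
        x∉a m = h (q⊆p∪q B ⁅ a ⁆ m)
        x∉b : x ∉ ⁅ b ⁆
        x∉b m = b∉Z (subst (_∈ Z) (x∈⁅y⁆⇒x≡y b m) x∈Z)
        x∉c : x ∉ ⁅ c ⁆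
        x∉c m = c∉Z (subst (_∈ Z) (x∈⁅y⁆⇒x≡y c m) x∈Z)
        x∉T : x ∉ T
        x∉T m = [ (λ m → [ x∉a , x∉b ]′ (x∈p∪q⁻ ⁅ a ⁆ ⁅ b ⁆ m)) , x∉c ]′ (x∈p∪q⁻ (⁅ a ⁆ ∪ ⁅ b ⁆) ⁅ c ⁆ (T⊆abc m))
        x∉Y₁ : x ∉ Y₁
        x∉Y₁ m = [ h , x∉b ]′ (x∈p∪q⁻ (B ∪ ⁅ a ⁆) ⁅ b ⁆ (Y₁⊆ m))
        x∉Y₂ : x ∉ Y₂
        x∉Y₂ m = [ h , x∉c ]′ (x∈p∪q⁻ (B ∪ ⁅ a ⁆) ⁅ c ⁆ (Y₂⊆ m))

    module Avoiding {Q B} (B⊆Q : B ⊆ Q) (iB : indep M B ≡ true) (eB : ∣ B ∣ ≡ rank M Q) (e : rank M (Q ∪ T) ≡ rank M Q + 1)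
      (above : ∀ {t} → t ∈ T → rank M Q + 1 ≤ rank M (Q ∪ ⁅ t ⁆)) where

      rank-B : rank M Q ≤ rank M B
      rank-B = ≤-reflexive (sym (trans (indep⇒rank M iB) eB))

      spanning : ∀ A → rank M (Q ∪ A) ≤ rank M (B ∪ A)
      spanning A = by-rank 3 (λ q b a → b ⊑ q ⇒ ρ q ≼ ρ b ⇒ sub q (b ⊔ a) ⇒ ⊢ ρ (q ⊔ a) ≼ ρ (b ⊔ a)) Q B A B⊆Q rank-B

      ∉B : ∀ {t} → t ∈ T → t ∉ B
      ∉B {t} t∈ m = absurd (by-rank 2 (λ q t → t ⊑ q ⇒ ρ q ⊞ # 1 ≼ ρ (q ⊔ t) ⇒ ⊢ # 1 ≼ # 0) Q ⁅ t ⁆ (sing⊆ (B⊆Q m)) (above t∈))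

      card-with : ∀ {t} → t ∈ T → ∣ B ∪ ⁅ t ⁆ ∣ ≡ rank M Q + 1
      card-with {t} t∈ = trans (card-insert B t (∉B t∈)) (trans (cong suc eB) (+-comm 1 (rank M Q)))

      basis-with : ∀ {t} → t ∈ T → indep M (B ∪ ⁅ t ⁆) ≡ true
      basis-with {t} t∈ = rank⇒indep M (≤-antisym (r≤card (B ∪ ⁅ t ⁆))
        (≤-trans (≤-reflexive (card-with t∈)) (≤-trans (above t∈) (spanning ⁅ t ⁆))))

      -- Otherwise `Q ∪ T` would exceed the rank of `Q` by two.
      two-dependent : ∀ {s t} → s ∈ T → t ∈ T → s ≢ t → indep M ((B ∪ ⁅ s ⁆) ∪ ⁅ t ⁆) ≢ true
      two-dependent {s} {t} s∈ t∈ s≢t i = <-irrefl refl (≤-trans (≤-reflexive big) (≤-trans small (≤-reflexive e)))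
        where
        t∉ : t ∉ B ∪ ⁅ s ⁆
        t∉ h = [ ∉B t∈ , (λ m → s≢t (sym (x∈⁅y⁆⇒x≡y s m))) ]′ (x∈p∪q⁻ B ⁅ s ⁆ h)
        big : suc (rank M Q + 1) ≡ rank M ((B ∪ ⁅ s ⁆) ∪ ⁅ t ⁆)
        big = trans (cong suc (sym (card-with s∈))) (trans (sym (card-insert (B ∪ ⁅ s ⁆) t t∉)) (sym (indep⇒rank M i)))
        small : rank M ((B ∪ ⁅ s ⁆) ∪ ⁅ t ⁆) ≤ rank M (Q ∪ T)
        small = by-rank 5 (λ q b s t u → b ⊑ q ⇒ s ⊑ u ⇒ t ⊑ u ⇒ ⊢ ρ ((b ⊔ s) ⊔ t) ≼ ρ (q ⊔ u)) Q B ⁅ s ⁆ ⁅ t ⁆ T B⊆Q (sing⊆ s∈) (sing⊆ t∈)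

      Through : Fin n → Fin n → Set
      Through s t = ∃[ Y ] (Y ⊆ (B ∪ ⁅ s ⁆) ∪ ⁅ t ⁆ × s ∈ Y × t ∈ Y × sumOver Y v ≡ zeroV)

      -- A relation that missed `s` or `t` would lie within the independent set `B ∪ ⁅ t ⁆` or
      -- `B ∪ ⁅ s ⁆`.
      through : ∀ {s t} → s ∈ T → t ∈ T → s ≢ t → Through s t
      through {s} {t} s∈ t∈ s≢t = use (dependent (∪-lub (indep⊆E M (B ∪ ⁅ s ⁆) (basis-with s∈)) (λ m → T⊆E (sing⊆ t∈ m))) (two-dependent s∈ t∈ s≢t))
        where
        without : ∀ {Y w C} → w ∉ Y → Y ⊆ C ∪ ⁅ w ⁆ → Y ⊆ C
        without {Y} {w} {C} w∉ h {x} m = [ (λ c → c) , (λ c → ⊥-elim (w∉ (subst (_∈ Y) (x∈⁅y⁆⇒x≡y w c) m))) ]′ (x∈p∪q⁻ C ⁅ w ⁆ (h m))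
        use : ∃[ Y ] Relation ((B ∪ ⁅ s ⁆) ∪ ⁅ t ⁆) Y → Through s t
        use (Y , Y⊆ , ne , zero-sum) = Y , Y⊆ , s∈Y (s ∈? Y) , t∈Y (t ∈? Y) , zero-sum
          where
          t∈Y : Dec (t ∈ Y) → t ∈ Y
          t∈Y (yes h) = h
          t∈Y (no h) = ⊥-elim (independent (basis-with s∈) (without {Y} {t} {B ∪ ⁅ s ⁆} h Y⊆ , ne , zero-sum))
          s∈Y : Dec (s ∈ Y) → s ∈ Y
          s∈Y (yes h) = h
          s∈Y (no h) = ⊥-elim (independent (basis-with t∈) (without {Y} {s} {B ∪ ⁅ t ⁆} h
            (SetSolver.by-rank 4 (λ b s t y → y ⊑ ((b ⊔ s) ⊔ t) ⇒ ⊢ y ⊑ ((b ⊔ t) ⊔ s)) B ⁅ s ⁆ ⁅ t ⁆ Y Y⊆) , ne , zero-sum))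

      impossible : ∀ {a b c} → a ∈ T → b ∈ T → c ∈ T → a ≢ b → a ≢ c → b ≢ c → T ⊆ (⁅ a ⁆ ∪ ⁅ b ⁆) ∪ ⁅ c ⁆ → ⊥
      impossible {a} {b} {c} a∈ b∈ c∈ a≢b a≢c b≢c T⊆abc = finish (through a∈ b∈ a≢b) (through a∈ c∈ a≢c)
        where
        finish : Through a b → Through a c → ⊥
        finish (Y₁ , Y₁⊆ , a∈₁ , b∈₁ , s₁) (Y₂ , Y₂⊆ , a∈₂ , c∈₂ , s₂) =
          independent {B ∪ ⁅ a ⁆} {T △ (Y₁ △ Y₂)} (basis-with a∈) (combine a∈ b∈ c∈ a≢b a≢c b≢c T⊆abc (∉B b∈) (∉B c∈) Y₁⊆ Y₂⊆ a∈₁ b∈₁ s₁ a∈₂ c∈₂ s₂)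

  -- If T avoided the closure of Q, there would be relations through a, b and through a, c over a basis B of Q,
  -- whose sum with the triangle is a relation of a over B.
  triangle-meets : ∀ Q → rank M (Q ∪ T) ≡ rank M Q + 1 → ∃[ t ] (t ∈ T × rank M (Q ∪ ⁅ t ⁆) ≤ rank M Q)
  triangle-meets Q e = search (any? (λ t → (t ∈? T) ×-dec (rank M (Q ∪ ⁅ t ⁆) ≤? rank M Q)))
    where
    Found : Set
    Found = ∃[ t ] (t ∈ T × rank M (Q ∪ ⁅ t ⁆) ≤ rank M Q)
    contradiction′ : ¬ Found → (∃[ B ] (B ⊆ Q × indep M B ≡ true × ∣ B ∣ ≡ rank M Q)) → ⊥
    contradiction′ none (B , B⊆Q , iB , eB) =
      let a , b , c , a∈ , b∈ , c∈ , a≢b , a≢c , b≢c , T⊆ = third in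
      Avoiding.impossible B⊆Q iB eB e
        (λ {t} t∈ → ≤-trans (≤-reflexive (+-comm (rank M Q) 1)) (≰⇒> (λ h → none (t , t∈ , h)))) a∈ b∈ c∈ a≢b a≢c b≢c (λ {x} → T⊆ {x})
    search : Dec Found → Found
    search (yes found) = found
    search (no none) = ⊥-elim (contradiction′ none (rank-basis M Q))

  binary-triangular : Triangular (rank M) (E M) T
  binary-triangular = record
    { isRank = rank-isRank M ; top = rank-⊆E M ; T⊆E = T⊆E ; rank-T = rank-T≤2
    ; pair = pair-rank ; size-T = size ; meets = triangle-meets }

-- Consequences of the 3-connectedness of M

module Ambient {n} (M : Matroid n) {T : Subset n} (tri : Triangular (rank M) (E M) T) (connM : Connected (rank M) (E M)) where
  open Separations tri public

  rank-T≥2 : 2 ≤ rank M T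
  rank-T≥2 = use (card-two {A = T} (≤-trans (s≤s (s≤s z≤n)) (≤-reflexive (sym size-T))))
    where
    use : ∃[ a ] ∃[ b ] (a ∈ T × b ∈ T × a ≢ b) → 2 ≤ rank M T
    use (a , b , a∈ , b∈ , a≢b) = ≤-trans (pair a∈ b∈ a≢b) (r-mono (∪-lub (sing⊆ a∈) (sing⊆ b∈)))

  -- If two elements of `E M` are outside `X`, 3-connectedness applies directly. Otherwise `X`
  -- spans, as `M` has no coloop, and `T` gives `Y` rank two.
  initially-linked : ∀ {P} → (∀ {X} → P X → 2 ≤ ∣ X ∩ E M ∣) → Linked ∅ P
  initially-linked {P} big {X} {Y} cov p = use (2 ≤? ∣ E M ─ (X ∩ E M) ∣)
    where
    Goal : Set
    Goal = rank M (E M) + rank M ∅ + 2 ≤ rank M X + rank M Y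
    one-side : ∣ E M ─ (X ∩ E M) ∣ ≤ 1 → Dec (1 ≤ ∣ E M ─ (X ∩ E M) ∣) → rank M (E M) ≤ rank M X
    one-side few (yes h) = by-rank 2 (λ e x → # 1 ⊞ ρ e ≼ ρ (x ⊓ e) ⊞ ρ (e ∖ (x ⊓ e)) ⇒ ρ (e ∖ (x ⊓ e)) ≼ # 1 ⇒ ⊢ ρ e ≼ ρ x) (E M) X
      (connM 1 (X ∩ E M) ≤-refl (s≤s (s≤s z≤n)) (p∩q⊆q X (E M)) (≤-trans (s≤s z≤n) (big p)) h) (≤-trans (r≤card _) few)
    one-side few (no h) = r-mono inside
      where
      inside : E M ⊆ X
      inside {x} m with x ∈? X
      ... | yes y = y
      ... | no ¬y = ⊥-elim (h (≤-trans (≤-reflexive (sym (∣⁅x⁆∣≡1 x))) (p⊆q⇒∣p∣≤∣q∣ {p = ⁅ x ⁆} (sing⊆ (x∈p∧x∉q⇒x∈p─q m (λ z → ¬y (p∩q⊆p X (E M) z)))))))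
    use : Dec (2 ≤ ∣ E M ─ (X ∩ E M) ∣) → Goal
    use (yes h) = by-rank 3 (λ e x y → e ⊑ (x ⊔ y) ⇒ # 2 ⊞ ρ e ≼ ρ (x ⊓ e) ⊞ ρ (e ∖ (x ⊓ e)) ⇒ ρ ∅ˢ ≼ # 0 ⇒
        ⊢ ρ e ⊞ ρ ∅ˢ ⊞ # 2 ≼ ρ x ⊞ ρ y) (E M) X Y (cover cov)
      (connM 2 (X ∩ E M) (s≤s z≤n) ≤-refl (p∩q⊆q X (E M)) (big p) h) (≤-reflexive r-∅)
    use (no h) = by-rank 4 (λ e x y t → t ⊑ y ⇒ ρ e ≼ ρ x ⇒ # 2 ≼ ρ t ⇒ ρ ∅ˢ ≼ # 0 ⇒ ⊢ ρ e ⊞ ρ ∅ˢ ⊞ # 2 ≼ ρ x ⊞ ρ y) (E M) X Y T (T⊆Y cov)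
      (one-side (≤-pred (≰⇒> h)) (1 ≤? _)) rank-T≥2 (≤-reflexive r-∅)

  nonloop-M : 2 ≤ ∣ E M ∣ → ∀ {e} → e ∈ E M → 1 ≤ rank M ⁅ e ⁆
  nonloop-M h {e} e∈ = by-rank 2 (λ e s → # 1 ⊞ ρ e ≼ ρ s ⊞ ρ (e ∖ s) ⇒ ⊢ # 1 ≼ ρ s) (E M) ⁅ e ⁆
    (connM 1 ⁅ e ⁆ ≤-refl (s≤s (s≤s z≤n)) (sing⊆ e∈) (≤-reflexive (sym (∣⁅x⁆∣≡1 e)))
      (CardSolver.by-rank 2 (λ e s → # 2 ≼ ρ e ⇒ ρ s ≼ # 1 ⇒ sub (e ∖ s) s ⇒ ⊢ # 1 ≼ ρ (e ∖ s)) (E M) ⁅ e ⁆ h (≤-reflexive (∣⁅x⁆∣≡1 e))))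

  -- A binary matroid of rank two has at most three points up to parallel elements.
  rank≥3 : 4 ≤ ∣ E M ∣ → 3 ≤ rank M (E M)
  rank≥3 four with 3 ≤? rank M (E M)
  ... | yes h = h
  ... | no small = ⊥-elim (use (card-pos {A = E M ─ T} (CardSolver.by-rank 2 (λ e t → # 4 ≼ ρ e ⇒ ρ t ≼ # 3 ⇒ sub (e ∖ t) t ⇒ ⊢ # 1 ≼ ρ (e ∖ t)) (E M) T four (≤-reflexive size-T))))
    where
    use : Nonempty (E M ─ T) → ⊥
    use (e , e∈) = parallel (meets ⁅ e ⁆ (≤-antisym
        (≤-trans (top _) (≤-trans (≤-pred (≰⇒> small)) (+-monoˡ-≤ 1 nonloop)))
        (≤-trans (+-monoˡ-≤ 1 (r-sing e)) (≤-trans rank-T≥2 (r-mono (q⊆p∪q ⁅ e ⁆ T))))))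
      where
      e∈E : e ∈ E M
      e∈E = proj₁ (∈─⁻ e∈)
      nonloop : 1 ≤ rank M ⁅ e ⁆
      nonloop = nonloop-M (≤-trans (s≤s (s≤s z≤n)) four) e∈E
      parallel : ¬ (∃[ t ] (t ∈ T × rank M (⁅ e ⁆ ∪ ⁅ t ⁆) ≤ rank M ⁅ e ⁆))
      parallel (t , t∈ , le) = absurd (by-rank 3 (λ e a b → # 2 ⊞ ρ e ≼ ρ (a ⊔ b) ⊞ ρ (e ∖ (a ⊔ b)) ⇒ ρ (a ⊔ b) ≼ ρ a ⇒ ρ a ≼ # 1 ⇒
          ⊢ # 1 ≼ # 0) (E M) ⁅ e ⁆ ⁅ t ⁆
        (connM 2 (⁅ e ⁆ ∪ ⁅ t ⁆) (s≤s z≤n) ≤-refl (∪-lub (sing⊆ e∈E) (sing⊆ (T⊆E t∈)))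
          (two-card {A = ⁅ e ⁆ ∪ ⁅ t ⁆} (p⊆p∪q ⁅ t ⁆ (x∈⁅x⁆ e)) (q⊆p∪q ⁅ e ⁆ ⁅ t ⁆ (x∈⁅x⁆ t)) (λ { refl → proj₂ (∈─⁻ e∈) t∈ }))
          (CardSolver.by-rank 3 (λ e a b → # 4 ≼ ρ e ⇒ ρ a ≼ # 1 ⇒ ρ b ≼ # 1 ⇒ sub (e ∖ (a ⊔ b)) (a ⊔ b) ⇒ sub a b ⇒ ⊢ # 2 ≼ ρ (e ∖ (a ⊔ b)))
            (E M) ⁅ e ⁆ ⁅ t ⁆ four (≤-reflexive (∣⁅x⁆∣≡1 e)) (≤-reflexive (∣⁅x⁆∣≡1 t)))) le (r-sing e))

-- From a final contraction to the required minor

module Assembly {n m} (M : Matroid n) (N : Matroid m) {T : Subset n} (tri : Triangular (rank M) (E M) T)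
  (connM : Connected (rank M) (E M)) (connN : Connected (rank N) (E N)) where

  open Finals tri (E N) (rank N) using (Final; final)
  open Labels tri (E N) (rank N)
  private module A = Ambient M tri connM

  from-final : ∀ {K U S f} (two : 2 ≤ ∣ E N ∣) → Final K U S f → Reduction.Simple tri (E N) (rank N) connN two K S → Conclusion M N T
  from-final {K} {U} {S} two fin simp = use (R.reduce ∣ S ─ T ∣ ≤-refl fin simp)
    where
    module R = Reduction tri (E N) (rank N) connN two
    use : ∃[ S′ ] ∃[ f′ ] (Final K U S′ f′ × R.Simple K S′ × R.Reduced K S′) → Conclusion M N T
    use (S′ , f′ , fin′ , simp′ , red) = package M N T (Final.K⊆E fin′) (∪-lub (S⊆E (Final.lab fin′)) T⊆E) (R.avoids-K fin′ simp′ red)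
      (q⊆p∪q S′ T) (λ m → q⊆p∪q S′ T (Final.U⊆T fin′ m)) (p⊆p∪q T) (R.avoids-U fin′)
      (S.by-rank 2 (λ s t → ⊢ ((s ⊔ t) ∖ s) ⊑ t) S′ T) (R.connected fin′ simp′ red) (bij (Final.lab fin′)) (quot (Final.lab fin′))

  large-case : ∀ {S f C} → 4 ≤ ∣ E N ∣ → Label S f C → C ⊆ E M → Conclusion M N T
  large-case {S} {f} {C} large L C⊆E = use (D.descend (suc (rank M (E M))) (m≤m+n _ _) (D.state L (λ m → ⊥-elim (∉⊥ m)) C⊆E
      (A.initially-linked λ {X} b → ≤-trans b (p⊆q⇒∣p∣≤∣q∣ {p = S ∩ X} (S.by-rank 3 (λ s x e → s ⊑ e ⇒ ⊢ (s ⊓ x) ⊑ (x ⊓ e)) S X (E M) (S⊆E L))))))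
    where
    module D = Descent tri (E N) (rank N) connN large
    use : ∃[ K′ ] ∃[ U ] ∃[ S′ ] ∃[ f′ ] Final K′ U S′ f′ → Conclusion M N T
    use (K , U , S′ , f′ , fin) = from-final (≤-trans (s≤s (s≤s z≤n)) large) fin λ {s} {t} s∈ t∈ s≢t →
      by-rank 4 (λ k u s t → ρ (k ⊔ u) ⊞ # 2 ≼ ρ ((s ⊔ t) ⊔ (k ⊔ u)) ⇒ sub (k ⊔ u) ((s ⊔ t) ⊔ k) ⇒ ⊢ ρ k ⊞ # 2 ≼ ρ ((s ⊔ t) ⊔ k)) K U ⁅ s ⁆ ⁅ t ⁆
        (simple (label-split connN (Final.lab fin)) (≤-trans large (≤-reflexive (sym (label-size (Final.lab fin))))) s∈ t∈ s≢t)

-- Minors with at most three elements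

module SmallMinors {n m} (M : Matroid n) (N : Matroid m) {T : Subset n} (tri : Triangular (rank M) (E M) T)
  (connM : Connected (rank M) (E M)) (connN : Connected (rank N) (E N)) (f₀ : Fin n → Fin m) where

  open Assembly M N tri connM connN
  open Finals tri (E N) (rank N) using (Final; final)
  open Labels tri (E N) (rank N)
  private
    module A = Ambient M tri connM
    module R = RankTheory (rank-isRank N)

  private
    rest-N : ∀ {y} → y ∈ E N → ∣ E N ∣ ≤ ∣ E N ─ ⁅ y ⁆ ∣ + 1
    rest-N {y} y∈ = CardSolver.by-rank 2 (λ e y → ρ y ≼ # 1 ⇒ sub (e ∖ y) y ⇒ ⊢ ρ e ≼ ρ (e ∖ y) ⊞ # 1) (E N) ⁅ y ⁆ (≤-reflexive (∣⁅x⁆∣≡1 y))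

    split-N : 2 ≤ ∣ E N ∣ → ∀ {y} → y ∈ E N → 1 + rank N (E N) ≤ rank N ⁅ y ⁆ + rank N (E N ─ ⁅ y ⁆)
    split-N h {y} y∈ = connN 1 ⁅ y ⁆ ≤-refl (s≤s (s≤s z≤n)) (sing⊆ y∈) (≤-reflexive (sym (∣⁅x⁆∣≡1 y)))
      (+-cancelʳ-≤ 1 1 _ (≤-trans h (rest-N y∈)))

  nonloop-N : 2 ≤ ∣ E N ∣ → ∀ {y} → y ∈ E N → 1 ≤ rank N ⁅ y ⁆
  nonloop-N h {y} y∈ = R.by-rank 2 (λ e y → # 1 ⊞ ρ e ≼ ρ y ⊞ ρ (e ∖ y) ⇒ ⊢ # 1 ≼ ρ y) (E N) ⁅ y ⁆ (split-N h y∈)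

  module ThreeParallel (size-N : ∣ E N ∣ ≡ 3) (rank-N : rank N (E N) ≡ 1) (rank-M : 3 ≤ rank M (E M)) where

    private
      two : 2 ≤ ∣ E N ∣
      two = ≤-trans (s≤s (s≤s z≤n)) (≤-reflexive (sym size-N))

    -- The points off a hyperplane H through T become three parallel elements in the contraction of H.
    module Hyperplane {B} (T⊆B : T ⊆ B) (B⊆E : B ⊆ E M) (rank-B : rank M B + 1 ≡ rank M (E M)) where

      H P : Subset n
      H = cl B
      P = E M ─ H

      -- No copy of `N` has to be tracked here, since suitable points off `H` are chosen at the very
      -- end; so the condition keeps all of them on one side.
      Off : Subset n → Set
      Off X = P ⊆ X

      off-up : ∀ {X Y} → X ⊆ Y → Off X → Off Y
      off-up X⊆Y h m = X⊆Y (h m)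

      E⊆ : E M ⊆ P ∪ H
      E⊆ = S.by-rank 2 (λ e h → ⊢ e ⊑ ((e ∖ h) ⊔ h)) (E M) H

      start : Linked ∅ Off
      start = A.initially-linked {Off} λ {X} off → ≤-trans two-off (p⊆q⇒∣p∣≤∣q∣ {p = P} {X ∩ E M} (λ m → x∈p∩q⁺ (off m , proj₁ (∈─⁻ m))))
        where
        -- A single point off the hyperplane would be a coloop.
        two-off : 2 ≤ ∣ P ∣
        two-off with 2 ≤? ∣ P ∣
        ... | yes h = h
        ... | no few = absurd (use (nonempty? P))
          where
          rank-H : rank M H + 1 ≤ rank M (E M)
          rank-H = ≤-trans (+-monoˡ-≤ 1 (r-cl B)) (≤-reflexive rank-B)
          use : Dec (Nonempty P) → 1 ≤ 0
          use (no empty) = by-rank 2 (λ e h → (e ∖ h) ⊑ ∅ˢ ⇒ ρ h ⊞ # 1 ≼ ρ e ⇒ ⊢ # 1 ≼ # 0) (E M) H (λ {x} m → ⊥-elim (empty (x , m))) rank-H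
          use (yes (x , x∈)) = by-rank 2 (λ e h → # 1 ⊞ ρ e ≼ ρ (e ∖ h) ⊞ ρ (e ∖ (e ∖ h)) ⇒ ρ (e ∖ h) ≼ # 1 ⇒ ρ h ⊞ # 1 ≼ ρ e ⇒ ⊢ # 1 ≼ # 0) (E M) H
            (connM 1 P ≤-refl (s≤s (s≤s z≤n)) (λ m → proj₁ (∈─⁻ m)) (≤-trans (≤-reflexive (sym (∣⁅x⁆∣≡1 x))) (p⊆q⇒∣p∣≤∣q∣ {p = ⁅ x ⁆} (sing⊆ x∈)))
              (CardSolver.by-rank 2 (λ e p → # 2 ≼ ρ e ⇒ ρ p ≼ # 1 ⇒ sub p (e ∖ p) ⇒ ⊢ # 1 ≼ ρ (e ∖ p)) (E M) P
                (≤-trans (s≤s (s≤s z≤n)) (≤-trans (≤-reflexive (sym size-T)) (p⊆q⇒∣p∣≤∣q∣ T⊆E))) (≤-pred (≰⇒> few))))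
            (≤-trans (r≤card P) (≤-pred (≰⇒> few))) rank-H

      -- `M / K` keeps rank at least three. The target is rank exactly three, where `H` becomes the
      -- line spanned by `T`.
      record Stage (K : Subset n) : Set where
        constructor stage
        field
          K⊆H : K ⊆ H
          K⊆E : K ⊆ E M
          linked : Linked K Off
          low : rank M K + 3 ≤ rank M (E M)

      module _ {K} (st : Stage K) (lower : rank M K + 4 ≤ rank M (E M)) where
        open Stage st
        private
          Good : Fin n → Set
          Good z = Linked (K ∪ ⁅ z ⁆) Off
          Step : Set
          Step = ∃[ z ] (Stage (K ∪ ⁅ z ⁆) × rank M K + 1 ≤ rank M (K ∪ ⁅ z ⁆))

          extend : ∀ {z} → z ∈ H → z ∈ E M → z ∉ cl (K ∪ T) → Good z → Step
          extend {z} z∈H z∈E z∉ good = z , stage (∪-lub K⊆H (sing⊆ z∈H)) (∪-lub K⊆E (sing⊆ z∈E)) good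
              (by-rank 3 (λ e k z → ρ k ⊞ # 4 ≼ ρ e ⇒ ρ (k ⊔ z) ≼ ρ k ⊞ # 1 ⇒ ⊢ ρ (k ⊔ z) ⊞ # 3 ≼ ρ e) (E M) K ⁅ z ⁆ lower (insert-≤ K z)) ,
            ∉cl⁻ K (λ h → z∉ (cl-mono (p⊆p∪q T) h))

          weaken : ∀ X Y z → rank M X + rank M Y ≤ rank M (E M) + rank M (K ∪ ⁅ z ⁆) + 1 → rank M X + rank M Y ≤ rank M (E M) + rank M K + 2
          weaken X Y z h = by-rank 5 (λ x y e k s → ρ x ⊞ ρ y ≼ ρ e ⊞ ρ (k ⊔ s) ⊞ # 1 ⇒ ρ (k ⊔ s) ≼ ρ k ⊞ # 1 ⇒ ⊢ ρ x ⊞ ρ y ≼ ρ e ⊞ ρ k ⊞ # 2)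
            X Y (E M) K ⁅ z ⁆ h (insert-≤ K z)

          forget : ∀ {X Y z} → Cover (K ∪ ⁅ z ⁆) X Y → Cover K X Y
          forget {z = z} cov = covers (cover cov) (λ m → K⊆X cov (p⊆p∪q ⁅ z ⁆ m)) (λ m → K⊆Y cov (p⊆p∪q ⁅ z ⁆ m)) (T⊆Y cov)

          last : ∀ z → z ∈ K ∪ ⁅ z ⁆
          last z = q⊆p∪q K ⁅ z ⁆ (x∈⁅x⁆ z)

          blocked : ∀ {e} → e ∉ cl (K ∪ T) → Separated (K ∪ ⁅ e ⁆) Off → Step
          blocked {e} e∉ (X , Y , cov , off , tight) = use (Exchange.exchange linked off-up (forget cov) off test (weaken X Y e tight) (K⊆X cov
              (last e)) (K⊆Y cov (last e)) e∉)
            where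
            test : ∀ z → z ∈ E M → z ∉ cl X → z ∉ cl (K ∪ T) →
              Good z ⊎ ∃[ X₂ ] ∃[ Y₂ ] (Cover K X₂ Y₂ × z ∈ X₂ × z ∈ Y₂ × Off (X ∩ X₂) × rank M X₂ + rank M Y₂ ≤ rank M (E M) + rank M K + 2)
            test z _ _ _ = decide (linked? (K ∪ ⁅ z ⁆) (λ X → P ⊆? X))
              where
              decide : Good z ⊎ Separated (K ∪ ⁅ z ⁆) Off →
                Good z ⊎ ∃[ X₂ ] ∃[ Y₂ ] (Cover K X₂ Y₂ × z ∈ X₂ × z ∈ Y₂ × Off (X ∩ X₂) × rank M X₂ + rank M Y₂ ≤ rank M (E M) + rank M K + 2)
              decide (inj₁ good) = inj₁ good
              decide (inj₂ (X₂ , Y₂ , cov₂ , off₂ , tight₂)) = inj₂ (X₂ , Y₂ , forget cov₂ , K⊆X cov₂ (last z) , K⊆Y cov₂ (last z) ,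
                (λ m → x∈p∩q⁺ (off m , off₂ m)) , weaken X₂ Y₂ z tight₂)
            use : ∃[ z ] (z ∈ E M × z ∉ cl X × z ∉ cl (K ∪ T) × Good z) → Step
            -- `X` contains every point off `H`, so `z`, being outside `X`, lies in `H`.
            use (z , z∈E , z∉X , z∉ , good) = extend ([ (λ m → ⊥-elim (z∉X (⊆cl X (off m)))) , (λ h → h) ]′ (x∈p∪q⁻ P H (E⊆ z∈E))) z∈E z∉ good

        next-stage : Step
        next-stage = use (outside (K ∪ T) B (by-rank 4 (λ k t b e → ρ (k ⊔ t) ≼ ρ k ⊞ # 2 ⇒ ρ k ⊞ # 4 ≼ ρ e ⇒ ρ e ≼ ρ b ⊞ # 1 ⇒
            ⊢ # 1 ⊞ ρ (k ⊔ t) ≼ ρ ((k ⊔ t) ⊔ b))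
            K T B (E M) (rank-K∪T-≤ K) lower (≤-reflexive (sym rank-B))))
          where
          use : ∃[ e ] (e ∈ B × e ∉ cl (K ∪ T)) → Step
          use (e , e∈B , e∉) = decide (linked? (K ∪ ⁅ e ⁆) (λ X → P ⊆? X))
            where
            decide : Good e ⊎ Separated (K ∪ ⁅ e ⁆) Off → Step
            decide (inj₁ good) = extend (⊆cl B e∈B) (B⊆E e∈B) e∉ good
            decide (inj₂ sep) = blocked e∉ sep

      final-stage : ∀ fuel {K} → rank M (E M) < fuel + rank M K → Stage K → ∃[ K′ ] (Stage K′ × rank M (E M) ≤ rank M K′ + 3)
      final-stage zero {K} bound st = ⊥-elim (<-irrefl refl (≤-trans bound (top K)))
      final-stage (suc fuel) {K} bound st = use (rank M K + 4 ≤? rank M (E M))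
        where
        Result : Set
        Result = ∃[ K′ ] (Stage K′ × rank M (E M) ≤ rank M K′ + 3)
        use : Dec (rank M K + 4 ≤ rank M (E M)) → Result
        use (no ¬lower) = K , st , ≤-pred (≤-trans (≰⇒> ¬lower) (≤-reflexive (+-suc (rank M K) 3)))
        use (yes lower) = let z , st′ , up = next-stage st lower in
          final-stage fuel (≤-trans bound (≤-trans (≤-reflexive (sym (+-suc fuel (rank M K)))) (+-monoʳ-≤ fuel (≤-trans (≤-reflexive (+-comm 1
              (rank M K))) up)))) st′

      module _ {K} (st : Stage K) (high : rank M (E M) ≤ rank M K + 3) where
        open Stage st

        -- The cover by `K ∪ P` and `H` has connectivity at least two, and `H` is one short of full
        -- rank.
        spans-P : rank M K + 3 ≤ rank M (K ∪ P)
        spans-P = by-rank 5 (λ k p h b e → ρ e ⊞ ρ k ⊞ # 2 ≼ ρ (k ⊔ p) ⊞ ρ h ⇒ ρ h ≼ ρ b ⇒ ρ b ⊞ # 1 ≼ ρ e ⇒ ⊢ ρ k ⊞ # 3 ≼ ρ (k ⊔ p)) K P H B (E M)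
          (linked (covers (S.by-rank 4 (λ e p h k → e ⊑ (p ⊔ h) ⇒
              ⊢ e ⊑ ((k ⊔ p) ⊔ h)) (E M) P H K E⊆) (p⊆p∪q P) K⊆H (λ m → ⊆cl B (T⊆B m))) (q⊆p∪q K P))
          (r-cl B) (≤-reflexive rank-B)

        T-free : rank M K + 2 ≤ rank M (K ∪ T)
        T-free = rank-K∪T-≥ off-up (λ {x} (m : x ∈ P) → m) linked

        K∪T⊆H : K ∪ T ⊆ H
        K∪T⊆H = ∪-lub K⊆H (λ m → ⊆cl B (T⊆B m))

        cl-KT⊆H : cl (K ∪ T) ⊆ H
        cl-KT⊆H {x} m = cl⁺ B (by-rank 4 (λ b h a s → ρ h ≼ ρ b ⇒ b ⊑ h ⇒ a ⊑ h ⇒ ρ (a ⊔ s) ≼ ρ a ⇒ sub h (a ⊔ s) ⇒ ⊢ ρ (b ⊔ s) ≼ ρ b)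
          B H (K ∪ T) ⁅ x ⁆ (r-cl B) (⊆cl B) K∪T⊆H (cl⁻ (K ∪ T) m))

        three : ∃[ a ] ∃[ b ] ∃[ c ] (a ∈ P × b ∈ P × c ∈ P × rank M K + 3 ≤ rank M (((K ∪ ⁅ a ⁆) ∪ ⁅ b ⁆) ∪ ⁅ c ⁆))
        three = first (outside K P (≤-trans (≤-trans (≤-reflexive (+-comm 1 (rank M K))) (+-monoʳ-≤ (rank M K) (s≤s z≤n))) spans-P))
          where
          Result : Set
          Result = ∃[ a ] ∃[ b ] ∃[ c ] (a ∈ P × b ∈ P × c ∈ P × rank M K + 3 ≤ rank M (((K ∪ ⁅ a ⁆) ∪ ⁅ b ⁆) ∪ ⁅ c ⁆))
          first : ∃[ a ] (a ∈ P × a ∉ cl K) → Result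
          first (a , a∈ , a∉) = second (outside (K ∪ ⁅ a ⁆) P (by-rank 3 (λ k p a → ρ k ⊞ # 3 ≼ ρ (k ⊔ p) ⇒ ρ (k ⊔ a) ≼ ρ k ⊞ # 1 ⇒
              ⊢ # 1 ⊞ ρ (k ⊔ a) ≼ ρ ((k ⊔ a) ⊔ p)) K P ⁅ a ⁆ spans-P (insert-≤ K a)))
            where
            second : ∃[ b ] (b ∈ P × b ∉ cl (K ∪ ⁅ a ⁆)) → Result
            second (b , b∈ , b∉) = third (outside ((K ∪ ⁅ a ⁆) ∪ ⁅ b ⁆) P (by-rank 4 (λ k p a b → ρ k ⊞ # 3 ≼ ρ (k ⊔ p) ⇒ ρ (k ⊔ a) ≼ ρ k ⊞ # 1 ⇒
                ρ ((k ⊔ a) ⊔ b) ≼ ρ (k ⊔ a) ⊞ # 1 ⇒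
                ⊢ # 1 ⊞ ρ ((k ⊔ a) ⊔ b) ≼ ρ (((k ⊔ a) ⊔ b) ⊔ p)) K P ⁅ a ⁆ ⁅ b ⁆ spans-P (insert-≤ K a) (insert-≤ (K ∪ ⁅ a ⁆) b)))
              where
              third : ∃[ c ] (c ∈ P × c ∉ cl ((K ∪ ⁅ a ⁆) ∪ ⁅ b ⁆)) → Result
              third (c , c∈ , c∉) = a , b , c , a∈ , b∈ , c∈ , by-rank 4 (λ k a b c → ρ k ⊞ # 1 ≼ ρ (k ⊔ a) ⇒ ρ (k ⊔ a) ⊞ # 1 ≼ ρ ((k ⊔ a) ⊔ b) ⇒
                  ρ ((k ⊔ a) ⊔ b) ⊞ # 1 ≼ ρ (((k ⊔ a) ⊔ b) ⊔ c) ⇒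
                ⊢ ρ k ⊞ # 3 ≼ ρ (((k ⊔ a) ⊔ b) ⊔ c)) K ⁅ a ⁆ ⁅ b ⁆ ⁅ c ⁆ (∉cl⁻ K a∉) (∉cl⁻ (K ∪ ⁅ a ⁆) b∉) (∉cl⁻ ((K ∪ ⁅ a ⁆) ∪ ⁅ b ⁆) c∉)

        module _ {S} (S⊆P : S ⊆ P) (small : ∣ S ∣ ≤ 3) (free : rank M K + 3 ≤ rank M (S ∪ K)) where

          size-S : ∣ S ∣ ≡ 3
          size-S = ≤-antisym small (+-cancelˡ-≤ (rank M K) 3 _ (≤-trans free (≤-trans (≤-reflexive (cong (rank M) (∪-comm S K))) (union-≤ K S))))

          simple-S : Reduction.Simple tri (E N) (rank N) connN two K S
          simple-S {s} {t} s∈ t∈ s≢t = +-cancelʳ-≤ 1 _ _ (≤-trans (≤-reflexive (+-assoc (rank M K) 2 1)) (≤-trans free (≤-trans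
            (by-rank 3 (λ s a k → ⊢ ρ (s ⊔ k) ≼ ρ ((a ⊔ k) ⊔ (s ∖ a))) S st₂ K) (≤-trans (union-≤ (st₂ ∪ K) (S ─ st₂)) (+-monoʳ-≤ _ one)))))
            where
            st₂ : Subset n
            st₂ = ⁅ s ⁆ ∪ ⁅ t ⁆
            one : ∣ S ─ st₂ ∣ ≤ 1
            one = +-cancelˡ-≤ 2 _ _ (≤-trans (+-monoˡ-≤ ∣ S ─ st₂ ∣ (two-card {A = S ∩ st₂} (x∈p∩q⁺ (s∈ , p⊆p∪q ⁅ t ⁆ (x∈⁅x⁆ s))) (x∈p∩q⁺
                (t∈ , q⊆p∪q ⁅ s ⁆ ⁅ t ⁆ (x∈⁅x⁆ t))) s≢t))
              (≤-trans (≤-reflexive (sym (card-split S st₂))) small))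

          off-S : ∀ {s} → s ∈ S → s ∉ cl (K ∪ T)
          off-S s∈ h = proj₂ (∈─⁻ (S⊆P s∈)) (cl-KT⊆H h)

          -- Contracting `K ∪ T` leaves rank one, and no point off `H` becomes a loop; hence every
          -- nonempty subset of `S` gets rank one, as in `N`.
          label-S : ∀ {f} → Bijects f S (E N) → Label S f (K ∪ T)
          label-S {f} b = label b quot′ (λ m → proj₁ (∈─⁻ (S⊆P m)))
            where
            quot′ : ∀ I → I ⊆ S → rank M (I ∪ (K ∪ T)) ≡ rank N (image f I) + rank M (K ∪ T)
            quot′ I I⊆S = use (nonempty? I)
              where
              use : Dec (Nonempty I) → rank M (I ∪ (K ∪ T)) ≡ rank N (image f I) + rank M (K ∪ T)
              use (no empty) rewrite Empty-unique empty = trans (cong (rank M) (∪-identityˡ (K ∪ T)))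
                (cong (_+ rank M (K ∪ T)) (sym (trans (cong (rank N) (image-∅ f)) R.r-∅)))
              use (yes (s , s∈)) = trans (≤-antisym
                  (≤-trans (top _) (by-rank 3 (λ e k t → ρ e ≼ ρ k ⊞ # 3 ⇒ ρ k ⊞ # 2 ≼ ρ (k ⊔ t) ⇒ ⊢ ρ e ≼ # 1 ⊞ ρ (k ⊔ t)) (E M) K T high T-free))
                  (by-rank 3 (λ a i s → s ⊑ i ⇒ ρ a ⊞ # 1 ≼ ρ (a ⊔ s) ⇒
                      ⊢ # 1 ⊞ ρ a ≼ ρ (i ⊔ a)) (K ∪ T) I ⁅ s ⁆ (sing⊆ s∈) (∉cl⁻ (K ∪ T) (off-S (I⊆S s∈)))))
                (cong (_+ rank M (K ∪ T)) (sym one))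
                where
                one : rank N (image f I) ≡ 1
                one = ≤-antisym (≤-trans (rank-⊆E N (image f I)) (≤-reflexive rank-N))
                  (≤-trans (nonloop-N two (into b (I⊆S s∈))) (R.r-mono (sing⊆ (image⁺ f I s∈))))

          conclusion-S : Conclusion M N T
          conclusion-S = use (equal-size⇒bijects f₀ S (E N) (trans size-S (sym size-N)))
            where
            use : ∃[ f ] Bijects f S (E N) → Conclusion M N T
            use (f , b) = from-final two (final (λ m → m) K⊆E T-free (label-S b) (≤-trans high free) (λ x∈ x∈cl → ⊥-elim (off-S x∈ x∈cl))) simple-S

        conclusion-K : Conclusion M N T
        conclusion-K = use three
          where
          use : ∃[ a ] ∃[ b ] ∃[ c ] (a ∈ P × b ∈ P × c ∈ P × rank M K + 3 ≤ rank M (((K ∪ ⁅ a ⁆) ∪ ⁅ b ⁆) ∪ ⁅ c ⁆)) → Conclusion M N T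
          use (a , b , c , a∈ , b∈ , c∈ , free) = conclusion-S {(⁅ a ⁆ ∪ ⁅ b ⁆) ∪ ⁅ c ⁆} (∪-lub (∪-lub (sing⊆ a∈) (sing⊆ b∈)) (sing⊆ c∈))
            (CardSolver.by-rank 3 (λ a b c → ρ a ≼ # 1 ⇒ ρ b ≼ # 1 ⇒ ρ c ≼ # 1 ⇒ sub a b ⇒ sub (a ⊔ b) c ⇒ ⊢ ρ ((a ⊔ b) ⊔ c) ≼ # 3) ⁅ a ⁆ ⁅ b ⁆ ⁅ c ⁆
              (≤-reflexive (∣⁅x⁆∣≡1 a)) (≤-reflexive (∣⁅x⁆∣≡1 b)) (≤-reflexive (∣⁅x⁆∣≡1 c)))
            (≤-trans free (by-rank 4 (λ k a b c → ⊢ ρ (((k ⊔ a) ⊔ b) ⊔ c) ≼ ρ (((a ⊔ b) ⊔ c) ⊔ k)) K ⁅ a ⁆ ⁅ b ⁆ ⁅ c ⁆))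

      conclusion-H : Conclusion M N T
      conclusion-H = use (final-stage (suc (rank M (E M))) (m≤m+n _ _) (stage (λ m → ⊥-elim (∉⊥ m)) (λ m → ⊥-elim (∉⊥ m)) start (≤-trans
          (≤-reflexive (cong (_+ 3) r-∅)) rank-M)))
        where
        use : ∃[ K ] (Stage K × rank M (E M) ≤ rank M K + 3) → Conclusion M N T
        use (K , st , high) = conclusion-K st high

    conclusion : Conclusion M N T
    -- `T` has rank two and `M` rank at least three, so some set containing `T` has rank one less
    -- than `M`; its closure is the hyperplane.
    conclusion = use (rank-intermediate T (E M) (rank M (E M) ∸ 1)
        (≤-trans rank-T (∸-monoˡ-≤ 1 rank-M)) (≤-trans (m∸n≤m _ 1) (r-mono (q⊆p∪q T (E M)))))
      where
      use : ∃[ B ] (T ⊆ B × B ⊆ T ∪ E M × rank M B ≡ rank M (E M) ∸ 1) → Conclusion M N T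
      use (B , T⊆B , B⊆ , eq) = Hyperplane.conclusion-H {B} T⊆B (λ m → ∪-lub T⊆E (λ h → h) (B⊆ m))
        (trans (cong (_+ 1) eq) (m∸n+n≡m (≤-trans (s≤s z≤n) rank-M)))

-- The uniform matroids on at most three elements, apart from three parallel elements, are minors of a triangle.
module Uniform {n m} (M : Matroid n) (N : Matroid m) {T : Subset n} (tri : Triangular (rank M) (E M) T)
  (T-rank : ∀ {A} → A ⊆ T → ∣ A ∣ ≤ 2 → rank M A ≡ ∣ A ∣)
  (connM : Connected (rank M) (E M)) (connN : Connected (rank N) (E N)) (f₀ : Fin n → Fin m)
  (small : ∣ E N ∣ ≤ 3) (not-parallel : ¬ (∣ E N ∣ ≡ 3 × rank N (E N) ≡ 1)) where

  open Triangular tri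
  open RankTheory isRank
  private
    module R = RankTheory (rank-isRank N)
    module A = Ambient M tri connM
    open SmallMinors M N tri connM connN f₀ using (nonloop-N)
    rN = rank N (E N)

  T-full : ∀ {A} → A ⊆ T → 2 ≤ ∣ A ∣ → rank M A ≡ 2
  T-full {A} A⊆T h = ≤-antisym (≤-trans (r-mono A⊆T) rank-T) (use (subset-of-size A 2 h))
    where
    use : ∃[ B ] (B ⊆ A × ∣ B ∣ ≡ 2) → 2 ≤ rank M A
    use (B , B⊆A , e) = ≤-trans (≤-reflexive (sym (trans (T-rank (λ m → A⊆T (B⊆A m)) (≤-reflexive e)) e))) (r-mono B⊆A)

  -- A dependent set J that does not span N would give a 1-separation, since J or its complement is a single element.
  uniform : ∀ J → J ⊆ E N → rank N J ≡ ∣ J ∣ ⊎ rank N J ≡ rN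
  uniform J J⊆ = use (∣ J ∣ ≤? rank N J) (rN ≤? rank N J) (1 ≤? ∣ J ∣) (1 ≤? ∣ E N ─ J ∣)
    where
    contra : 1 ≤ ∣ J ∣ → 1 ≤ ∣ E N ─ J ∣ → rank N J + 1 ≤ ∣ J ∣ → rank N J + 1 ≤ rN → ⊥
    contra a b c d = split (2 ≤? ∣ E N ─ J ∣)
      where
      sep : 1 + rN ≤ rank N J + rank N (E N ─ J)
      sep = connN 1 J ≤-refl (s≤s (s≤s z≤n)) J⊆ a b
      split : Dec (2 ≤ ∣ E N ─ J ∣) → ⊥
      split (no few) = absurd (R.by-rank 2 (λ e j → # 1 ⊞ ρ e ≼ ρ j ⊞ ρ (e ∖ j) ⇒ ρ (e ∖ j) ≼ # 1 ⇒ ρ j ⊞ # 1 ≼ ρ e ⇒ ⊢ # 1 ≼ # 0) (E N) J sep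
        (≤-trans (R.r≤card (E N ─ J)) (≤-pred (≰⇒> few))) d)
      split (yes many) = absurd (R.by-rank 2 (λ e j → # 1 ⊞ ρ e ≼ ρ j ⊞ ρ (e ∖ j) ⇒ ρ j ⊞ # 1 ≼ # 1 ⇒ ⊢ # 1 ≼ # 0) (E N) J sep
        (≤-trans c (CardSolver.by-rank 2 (λ e j → j ⊑ e ⇒ ρ (j ⊔ (e ∖ j)) ⊞ ρ (j ⊓ (e ∖ j)) ≼ ρ e ⇒
            ρ j ⊞ ρ (e ∖ j) ≼ ρ (j ⊔ (e ∖ j)) ⊞ ρ (j ⊓ (e ∖ j)) ⇒
            ρ e ≼ # 3 ⇒ # 2 ≼ ρ (e ∖ j) ⇒ ⊢ ρ j ≼ # 1) (E N) J J⊆ parts (≤-reflexive (sym (card-modular J (E N ─ J)))) small many)))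
        where
        parts : ∣ J ∪ (E N ─ J) ∣ + ∣ J ∩ (E N ─ J) ∣ ≤ ∣ E N ∣
        parts = ≤-trans (≤-reflexive (card-modular J (E N ─ J))) (≤-trans
          (+-monoˡ-≤ ∣ E N ─ J ∣ (p⊆q⇒∣p∣≤∣q∣ {p = J} {E N ∩ J} (λ m → x∈p∩q⁺ (J⊆ m , m)))) (≤-reflexive (sym (card-split (E N) J))))
    use : Dec (∣ J ∣ ≤ rank N J) → Dec (rN ≤ rank N J) → Dec (1 ≤ ∣ J ∣) → Dec (1 ≤ ∣ E N ─ J ∣) → rank N J ≡ ∣ J ∣ ⊎ rank N J ≡ rN
    use (yes h) _ _ _ = inj₁ (≤-antisym (R.r≤card J) h)
    use _ (yes h) _ _ = inj₂ (≤-antisym (R.r-mono J⊆) h)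
    use (no h) _ (no empty) _ = ⊥-elim (h (≤-trans (≤-pred (≰⇒> empty)) z≤n))
    use _ (no h) _ (no empty) = ⊥-elim (h (R.by-rank 2 (λ e j → (e ∖ j) ⊑ ∅ˢ ⇒ ⊢ ρ e ≼ ρ j) (E N) J
      (λ {x} m → ⊥-elim (empty (≤-trans (≤-reflexive (sym (∣⁅x⁆∣≡1 x))) (p⊆q⇒∣p∣≤∣q∣ {p = ⁅ x ⁆} {E N ─ J} (sing⊆ m)))))))
    use (no h) (no h′) (yes a) (yes b) = ⊥-elim (contra a b (≤-trans (≤-reflexive (+-comm _ 1)) (≰⇒> h)) (≤-trans (≤-reflexive (+-comm _ 1))
        (≰⇒> h′)))

  -- With two or three elements, 3-connectedness excludes loops and coloops, so the rank is positive
  -- and less than the size. Among these sizes only three parallel elements violate the second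
  -- bound.
  bounds : rN ≤ 2 × ∣ E N ∣ ≤ rN + 1
  bounds = use (2 ≤? ∣ E N ∣)
    where
    use : Dec (2 ≤ ∣ E N ∣) → rN ≤ 2 × ∣ E N ∣ ≤ rN + 1
    use (no few) = ≤-trans (R.r≤card (E N)) (≤-trans (≤-pred (≰⇒> few)) (s≤s z≤n)) , ≤-trans (≤-pred (≰⇒> few)) (m≤n+m 1 rN)
    use (yes two) = use′ (card-pos {A = E N} (≤-trans (s≤s z≤n) two))
      where
      use′ : Nonempty (E N) → rN ≤ 2 × ∣ E N ∣ ≤ rN + 1
      use′ (y , y∈) = upper , lower (∣ E N ∣ ℕ.≟ 3) (rN ℕ.≟ 1)
        where
        pos : 1 ≤ rN
        pos = ≤-trans (nonloop-N two y∈) (R.r-mono (sing⊆ y∈))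
        rest : ∣ E N ─ ⁅ y ⁆ ∣ ≤ 2
        rest = ≤-pred (≤-trans (≤-reflexive (sym (trans (card-split (E N) ⁅ y ⁆) (cong (_+ ∣ E N ─ ⁅ y ⁆ ∣) one)))) small)
          where
          one : ∣ E N ∩ ⁅ y ⁆ ∣ ≡ 1
          one = trans (cong ∣_∣ (⊆-antisym (p∩q⊆q (E N) ⁅ y ⁆) (λ m → x∈p∩q⁺ (sing⊆ y∈ m , m)))) (∣⁅x⁆∣≡1 y)
        rest≥1 : 1 ≤ ∣ E N ─ ⁅ y ⁆ ∣
        rest≥1 = CardSolver.by-rank 2 (λ e y → # 2 ≼ ρ e ⇒ ρ y ≼ # 1 ⇒ sub (e ∖ y) y ⇒ ⊢ # 1 ≼ ρ (e ∖ y)) (E N) ⁅ y ⁆ two (≤-reflexive (∣⁅x⁆∣≡1 y))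
        upper : rN ≤ 2
        upper = R.by-rank 2 (λ e y → # 1 ⊞ ρ e ≼ ρ y ⊞ ρ (e ∖ y) ⇒ ρ y ≼ # 1 ⇒ ρ (e ∖ y) ≼ # 2 ⇒ ⊢ ρ e ≼ # 2) (E N) ⁅ y ⁆
          (connN 1 ⁅ y ⁆ ≤-refl (s≤s (s≤s z≤n)) (sing⊆ y∈) (≤-reflexive (sym (∣⁅x⁆∣≡1 y))) rest≥1) (R.r-sing y) (≤-trans (R.r≤card
              (E N ─ ⁅ y ⁆)) rest)
        lower : Dec (∣ E N ∣ ≡ 3) → Dec (rN ≡ 1) → ∣ E N ∣ ≤ rN + 1
        lower (no ne) _ = ≤-trans (≤-pred (≤∧≢⇒< small ne)) (+-monoˡ-≤ 1 pos)
        lower (yes e) (yes e′) = ⊥-elim (not-parallel (e , e′))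
        lower (yes e) (no ne) = ≤-trans small (+-monoˡ-≤ 1 (≤∧≢⇒< pos (λ e′ → ne (sym e′))))

  -- Three elements cannot provide two for each side, so only 1-separations matter. One side then
  -- has two elements and the full rank two, and the other side has a nonloop.
  connected-T : Connected (contracted ∅) T
  connected-T k X 1≤k k<3 X⊆T k≤X k≤Y = subst₂ _≤_ (cong (k +_) (plain T)) (cong₂ _+_ (plain X) (plain (T ─ X))) (use k 1≤k k<3 k≤X k≤Y (2 ≤? ∣ X ∣))
    where
    plain : ∀ A → rank M A ≡ contracted ∅ A
    plain A = sym (trans (cong (rank M (A ∪ ∅) ∸_) r-∅) (cong (rank M) (∪-identityʳ A)))
    Y = T ─ X
    Y⊆T : Y ⊆ T
    Y⊆T m = proj₁ (∈─⁻ m)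
    sizes : ∣ X ∣ + ∣ Y ∣ ≡ 3
    sizes = trans (cong (_+ ∣ Y ∣) (cong ∣_∣ (⊆-antisym {i = X} {T ∩ X} (λ m → x∈p∩q⁺ (X⊆T m , m)) (p∩q⊆q T X)))) (trans (sym
        (card-split T X)) size-T)
    pos : ∀ {A} → A ⊆ T → 1 ≤ ∣ A ∣ → 1 ≤ rank M A
    pos {A} A⊆T h = use′ (2 ≤? ∣ A ∣)
      where
      use′ : Dec (2 ≤ ∣ A ∣) → 1 ≤ rank M A
      use′ (yes two) = ≤-trans (s≤s z≤n) (≤-reflexive (sym (T-full A⊆T two)))
      use′ (no few) = ≤-trans h (≤-reflexive (sym (T-rank A⊆T (≤-trans (≤-pred (≰⇒> few)) (s≤s z≤n)))))
    use : ∀ k → 1 ≤ k → k < 3 → k ≤ ∣ X ∣ → k ≤ ∣ Y ∣ → Dec (2 ≤ ∣ X ∣) → k + rank M T ≤ rank M X + rank M Y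
    use 1 _ _ a b (yes two) = ≤-trans (+-monoʳ-≤ 1 rank-T) (≤-trans (≤-reflexive refl) (+-mono-≤ (≤-reflexive (sym (T-full X⊆T two))) (pos Y⊆T b)))
    use 1 _ _ a b (no few) = ≤-trans (+-monoʳ-≤ 1 rank-T) (+-mono-≤ (pos X⊆T a) (≤-reflexive (sym (T-full Y⊆T
      (+-cancelˡ-≤ 1 2 _ (≤-trans (≤-reflexive (sym sizes)) (+-monoˡ-≤ ∣ Y ∣ (≤-pred (≰⇒> few)))))))))
    use 2 _ _ a b _ = ⊥-elim (1+n≰n (≤-trans (+-mono-≤ a b) (≤-reflexive sizes)))
    use (suc (suc (suc k))) _ (s≤s (s≤s (s≤s ()))) _ _ _

  conclusion : Conclusion M N T
  -- Contracting 2 - r(N) elements of the triangle leaves the uniform matroid of rank r(N) on r(N) +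
  -- 1 elements; by `bounds` this is enough room for `N`.
  conclusion = use (subset-of-size T (2 ∸ rN) (≤-trans (m∸n≤m 2 rN) (≤-trans (s≤s (s≤s z≤n)) (≤-reflexive (sym size-T)))))
    where
    use : ∃[ U ] (U ⊆ T × ∣ U ∣ ≡ 2 ∸ rN) → Conclusion M N T
    use (U , U⊆T , eU) = use′ (subset-of-size (T ─ U) ∣ E N ∣ room)
      where
      eU+ : ∣ U ∣ + rN ≡ 2
      eU+ = trans (cong (_+ rN) eU) (m∸n+n≡m (proj₁ bounds))
      room : ∣ E N ∣ ≤ ∣ T ─ U ∣
      room = ≤-trans (proj₂ bounds) (+-cancelˡ-≤ ∣ U ∣ _ _ (≤-trans (≤-reflexive (trans (sym (+-assoc ∣ U ∣ rN 1)) (cong (_+ 1) eU+)))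
        (≤-trans (≤-reflexive (trans (sym size-T) (card-split T U))) (+-monoˡ-≤ ∣ T ─ U ∣ (p⊆q⇒∣p∣≤∣q∣ (p∩q⊆q T U))))))
      use′ : ∃[ S ] (S ⊆ T ─ U × ∣ S ∣ ≡ ∣ E N ∣) → Conclusion M N T
      use′ (S , S⊆ , eS) = use″ (equal-size⇒bijects f₀ S (E N) eS)
        where
        S⊆T : S ⊆ T
        S⊆T m = proj₁ (∈─⁻ (S⊆ m))
        use″ : ∃[ f ] Bijects f S (E N) → Conclusion M N T
        use″ (f , b) = package M N T {K = ∅} {W = T} {U = U} {S = S} {f = f} (λ m → ⊥-elim (∉⊥ m)) T⊆E (λ _ → ∉⊥) (λ m → m) U⊆T S⊆T
          (λ m → proj₂ (∈─⁻ (S⊆ m))) (λ m → proj₁ (∈─⁻ m)) connected-T b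
          (λ I I⊆S → subst (λ X → rank M (I ∪ X) ≡ rank N (image f I) + rank M X) (sym (∪-identityˡ U)) (quot I I⊆S))
          where
          rU : rank M U ≡ ∣ U ∣
          rU = T-rank U⊆T (≤-trans (≤-reflexive eU) (m∸n≤m 2 rN))
          quot : ∀ I → I ⊆ S → rank M (I ∪ U) ≡ rank N (image f I) + rank M U
          quot I I⊆S = decide (∣ I ∣ ≤? rN) (uniform (image f I) im⊆)
            where
            im⊆ : image f I ⊆ E N
            im⊆ h with image⁻ f I h
            ... | x , x∈ , refl = into b (I⊆S x∈)
            card : ∣ image f I ∣ ≡ ∣ I ∣
            card = card-image f I (λ a c → inj b (I⊆S a) (I⊆S c))
            IU⊆T : I ∪ U ⊆ T
            IU⊆T = ∪-lub (λ m → S⊆T (I⊆S m)) U⊆T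
            size-IU : ∣ I ∪ U ∣ ≡ ∣ I ∣ + ∣ U ∣
            size-IU = card-∪ I U (S.by-rank 3 (λ i u t → i ⊑ (t ∖ u) ⇒ ⊢ (i ⊓ u) ⊑ ∅ˢ) I U T (λ m → S⊆ (I⊆S m)))
            below : ∣ I ∣ ≤ rN → ∣ I ∪ U ∣ ≤ 2
            below h = ≤-trans (≤-reflexive size-IU) (≤-trans (+-monoˡ-≤ ∣ U ∣ h) (≤-reflexive (trans (+-comm rN ∣ U ∣) eU+)))
            above : rN ≤ ∣ I ∣ → 2 ≤ ∣ I ∪ U ∣
            above h = ≤-trans (≤-reflexive (trans (sym eU+) (+-comm ∣ U ∣ rN))) (≤-trans (+-monoˡ-≤ ∣ U ∣ h) (≤-reflexive (sym size-IU)))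
            as-size : ∣ I ∣ ≤ rN → rank N (image f I) ≡ ∣ I ∣ → rank M (I ∪ U) ≡ rank N (image f I) + rank M U
            as-size h e = trans (T-rank IU⊆T (below h)) (trans size-IU (sym (cong₂ _+_ e rU)))
            as-full : rN ≤ ∣ I ∣ → rank N (image f I) ≡ rN → rank M (I ∪ U) ≡ rank N (image f I) + rank M U
            as-full h e = trans (T-full IU⊆T (above h)) (sym (trans (cong₂ _+_ e rU) (trans (+-comm rN ∣ U ∣) eU+)))
            decide : Dec (∣ I ∣ ≤ rN) → rank N (image f I) ≡ ∣ image f I ∣ ⊎ rank N (image f I) ≡ rN → rank M (I ∪ U) ≡ rank N (image f I) + rank M U
            decide (yes h) (inj₁ e) = as-size h (trans e card)
            decide (yes h) (inj₂ e) = as-size h (≤-antisym (≤-trans (R.r≤card (image f I)) (≤-reflexive card)) (≤-trans h (≤-reflexive (sym e))))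
            decide (no h) (inj₁ e) = as-full (<⇒≤ (≰⇒> h)) (≤-antisym (R.r-mono im⊆) (≤-trans (<⇒≤ (≰⇒> h)) (≤-reflexive (sym (trans e card)))))
            decide (no h) (inj₂ e) = as-full (<⇒≤ (≰⇒> h)) e

-- Cases by the size and the rank of N

theorem1p2 : ∀ {n m} (M : Matroid n) (N : Matroid m) (T : Subset n) →
    IsBinary M → ThreeConnected M → ThreeConnected N →
    Σ (Matroid n) (λ N₀ → IsMinor M N₀ × Isomorphic N₀ N) →
    IsTriangle M T →
    Σ (Matroid n) λ M′ → IsMinor M M′ × ThreeConnected M′ × T ⊆ E M′ ×
    Σ (Matroid n) λ N′ → IsMinor M′ N′ × Isomorphic N′ N × (E M′ ─ E N′) ⊆ T
theorem1p2 {n} {m} M N T binary conn-M conn-N (N₀ , isMinor , iso) triangle = use (minor⇒quotient M N T {N₀} isMinor iso)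
  where
  tri : Triangular (rank M) (E M) T
  tri = binary-triangular M binary T triangle
  connM = connected⇐ M conn-M
  connN = connected⇐ N conn-N
  open Labels tri (E N) (rank N)
  module Amb = Ambient M tri connM
  use : ∃[ S ] ∃[ C ] ∃[ f ] (S ⊆ E M × C ⊆ E M × Bijects f S (E N) × (∀ {s} → s ∈ S → s ∉ C) ×
          (∀ I → I ⊆ S → rank M (I ∪ C) ≡ rank N (image f I) + rank M C)) → Conclusion M N T
  use (S , C , f , S⊆ , C⊆ , b , avoid , q) = cases (4 ≤? ∣ E N ∣) (∣ E N ∣ ℕ.≟ 3) (rank N (E N) ℕ.≟ 1)
    where
    L : Label S f C
    L = label b q S⊆
    -- Otherwise S, the triangle and the whole ground set coincide and C is empty.
    four : ∣ E N ∣ ≡ 3 → rank N (E N) ≡ 1 → 4 ≤ ∣ E M ∣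
    four size-N rank-N with 4 ≤? ∣ E M ∣
    ... | yes h = h
    ... | no few = absurd (by-rank 4 (λ t s c e → t ⊑ s ⇒ c ⊑ ∅ˢ ⇒ ρ (s ⊔ c) ≼ # 1 ⊞ ρ c ⇒ ρ ∅ˢ ≼ # 0 ⇒ # 2 ≼ ρ t ⇒ ⊢ # 1 ≼ # 0) T S C (E M)
        (λ m → E⊆S (T⊆E m)) (λ m → ⊥-elim (avoid (E⊆S (C⊆ m)) m))
        (≤-reflexive (trans (q S (λ m → m)) (cong (_+ rank M C) (trans (cong (rank N) (label-image L)) rank-N)))) (≤-reflexive r-∅) Amb.rank-T≥2)
      where
      E⊆S : E M ⊆ S
      E⊆S = card-≥⇒⊇ {A = S} {E M} S⊆ (≤-trans (≤-pred (≰⇒> few)) (≤-reflexive (sym (trans (label-size L) size-N))))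
    cases : Dec (4 ≤ ∣ E N ∣) → Dec (∣ E N ∣ ≡ 3) → Dec (rank N (E N) ≡ 1) → Conclusion M N T
    cases (yes large) _ _ = Assembly.large-case M N tri connM connN large L C⊆
    cases (no _) (yes size-N) (yes rank-N) = SmallMinors.ThreeParallel.conclusion M N tri connM connN f size-N rank-N (Amb.rank≥3
        (four size-N rank-N))
    cases (no ¬large) (no ne) _ = Uniform.conclusion M N tri (proper-rank M binary T triangle) connM connN f (≤-pred (≰⇒> ¬large)) (λ p → ne
        (proj₁ p))
    cases (no ¬large) (yes _) (no ne) = Uniform.conclusion M N tri (proper-rank M binary T triangle) connM connN f (≤-pred (≰⇒> ¬large))
        (λ p → ne (proj₂ p))
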